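{- For every pair of integers $r,k \ge 3$, there exists $K = K(r,k) > 0$ such that the following holds for all $n \in \mathbb{N}$. Given an $r$-graph $G$ on $[n]$ with $|E(G)| = t n^{r-1}$ for some $t \ge 2k(r-1)$, there exists a $k$-graph $\mathcal{H}$ with vertex set $E(G)$, where each edge of $\mathcal{H}$ is (the edge set of) a copy of $C^r_k$ in $G$, such that (1) $d(\mathcal{H}) \ge K^{ -1} t^{k-2} D^{k-1}$, and (2) $\Delta_j(\mathcal{H}) \le K t^{k-j-1} D^{k-j}$ for each $1 \le j \le k-1$, where $D = t^2 n^{r-4}$ if $r \ge 4$ and $D = t$ if $r = 3$.
   Context: An $r$-graph is a pair $(V,E)$ of finite sets with $E$ a family of $r$-element subsets of $V$. The $r$-uniform linear $k$-cycle $C^r_k$ is the $r$-graph on $k(r-1)$ vertices whose vertices can be ordered cyclically so that its $k$ edges are sets of $r$ consecutive vertices in this ordering and every two consecutive edges share exactly one vertex. For a hypergraph $\mathcal{H}$ and a set $\sigma$ of vertices, $\deg_{\mathcal{H}}(\sigma)$ is the number of edges of $\mathcal{H}$ containing $\sigma$; $\Delta_j(\mathcal{H})$ is the maximum of $\deg_{\mathcal{H}}(\sigma)$ over all $j$-element vertex sets $\sigma$. The average degree of a $k$-graph $\mathcal{H}$ is $d(\mathcal{H}) = k|E(\mathcal{H})|/|V(\mathcal{H})|$. -}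

module Defs where

open import Data.Bool using (Bool; true; false; _∧_)
open import Data.Nat as ℕ using (ℕ; zero; suc; _+_; _*_; _∸_; _%_; _⊔_)
open import Data.Fin as Fin using (Fin; toℕ)
open import Data.Fin.Subset using (Subset; ∣_∣; _⊆_; _∈_; inside; outside)
open import Data.Fin.Subset.Properties using (_⊆?_)
open import Data.List using (List; []; _∷_; [_]; _++_; length; filter; map; foldr; upTo; allFin; lookup)
open import Data.Bool.ListAction using (any)
open import Data.List.Relation.Unary.All using (All)
open import Data.List.Relation.Unary.Unique.Propositional using (Unique)
open import Data.List.Membership.Propositional using () renaming (_∈_ to _∈ₗ_)
open import Data.Vec using (Vec; tabulate; []; _∷_)
open import Data.Product using (Σ; _×_)
open import Data.Integer using (+_)
open import Data.Rational as ℚ using (ℚ; Positive; 1/_; _/_)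
open import Data.Rational.Properties using (pos⇒nonZero)
open import Function using (_⇔_)
open import Function.Definitions using (Injective)
open import Relation.Binary.PropositionalEquality using (_≡_)
open import Relation.Nullary.Decidable using (⌊_⌋; yes; no)

ℕtoℚ : ℕ → ℚ
ℕtoℚ m = (+ m) / 1

_^ℚ_ : ℚ → ℕ → ℚ
p ^ℚ zero  = ℚ.1ℚ
p ^ℚ suc e = p ℚ.* (p ^ℚ e)

inv : (K : ℚ) → Positive K → ℚ
inv K pos = (1/ K) {{pos⇒nonZero K {{pos}}}}

record RGraph (r n : ℕ) : Set where
  field
    edges    : List (Subset n)
    distinct : Unique edges
    uniform  : All (λ e → ∣ e ∣ ≡ r) edges

open RGraph public

numEdges : ∀ {r n} → RGraph r n → ℕ
numEdges G = length (edges G)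

-- the i-th edge of G (vertices of H are the indices Fin |E(G)|)
edgeAt : ∀ {r n} (G : RGraph r n) → Fin (numEdges G) → Subset n
edgeAt G i = lookup (edges G) i

-- The r-uniform linear k-cycle C^r_k on the vertex set Fin (k(r-1)),
-- vertices cyclically ordered 0,1,...,k(r-1)-1; its i-th edge (i < k)
-- is {i(r-1), i(r-1)+1, ..., i(r-1)+r-1} (indices mod k(r-1)).

cycleEdge : (k r : ℕ) → ℕ → Subset (k * (r ∸ 1))
cycleEdge k r i = go (k * (r ∸ 1))
  where
  go : (L : ℕ) → Subset L
  go zero    = []
  go (suc L) = tabulate (λ v →
    any (λ j → ⌊ ((i * (r ∸ 1) + j) % suc L) ℕ.≟ toℕ v ⌋) (upTo r))

cycleEdges : (k r : ℕ) → List (Subset (k * (r ∸ 1)))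
cycleEdges k r = map (cycleEdge k r) (upTo k)

image : ∀ {L n} → (Fin L → Fin n) → Subset L → Subset n
image {L} φ e = tabulate (λ u →
  any (λ v → isIn v ∧ ⌊ φ v Fin.≟ u ⌋) (allFin L))
  where
  isIn : Fin L → Bool
  isIn v with Data.Vec.lookup e v
  ... | inside  = true
  ... | outside = false

IsCycleCopy : ∀ {r n} (k : ℕ) (G : RGraph r n) → Subset (numEdges G) → Set
IsCycleCopy {r} {n} k G h =
  Σ (Fin (k * (r ∸ 1)) → Fin n) λ φ →
    Injective _≡_ _≡_ φ ×
    All (λ c → image φ c ∈ₗ edges G) (cycleEdges k r) ×
    (∀ i → (i ∈ h) ⇔ (edgeAt G i ∈ₗ map (image φ) (cycleEdges k r)))

record CycleHGraph {r n : ℕ} (k : ℕ) (G : RGraph r n) : Set where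
  field
    hedges    : List (Subset (numEdges G))
    hdistinct : Unique hedges
    huniform  : All (λ e → ∣ e ∣ ≡ k) hedges
    hcopies   : All (IsCycleCopy k G) hedges

open CycleHGraph public

allSubsets : (m : ℕ) → List (Subset m)
allSubsets zero    = [ [] ]
allSubsets (suc m) = map (outside ∷_) (allSubsets m) ++ map (inside ∷_) (allSubsets m)

module _ {r n k : ℕ} {G : RGraph r n} (H : CycleHGraph k G) where

  deg : Subset (numEdges G) → ℕ
  deg σ = length (filter (σ ⊆?_) (hedges H))

  -- Δ_j(H): maximum of deg_H(σ) over j-element vertex sets σ (0 if none)
  Δ : ℕ → ℕ
  Δ j = foldr _⊔_ 0 (map deg (filter (λ σ → ∣ σ ∣ ℕ.≟ j) (allSubsets (numEdges G))))

  -- average degree d(H) = k |E(H)| / |V(H)|, with |V(H)| = |E(G)|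
  -- (set to 0 when V(H) is empty, where it is undefined)
  avgDeg : ℚ
  avgDeg = go (numEdges G)
    where
    go : ℕ → ℚ
    go zero    = ℚ.0ℚ
    go (suc v) = (+ (k * length (hedges H))) / suc v

Dval : ℕ → ℕ → ℚ → ℚ
Dval r n t with r ℕ.≟ 3
... | yes _ = t
... | no  _ = (t ^ℚ 2) ℚ.* (ℕtoℚ n ^ℚ (r ∸ 4))

{-# OPTIONS --safe #-}

-- Pass to ordered edges and delete those lying in a thin fibre, a fibre being the set of ordered edges with
-- one of the first three vertices, or all vertices from the fourth on, left free.  At least |E(G)| ordered edges
-- survive, and now all fibres have size at least s ~ t (one vertex free) resp. b ~ t n^(r-4) (the last r - 3 free;
-- b = 1 if r = 3).  Cut every fibre into blocks of size between s and 2s, resp. b and 2b.  Lying in the same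
-- block is a symmetric relation of bounded degree, even when G itself is very irregular.
--
-- Triangulate the k-gon of degree-two vertices of the cycle as a fan.  All triangles of the fan, and the triangles on its
-- sides, are extended by the same r - 3 vertices to edges of G that are neighbours for the block relation; on all sides
-- but one the r - 3 vertices are then exchanged, again within a block.  Choosing the vertices greedily, each step has
-- a positive proportion of a block available, whence |E(G)| s^(2k-3) b^(k-1) cycles up to a constant, where
-- s^(2k-3) b^(k-1) ~ t^(k-2) D^(k-1).  Since the relations are symmetric, the same tree can be explored from any edge
-- of the cycle: given j edges, at most 2(k-j) - 1 vertices and k - j blocks remain, each with at most 2s, resp. 2b,
-- choices, which bounds the degrees.
module Submission where

open import Defs
open import Data.Bool using (Bool; true; false; not)
import Data.Bool.Properties as BoolP
open import Data.Bool.ListAction using (any)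
open import Data.Empty using (⊥; ⊥-elim)
open import Data.Fin using (Fin; toℕ; fromℕ<; cast; remQuot; combine)
open import Data.Fin.Patterns using (0F; 1F; 2F; 3F)
import Data.Fin.Properties as FinP
open import Data.Fin.Subset using (Subset; ∣_∣; inside; outside) renaming (_∈_ to _∈ˢ_; _⊆_ to _⊆ˢ_)
import Data.Fin.Subset.Properties as SubP
import Data.Integer as ℤ
import Data.Integer.Properties as ℤP
open import Data.List as List using (List; []; _∷_; [_]; _++_; length; filter; map; concat; concatMap; cartesianProductWith; allFin; upTo; deduplicate; foldr)
open import Data.List.Membership.Propositional using (_∈_; _∉_; find)
open import Data.List.Membership.Propositional.Properties
open import Data.List.Properties using (length-++; length-map; length-tabulate; length-upTo; map-++; map-∘; map-cong-local; ++-assoc; ++-identityʳ; ∷-injective; ≡-dec)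
open import Data.List.Relation.Binary.Disjoint.Propositional using (Disjoint)
open import Data.List.Relation.Binary.Permutation.Propositional using (_↭_; ↭-trans; ↭-refl; prep)
open import Data.List.Relation.Binary.Permutation.Propositional.Properties using (shift; map⁺; ↭-length; ∈-resp-↭)
open import Data.List.Relation.Unary.All as All using (All; []; _∷_)
open import Data.List.Relation.Unary.All.Properties using (all-filter)
import Data.List.Relation.Unary.All.Properties as AllP
open import Data.List.Relation.Unary.AllPairs as AllPairs using (AllPairs; []; _∷_)
import Data.List.Relation.Unary.AllPairs.Properties as AllPairsP
open import Data.List.Relation.Unary.Any as Any using (Any; here; there)
open import Data.List.Relation.Unary.Any.Properties using (lookup-index)
import Data.List.Relation.Unary.Unique.DecPropositional.Properties as UniqueDecP
open import Data.List.Relation.Unary.Unique.Propositional using (Unique)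
import Data.List.Relation.Unary.Unique.Propositional.Properties as UniqueP
open import Data.Nat using (ℕ; zero; suc; _+_; _*_; _∸_; _^_; _/_; _⊔_; _≤_; _<_; z≤n; s≤s; s≤s⁻¹; _≟_; _<?_; NonZero; >-nonZero)
open import Data.Nat.DivMod using (_%_; m<n⇒m%n≡m; n%n≡0; m/n*n≤m; m*n/n≡m; /-monoˡ-≤; m≡m%n+[m/n]*n; m%n<n)
open import Data.Nat.ListAction using (sum; product)
open import Data.Nat.ListAction.Properties using (sum-++; sum-↭; product-++; product-↭; product≢0)
open import Data.Nat.Properties
open import Data.Nat.Tactic.RingSolver using (solve-∀)
open import Data.Product using (Σ; _×_; _,_; proj₁; proj₂; ∃; uncurry)
open import Data.Rational as ℚ using (ℚ; Positive; 0ℚ; 1ℚ; positive; nonNegative) renaming (_≤_ to _≤ℚ_; _*_ to _*ℚ_)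
import Data.Rational.Properties as ℚP
import Data.Rational.Solver as ℚSolver
import Data.Rational.Unnormalised as ℚᵘ
import Data.Rational.Unnormalised.Properties as ℚᵘP
open import Data.Sum using (_⊎_; inj₁; inj₂; [_,_]′)
open import Data.Vec as Vec using (Vec; lookup; _[_]≔_)
import Data.Vec.Properties as VecP
open import Function using (_∘_; id; mk⇔)
open import Function.Definitions using (Injective)
open import Relation.Binary using (DecidableEquality)
open import Relation.Binary.PropositionalEquality using (_≡_; _≢_; refl; sym; trans; cong; cong₂; subst; subst₂; module ≡-Reasoning)
open import Relation.Nullary using (¬_; Dec; yes; no; does; contradiction)
open import Relation.Nullary.Decidable using (⌊_⌋; ¬?; _⊎-dec_; dec-true; map′)
open import Relation.Unary using (Decidable)

-- Counting in lists

-- The hypothesis t ≥ 2k(r-1) leaves little slack, and this fixes the constants. The cycle has `M` =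
-- k(r-1) vertices, and a vertex can be chosen greedily only from a block with at least `M` members.
-- For the smallest admissible t this is t/2, so fibres of up to about t/2 members have to count as
-- thin. There are 3 n^(r-1) fibres with a free vertex, so deleting the thin ones may cost 3/2
-- |E(G)| ordered edges: one ordering per edge would not survive this. Therefore each edge enters
-- with r orderings, while the set of possible fibres stays the same. Half of these r |E(G)| ordered
-- edges may be lost, of which 3/2 |E(G)| is the share of the three vertices and w/2 |E(G)| that of
-- the last w = r - 3 coordinates. The second share also fits: a used vertex spoils at most w
-- n^(w-1) choices of the last w coordinates, and M w n^(w-1) ≤ w |E(G)| / (2 n^3) follows from the
-- same inequality |E(G)| ≥ 2 M n^(r-1).

private variable
  I V : Set

-- With the complement `zs` explicit, comparing lengths, sums or products over the two lists reduces
-- to how the fold behaves on `++`.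
unique-⊆⇒↭ : {xs ys : List I} → Unique xs → (∀ {x} → x ∈ xs → x ∈ ys) →
              ∃ λ zs → ys ↭ xs ++ zs
unique-⊆⇒↭ {xs = []} {ys} _ _ = ys , ↭-refl
unique-⊆⇒↭ {xs = x ∷ xs} (x≢ ∷ u) sub with ∈-∃++ (sub (here refl))
... | as , bs , refl =
  let zs , p = unique-⊆⇒↭ u sub′ in zs , ↭-trans (shift x as bs) (prep x p)
  where
  sub′ : ∀ {y} → y ∈ xs → y ∈ as ++ bs
  sub′ y∈ with ∈-resp-↭ (shift x as bs) (sub (there y∈))
  ... | here refl = contradiction refl (All.lookup x≢ y∈)
  ... | there q = q

module _ {xs ys : List I} (u : Unique xs) (sub : ∀ {x} → x ∈ xs → x ∈ ys) where

  unique-⊆⇒length≤ : length xs ≤ length ys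
  unique-⊆⇒length≤ with unique-⊆⇒↭ u sub
  ... | zs , p rewrite ↭-length p | length-++ xs {zs} = m≤m+n _ _

  unique-⊆⇒sum≤ : (f : I → ℕ) → sum (map f xs) ≤ sum (map f ys)
  unique-⊆⇒sum≤ f with unique-⊆⇒↭ u sub
  ... | zs , p rewrite sum-↭ (map⁺ f p) | map-++ f xs zs | sum-++ (map f xs) (map f zs) = m≤m+n _ _

  unique-⊆⇒product≤ : (f : I → ℕ) → (∀ i → 1 ≤ f i) → product (map f xs) ≤ product (map f ys)
  unique-⊆⇒product≤ f 1≤f with unique-⊆⇒↭ u sub
  ... | zs , p rewrite product-↭ (map⁺ f p) | map-++ f xs zs | product-++ (map f xs) (map f zs) =
    m≤m*n _ _ {{product≢0 (AllP.map⁺ (All.universal (λ z → >-nonZero (1≤f z)) zs))}}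

length-filter-¬ : {P : I → Set} (P? : Decidable P) (xs : List I) →
                  length (filter P? xs) + length (filter (¬? ∘ P?) xs) ≡ length xs
length-filter-¬ P? [] = refl
length-filter-¬ P? (x ∷ xs) with P? x
... | yes _ = cong suc (length-filter-¬ P? xs)
... | no  _ = trans (+-suc _ _) (cong suc (length-filter-¬ P? xs))

-- Q stands for the properties of L that survive passing to the sublist of elements in one class.
length≤classes*size : (Q : List I → Set) → (∀ {P : I → Set} (P? : Decidable P) {L} → Q L → Q (filter P? L)) →
  {P : V → I → Set} (P? : ∀ v → Decidable (P v)) (B : ℕ) (vs : List V) (L : List I) → Q L →
  All (λ a → ∃ λ v → v ∈ vs × P v a) L →
  (∀ v → v ∈ vs → ∀ L′ → Q L′ → All (P v) L′ → length L′ ≤ B) →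
  length L ≤ length vs * B
length≤classes*size Q cl P? B [] [] q cov bd = z≤n
length≤classes*size Q cl P? B [] (a ∷ L) q ((v , () , _) ∷ _) bd
length≤classes*size {I = I} Q cl {P} P? B (v ∷ vs) L q cov bd = begin
  length L                                                         ≡⟨ length-filter-¬ (P? v) L ⟨
  length (filter (P? v) L) + length (filter (¬? ∘ P? v) L)         ≤⟨ +-mono-≤ (bd v (here refl) _ (cl (P? v) q) (all-filter (P? v) L)) rest ⟩
  B + length vs * B                                                ∎
  where
  open ≤-Reasoning
  cov′ : All (λ a → ∃ λ u → u ∈ vs × P u a) (filter (¬? ∘ P? v) L)
  cov′ = All.zipWith (λ { ((u , here refl , p) , ¬p) → contradiction p ¬p ; ((u , there i , p) , _) → u , i , p })
           (AllP.filter⁺ (¬? ∘ P? v) cov , all-filter (¬? ∘ P? v) L)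
  rest = length≤classes*size Q cl P? B vs (filter (¬? ∘ P? v) L) (cl (¬? ∘ P? v) q) cov′ (λ u u∈ → bd u (there u∈))

unique-++ʳ : (xs : List I) {ys : List I} → Unique (xs ++ ys) → Unique ys
unique-++ʳ []       u       = u
unique-++ʳ (x ∷ xs) (_ ∷ u) = unique-++ʳ xs u

unique-++ˡ : (xs : List I) {ys : List I} → Unique (xs ++ ys) → Unique xs
unique-++ˡ []       u        = []
unique-++ˡ (x ∷ xs) (x≢ ∷ u) = AllP.++⁻ˡ xs x≢ ∷ unique-++ˡ xs u

unique-++-disjoint : (xs : List I) {ys : List I} → Unique (xs ++ ys) → ∀ {v} → v ∈ xs → v ∈ ys → ⊥
unique-++-disjoint (x ∷ xs) (x≢ ∷ u) (here refl) q = All.lookup x≢ (∈-++⁺ʳ xs q) refl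
unique-++-disjoint (x ∷ xs) (_ ∷ u)  (there p)   q = unique-++-disjoint xs u p q

unique-concat⁻ : (xss : List (List I)) → Unique (concat xss) → All Unique xss
unique-concat⁻ []         _ = []
unique-concat⁻ (xs ∷ xss) u = unique-++ˡ xs u ∷ unique-concat⁻ xss (unique-++ʳ xs u)

-- A list is cut from the right into pieces of length d; a short leftover piece is glued to its neighbour.
module Blocks {I : Set} (_≟_ : DecidableEquality I) (d : ℕ) where

  open import Data.List.Membership.DecPropositional _≟_ using (_∈?_)

  split : List I → List I × List (List I)
  split [] = [] , []
  split (x ∷ xs) with suc (length (proj₁ (split xs))) <? d
  ... | yes _ = x ∷ proj₁ (split xs) , proj₂ (split xs)
  ... | no  _ = [] , (x ∷ proj₁ (split xs)) ∷ proj₂ (split xs)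

  merge : List I → List (List I) → List (List I)
  merge xs []       = xs ∷ []
  merge xs (c ∷ cs) = (xs ++ c) ∷ cs

  blocks : List I → List (List I)
  blocks xs = merge (proj₁ (split xs)) (proj₂ (split xs))

  concat-split : ∀ xs → proj₁ (split xs) ++ concat (proj₂ (split xs)) ≡ xs
  concat-split [] = refl
  concat-split (x ∷ xs) with suc (length (proj₁ (split xs))) <? d
  ... | yes _ = cong (x ∷_) (concat-split xs)
  ... | no  _ = cong (x ∷_) (concat-split xs)

  concat-merge : ∀ xs cs → concat (merge xs cs) ≡ xs ++ concat cs
  concat-merge xs []       = refl
  concat-merge xs (c ∷ cs) = ++-assoc xs c (concat cs)

  concat-blocks : ∀ xs → concat (blocks xs) ≡ xs
  concat-blocks xs = trans (concat-merge (proj₁ (split xs)) (proj₂ (split xs))) (concat-split xs)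

  module _ (1≤d : 1 ≤ d) where

    split-short : ∀ xs → length (proj₁ (split xs)) < d
    split-short [] = 1≤d
    split-short (x ∷ xs) with suc (length (proj₁ (split xs))) <? d
    ... | yes p = p
    ... | no  _ = 1≤d

    split-full : ∀ xs → All (λ c → length c ≡ d) (proj₂ (split xs))
    split-full [] = []
    split-full (x ∷ xs) with suc (length (proj₁ (split xs))) <? d
    ... | yes _ = split-full xs
    ... | no  p = ≤-antisym (split-short xs) (≮⇒≥ p) ∷ split-full xs

    merge-size : ∀ xs cs → d ≤ length (xs ++ concat cs) → length xs < d → All (λ c → length c ≡ d) cs →
                 All (λ c → d ≤ length c × length c ≤ 2 * d) (merge xs cs)
    merge-size xs [] d≤ <d [] = contradiction (subst (λ l → d ≤ length l) (++-identityʳ xs) d≤) (<⇒≱ <d)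
    merge-size xs (c ∷ cs) d≤ <d (eq ∷ eqs) =
      (subst (d ≤_) (sym eq′) (m≤n+m d _) , subst₂ _≤_ (sym eq′) (cong (d +_) (sym (+-identityʳ d))) (+-monoˡ-≤ d (<⇒≤ <d))) ∷
      All.map (λ { refl → ≤-refl , m≤m+n d _ }) eqs
      where
      eq′ : length (xs ++ c) ≡ length xs + d
      eq′ = trans (length-++ xs) (cong (length xs +_) eq)

    blocks-size : ∀ xs → d ≤ length xs → All (λ c → d ≤ length c × length c ≤ 2 * d) (blocks xs)
    blocks-size xs d≤ = merge-size (proj₁ (split xs)) (proj₂ (split xs)) (subst (λ l → d ≤ length l) (sym (concat-split xs)) d≤)
                          (split-short xs) (split-full xs)

  blockOf : List (List I) → I → List I
  blockOf []       a = []
  blockOf (c ∷ cs) a with a ∈? c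
  ... | yes _ = c
  ... | no  _ = blockOf cs a

  blockOf-∈ : ∀ cs {a} → a ∈ concat cs → blockOf cs a ∈ cs × a ∈ blockOf cs a
  blockOf-∈ (c ∷ cs) {a} a∈ with a ∈? c
  ... | yes p = here refl , p
  ... | no ¬p with ∈-++⁻ c a∈
  ...   | inj₁ p = contradiction p ¬p
  ...   | inj₂ p = let q , r = blockOf-∈ cs p in there q , r

  blockOf-⊆ : ∀ cs a {x} → x ∈ blockOf cs a → x ∈ concat cs
  blockOf-⊆ (c ∷ cs) a x∈ with a ∈? c
  ... | yes _ = ∈-++⁺ˡ x∈
  ... | no  _ = ∈-++⁺ʳ c (blockOf-⊆ cs a x∈)

  -- The pieces are disjoint, so the first piece found to contain `x` can only be the one found for
  -- `a`. This is the source of the symmetry of the block relation.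
  blockOf-≡ : ∀ cs → Unique (concat cs) → ∀ {a x} → x ∈ blockOf cs a → blockOf cs x ≡ blockOf cs a
  blockOf-≡ (c ∷ cs) u {a} {x} x∈ with a ∈? c | x ∈? c
  ... | yes _ | yes _ = refl
  ... | yes _ | no ¬p = contradiction x∈ ¬p
  ... | no  _ | yes p = ⊥-elim (unique-++-disjoint c u p (blockOf-⊆ cs a x∈))
  ... | no  _ | no  _ = blockOf-≡ cs (unique-++ʳ c u) x∈

-- Deleting thin fibres and dividing the remaining ones into blocks

module Prune {T Q K : Set} (_≟K_ : DecidableEquality K)
             (qs : List Q) (key : Q → T → K) (th : Q → ℕ) where

  fibre : Q → K → List T → List T
  fibre q x = filter (λ a → key q a ≟K x)

  Thick : List T → T → Q → Set
  Thick A a q = th q < length (fibre q (key q a) A)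

  -- Each removal of a thin fibre uses up one key (q , x) for good and costs at most th q elements.
  prune : (keys : List (Q × K)) (A : List T) → Unique A → (∀ {a q} → a ∈ A → q ∈ qs → (q , key q a) ∈ keys) →
          ∃ λ A′ → Unique A′ × (∀ a → a ∈ A′ → a ∈ A) ×
            length A ≤ length A′ + sum (map (th ∘ proj₁) keys) ×
            (∀ a q → a ∈ A′ → q ∈ qs → Thick A′ a q)
  prune keys A = go (length keys) keys ≤-refl A
    where
    go : ∀ fuel keys → length keys ≤ fuel → (A : List T) → Unique A → (∀ {a q} → a ∈ A → q ∈ qs → (q , key q a) ∈ keys) →
         ∃ λ A′ → Unique A′ × (∀ a → a ∈ A′ → a ∈ A) ×
           length A ≤ length A′ + sum (map (th ∘ proj₁) keys) ×
           (∀ a q → a ∈ A′ → q ∈ qs → Thick A′ a q)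
    go fuel keys ≤fuel A u keyed with All.all? (λ a → All.all? (λ q → th q <? length (fibre q (key q a) A)) qs) A
    ... | yes thick = A , u , (λ _ a∈ → a∈) , m≤m+n _ _ , λ a q a∈ q∈ → All.lookup (All.lookup thick a∈) q∈
    ... | no ¬thick with find (AllP.¬All⇒Any¬ (λ a → All.all? (λ q → th q <? length (fibre q (key q a) A)) qs) A ¬thick)
    ... | a , a∈ , ¬thick′ with find (AllP.¬All⇒Any¬ (λ q → th q <? length (fibre q (key q a) A)) qs ¬thick′)
    ... | q , q∈ , thin with ∈-∃++ (keyed a∈ q∈)
    ... | xs , ys , refl = remove fuel ≤fuel
      where
      same? : ∀ b → Dec (key q b ≡ key q a)
      same? b = key q b ≟K key q a
      A₁ = filter (¬? ∘ same?) A
      keyed₁ : ∀ {b p} → b ∈ A₁ → p ∈ qs → (p , key p b) ∈ xs ++ ys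
      keyed₁ b∈ p∈ with ∈-filter⁻ (¬? ∘ same?) b∈
      ... | b∈A , b≢ with ∈-resp-↭ (shift (q , key q a) xs ys) (keyed b∈A p∈)
      ... | here eq = contradiction (subst (λ p′ → key p′ _ ≡ key q a) (cong proj₁ eq) (cong proj₂ eq)) b≢
      ... | there r = r
      remove : ∀ fuel → length (xs ++ [ q , key q a ] ++ ys) ≤ fuel → _
      remove zero ≤0 = contradiction (subst (_≤ 0) (↭-length (shift (q , key q a) xs ys)) ≤0) λ ()
      remove (suc fuel) ≤1+f =
        let A′ , u′ , sub , big , thick = go fuel (xs ++ ys) (s≤s⁻¹ (subst (_≤ suc fuel) (↭-length (shift (q , key q a) xs ys)) ≤1+f))
                                             A₁ (UniqueP.filter⁺ (¬? ∘ same?) u) keyed₁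
        in A′ , u′ , (λ b b∈ → proj₁ (∈-filter⁻ (¬? ∘ same?) (sub b b∈))) , bound big , thick
        where
        open ≤-Reasoning
        S = sum (map (th ∘ proj₁) (xs ++ ys))
        bound : ∀ {l} → length A₁ ≤ l + S → length A ≤ l + sum (map (th ∘ proj₁) (xs ++ [ q , key q a ] ++ ys))
        bound {l} big = begin
          length A                                  ≡⟨ length-filter-¬ same? A ⟨
          length (filter same? A) + length A₁       ≤⟨ +-mono-≤ (≮⇒≥ thin) big ⟩
          th q + (l + S)                            ≡⟨ +-assoc (th q) l S ⟨
          th q + l + S                              ≡⟨ cong (_+ S) (+-comm (th q) l) ⟩
          l + th q + S                              ≡⟨ +-assoc l (th q) S ⟩
          l + (th q + S)                            ≡⟨ cong (l +_) (sum-↭ (map⁺ (th ∘ proj₁) (shift (q , key q a) xs ys))) ⟨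
          l + sum (map (th ∘ proj₁) (xs ++ [ q , key q a ] ++ ys)) ∎

module Classes {T Q K : Set} (_≟T_ : DecidableEquality T) (_≟K_ : DecidableEquality K) (key : Q → T → K)
               (d : Q → ℕ) (1≤d : ∀ q → 1 ≤ d q) (A : List T) (uA : Unique A)
               (thick : ∀ a q → a ∈ A → d q ≤ length (filter (λ x → key q x ≟K key q a) A)) where

  private
    fibre : Q → K → List T
    fibre q x = filter (λ a → key q a ≟K x) A

    module B q = Blocks _≟T_ (d q)

  block : Q → T → List T
  block q a = B.blockOf q (B.blocks q (fibre q (key q a))) a

  block-⊆ : ∀ q a {x} → x ∈ block q a → x ∈ A × key q x ≡ key q a
  block-⊆ q a {x} x∈ = ∈-filter⁻ (λ y → key q y ≟K key q a)
    (subst (x ∈_) (B.concat-blocks q (fibre q (key q a))) (B.blockOf-⊆ q (B.blocks q (fibre q (key q a))) a x∈))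

  module _ (q : Q) {a : T} (a∈A : a ∈ A) where

    private
      a∈ : B.blockOf q (B.blocks q (fibre q (key q a))) a ∈ B.blocks q (fibre q (key q a)) × a ∈ block q a
      a∈ = B.blockOf-∈ q (B.blocks q (fibre q (key q a)))
             (subst (a ∈_) (sym (B.concat-blocks q (fibre q (key q a)))) (∈-filter⁺ (λ y → key q y ≟K key q a) a∈A refl))

      unique-concat : Unique (concat (B.blocks q (fibre q (key q a))))
      unique-concat = subst Unique (sym (B.concat-blocks q (fibre q (key q a)))) (UniqueP.filter⁺ (λ y → key q y ≟K key q a) uA)

    block-size : d q ≤ length (block q a) × length (block q a) ≤ 2 * d q
    block-size = All.lookup (B.blocks-size q (1≤d q) (fibre q (key q a)) (thick a q a∈A)) (proj₁ a∈)

    block-unique : Unique (block q a)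
    block-unique = All.lookup (unique-concat⁻ _ unique-concat) (proj₁ a∈)

    block-sym : ∀ {x} → x ∈ block q a → a ∈ block q x
    block-sym {x} x∈ = subst (a ∈_) (sym eq) (proj₂ a∈)
      where
      -- A fibre and its division depend on the key alone. Members of one block have equal keys, so
      -- both are looked up in the same division.
      eq : block q x ≡ block q a
      eq rewrite proj₂ (block-⊆ q a x∈) = B.blockOf-≡ q (B.blocks q (fibre q (key q a))) unique-concat x∈

-- How many choices the vertices used so far can spoil

length-cartesianProductWith : {X : Set} (f : I → V → X) (xs : List I) (ys : List V) →
                              length (cartesianProductWith f xs ys) ≡ length xs * length ys
length-cartesianProductWith f []       ys = refl
length-cartesianProductWith f (x ∷ xs) ys =
  trans (length-++ (map (f x) ys)) (cong₂ _+_ (length-map (f x) ys) (length-cartesianProductWith f xs ys))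

listsOver : ℕ → List I → List (List I)
listsOver zero    xs = [ [] ]
listsOver (suc l) xs = cartesianProductWith _∷_ xs (listsOver l xs)

length-listsOver : ∀ l (xs : List I) → length (listsOver l xs) ≡ length xs ^ l
length-listsOver zero    xs = refl
length-listsOver (suc l) xs = trans (length-cartesianProductWith _∷_ xs _) (cong (length xs *_) (length-listsOver l xs))

∈-listsOver : ∀ l {xs v : List I} → length v ≡ l → All (_∈ xs) v → v ∈ listsOver l xs
∈-listsOver zero    {v = []}    refl []       = here refl
∈-listsOver (suc l) {v = x ∷ v} eq   (p ∷ ps) = ∈-cartesianProductWith⁺ _∷_ p (∈-listsOver l (suc-injective eq) ps)

module _ {n : ℕ} where

  -- A union over the position of the entry in `us`. Lists with several such entries occur
  -- repeatedly, which is harmless because only an upper bound on their number is wanted.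
  listsMeeting : ℕ → List (Fin n) → List (List (Fin n))
  listsMeeting zero    us = []
  listsMeeting (suc l) us = cartesianProductWith _∷_ us (listsOver l (allFin n)) ++
                            cartesianProductWith _∷_ (allFin n) (listsMeeting l us)

  ∈-listsMeeting : ∀ l {us v} → length v ≡ l → Any (_∈ us) v → v ∈ listsMeeting l us
  ∈-listsMeeting (suc l) {us} {x ∷ v} eq (here p) =
    ∈-++⁺ˡ (∈-cartesianProductWith⁺ _∷_ p (∈-listsOver l (suc-injective eq) (All.universal ∈-allFin v)))
  ∈-listsMeeting (suc l) {us} {x ∷ v} eq (there p) =
    ∈-++⁺ʳ (cartesianProductWith _∷_ us (listsOver l (allFin n)))
      (∈-cartesianProductWith⁺ _∷_ (∈-allFin x) (∈-listsMeeting l (suc-injective eq) p))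

-- This is l n^(l-1), one term n^(l-1) for each position that a given vertex may occupy. The
-- recursion avoids the subtraction in the exponent and gives 0 for l = 0.
meetCoeff : ℕ → ℕ → ℕ
meetCoeff n zero    = 0
meetCoeff n (suc l) = n ^ l + n * meetCoeff n l

length-listsMeeting : ∀ {n} l (us : List (Fin n)) → length (listsMeeting l us) ≡ length us * meetCoeff n l
length-listsMeeting zero us = sym (*-zeroʳ (length us))
length-listsMeeting {n} (suc l) us = begin
  length (cartesianProductWith _∷_ us (listsOver l (allFin n)) ++ cartesianProductWith _∷_ (allFin n) (listsMeeting l us))
    ≡⟨ length-++ (cartesianProductWith _∷_ us (listsOver l (allFin n))) ⟩
  length (cartesianProductWith _∷_ us (listsOver l (allFin n))) + length (cartesianProductWith _∷_ (allFin n) (listsMeeting l us))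
    ≡⟨ cong₂ _+_ (trans (length-cartesianProductWith _∷_ us _) (cong (length us *_) (length-listsOver l (allFin n))))
                 (trans (length-cartesianProductWith _∷_ (allFin n) _) (cong (length (allFin n) *_) (length-listsMeeting l us))) ⟩
  length us * length (allFin n) ^ l + length (allFin n) * (length us * meetCoeff n l)
    ≡⟨ cong (λ N → length us * N ^ l + N * (length us * meetCoeff n l)) (length-tabulate id) ⟩
  length us * n ^ l + n * (length us * meetCoeff n l)
    ≡⟨ rearrange (length us) (n ^ l) n (meetCoeff n l) ⟩
  length us * (n ^ l + n * meetCoeff n l) ∎
  where
  open ≡-Reasoning
  rearrange : ∀ u p n c → u * p + n * (u * c) ≡ u * (p + n * c)
  rearrange = solve-∀

1≤n⇒m≤n*m : ∀ {m n} → 1 ≤ n → m ≤ n * m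
1≤n⇒m≤n*m {m} {suc n} _ = m≤m+n m _

-- With c the coefficient, M d ≤ U (M c) + M g ≤ U d + M g. If l is positive, the l vertices still
-- to be placed force U + 1 ≤ M, and cancelling U d leaves d ≤ M g. If l = 0, an empty list meets
-- nothing and all d choices survive.
survivors-bound : ∀ n l M U d g → 1 ≤ M → U + l ≤ M → M * meetCoeff n l ≤ d → d ≤ U * meetCoeff n l + g → d ≤ M * g
survivors-bound n zero M U d g 1≤M _ _ d≤ = begin
  d         ≤⟨ d≤ ⟩
  U * 0 + g ≡⟨ cong (_+ g) (*-zeroʳ U) ⟩
  g         ≤⟨ 1≤n⇒m≤n*m 1≤M ⟩
  M * g     ∎
  where open ≤-Reasoning
survivors-bound n (suc l) M U d g 1≤M Ul≤M Mc≤d d≤ = +-cancelˡ-≤ (U * d) d (M * g) (begin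
  U * d + d                 ≡⟨ +-comm (U * d) d ⟩
  suc U * d                 ≤⟨ *-monoˡ-≤ d U<M ⟩
  M * d                     ≤⟨ *-monoʳ-≤ M d≤ ⟩
  M * (U * c + g)           ≡⟨ rearrange M U c g ⟩
  U * (M * c) + M * g       ≤⟨ +-monoˡ-≤ (M * g) (*-monoʳ-≤ U Mc≤d) ⟩
  U * d + M * g             ∎)
  where
  open ≤-Reasoning
  c = meetCoeff n (suc l)
  U<M : U < M
  U<M = ≤-trans (≤-trans (s≤s (m≤m+n U l)) (≤-reflexive (sym (+-suc U l)))) Ul≤M
  rearrange : ∀ M U c g → M * (U * c + g) ≡ U * (M * c) + M * g
  rearrange = solve-∀

-- The key of a fibre: tuples with the same `erase q` differ at most in coordinate `q`. Overwriting
-- with the empty list keeps keys in the type of tuples, so one decidable equality serves for both.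
erase : ∀ {n} → Fin 4 → Vec (List (Fin n)) 4 → Vec (List (Fin n)) 4
erase q a = a [ q ]≔ []

erase-≡⇒[]≔ : ∀ {n} q {a a′ : Vec (List (Fin n)) 4} → erase q a′ ≡ erase q a → a [ q ]≔ lookup a′ q ≡ a′
erase-≡⇒[]≔ q {a} {a′} eq = begin
  a [ q ]≔ lookup a′ q                  ≡⟨ VecP.[]≔-idempotent a q ⟨
  (a [ q ]≔ []) [ q ]≔ lookup a′ q      ≡⟨ cong (_[ q ]≔ lookup a′ q) eq ⟨
  (a′ [ q ]≔ []) [ q ]≔ lookup a′ q     ≡⟨ VecP.[]≔-idempotent a′ q ⟩
  a′ [ q ]≔ lookup a′ q                 ≡⟨ VecP.[]≔-lookup a′ q ⟩
  a′                                    ∎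
  where open ≡-Reasoning

-- Within a fibre a tuple is determined by its coordinate `q`, so a block offers as many distinct
-- values for a new role as it has members.
map-lookup-unique : ∀ {n} q (a : Vec (List (Fin n)) 4) {as} → Unique as → All (λ x → erase q x ≡ erase q a) as →
                    Unique (map (λ x → lookup x q) as)
map-lookup-unique q a [] [] = []
map-lookup-unique q a (x≢ ∷ u) (e ∷ es) =
  AllP.map⁺ (All.zipWith (λ { (x≢y , e′) eq → x≢y (trans (sym (erase-≡⇒[]≔ q e)) (trans (cong (a [ q ]≔_) eq) (erase-≡⇒[]≔ q e′))) }) (x≢ , es))
  ∷ map-lookup-unique q a u es

map-cong-lookup : ∀ {m} {f g : I → V} (xs : Vec I m) → (∀ i → f (lookup xs i) ≡ g (lookup xs i)) → Vec.map f xs ≡ Vec.map g xs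
map-cong-lookup Vec.[]       h = refl
map-cong-lookup (x Vec.∷ xs) h = cong₂ Vec._∷_ (h Fin.zero) (map-cong-lookup xs (h ∘ Fin.suc))

-- Assignments of vertices to roles

module Config {Role : Set} (_≟R_ : DecidableEquality Role) (roles : List Role) (n : ℕ)
  (widthR dR : Role → ℕ) (widthQ dQ : Fin 4 → ℕ) (1≤dQ : ∀ q → 1 ≤ dQ q)
  (A : List (Vec (List (Fin n)) 4)) (uA : Unique A)
  (thick : ∀ a q → a ∈ A → dQ q ≤ length (filter (λ x → VecP.≡-dec (≡-dec FinP._≟_) (erase q x) (erase q a)) A))
  where

  open import Data.List.Membership.DecPropositional (FinP._≟_ {n}) using () renaming (_∈?_ to _∈F?_)

  Cfg : Set
  Cfg = Role → List (Fin n)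

  Node : Set
  Node = Vec Role 4

  _≟T_ : DecidableEquality (Vec (List (Fin n)) 4)
  _≟T_ = VecP.≡-dec (≡-dec FinP._≟_)

  open Classes _≟T_ _≟T_ erase dQ 1≤dQ A uA thick public

  R : Fin 4 → Vec (List (Fin n)) 4 → Vec (List (Fin n)) 4 → Set
  R q a a′ = a ∈ A × a′ ∈ block q a

  R-sym : ∀ {q a a′} → R q a a′ → R q a′ a
  R-sym {q} {a} (a∈ , a′∈) = proj₁ (block-⊆ q a a′∈) , block-sym q a∈ a′∈

  Agree : List Role → Cfg → Cfg → Set
  Agree S f g = ∀ ρ → ρ ∈ S → f ρ ≡ g ρ

  -- Configurations are functions, so propositional inequality would be the wrong notion: only the
  -- values on `roles` matter. Lists that are pairwise `Diff` play the part of sets of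
  -- configurations.
  Diff : Cfg → Cfg → Set
  Diff f g = ¬ Agree roles f g

  _[_↦_] : Cfg → Role → List (Fin n) → Cfg
  (f [ ρ ↦ v ]) ρ′ with ρ′ ≟R ρ
  ... | yes _ = v
  ... | no  _ = f ρ′

  update-same : ∀ ρ f v → (f [ ρ ↦ v ]) ρ ≡ v
  update-same ρ f v with ρ ≟R ρ
  ... | yes _ = refl
  ... | no ¬p = contradiction refl ¬p

  update-other : ∀ {ρ ρ′} f v → ρ′ ≢ ρ → (f [ ρ ↦ v ]) ρ′ ≡ f ρ′
  update-other {ρ} {ρ′} f v ≢ with ρ′ ≟R ρ
  ... | yes p = contradiction p ≢
  ... | no  _ = refl

  -- (q , m , ρ) passes from node m to the node in which coordinate q of m is replaced by ρ.
  Step : Set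
  Step = Fin 4 × Node × Role

  role : Step → Role
  role (_ , _ , ρ) = ρ

  Sat : Cfg → Step → Set
  Sat f (q , m , ρ) = R q (Vec.map f m) (Vec.map f (m [ q ]≔ ρ))

  -- The values on `roles` determine the tag, so families belonging to different tags cannot overlap
  -- and their sizes add up. The tag is the initial ordered edge at the root of the construction,
  -- and the value just chosen at each later step.
  collect : (Good : Cfg → Set) {J : Set} (Tag : J → Cfg → Set) →
    (∀ {i j f g} → Tag i f → Tag j g → Agree roles f g → i ≡ j) → (c N : ℕ) (js : List J) → Unique js →
    (∀ j → j ∈ js → Σ (List Cfg) λ L → c ≤ N * length L × All (λ g → Tag j g × Good g) L × AllPairs Diff L) →
    Σ (List Cfg) λ L → length js * c ≤ N * length L × All (λ g → (∃ λ j → j ∈ js × Tag j g) × Good g) L × AllPairs Diff L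
  collect Good Tag inj c N [] _ h = [] , z≤n , [] , []
  collect Good Tag inj c N (j ∷ js) (j≢ ∷ u) h =
    let L₁ , big₁ , good₁ , ap₁ = h j (here refl)
        L₂ , big₂ , good₂ , ap₂ = collect Good Tag inj c N js u (λ i i∈ → h i (there i∈))
    in L₁ ++ L₂ ,
       ≤-trans (+-mono-≤ big₁ big₂)
         (≤-reflexive (trans (sym (*-distribˡ-+ N (length L₁) (length L₂))) (cong (N *_) (sym (length-++ L₁))))) ,
       AllP.++⁺ (All.map (λ (t , g) → (j , here refl , t) , g) good₁)
                (All.map (λ { ((i , i∈ , t) , g) → (i , there i∈ , t) , g }) good₂) ,
       AllPairsP.++⁺ ap₁ ap₂
         (All.map (λ { (t , _) → All.map (λ { ((i , i∈ , t′) , _) agree → All.lookup j≢ i∈ (inj t t′ agree) }) good₂ }) good₁)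

  module Greedy (M : ℕ) (1≤M : 1 ≤ M) (room : sum (map widthR roles) ≤ M)
    (big : ∀ q → M * meetCoeff n (widthQ q) ≤ dQ q)
    (A-width : ∀ a q → a ∈ A → length (lookup a q) ≡ widthQ q)
    (A-unique : ∀ a q → a ∈ A → Unique (lookup a q))
    where

    record Inv (S : List Role) (Ns : List Node) (f : Cfg) : Set where
      field
        width    : ∀ {ρ} → ρ ∈ S → length (f ρ) ≡ widthR ρ
        unique   : ∀ {ρ} → ρ ∈ S → Unique (f ρ)
        disjoint : ∀ {ρ ρ′ v} → ρ ∈ S → ρ′ ∈ S → v ∈ f ρ → v ∈ f ρ′ → ρ ≡ ρ′
        node     : ∀ {m} → m ∈ Ns → Vec.map f m ∈ A
    open Inv

    -- `S` holds the roles assigned so far and `Ns` the nodes already carrying a tuple of `A`. Since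
    -- `ρ` is fresh, assigning it disturbs no earlier node, and different values lead to different
    -- configurations.
    data WF (S : List Role) (Ns : List Node) : List Step → Set where
      []   : WF S Ns []
      step : ∀ {q m ρ st} → m ∈ Ns → ρ ∉ S → ρ ∈ roles → widthR ρ ≡ widthQ q → dR ρ ≡ dQ q →
             WF (ρ ∷ S) (m [ q ]≔ ρ ∷ Ns) st → WF S Ns ((q , m , ρ) ∷ st)

    Closed : List Role → List Node → Set
    Closed S Ns = ∀ {m} → m ∈ Ns → ∀ q → lookup m q ∈ S

    finalS : List Role → List Step → List Role
    finalS S []                 = S
    finalS S ((q , m , ρ) ∷ st) = finalS (ρ ∷ S) st

    finalN : List Node → List Step → List Node
    finalN Ns []                 = Ns
    finalN Ns ((q , m , ρ) ∷ st) = finalN (m [ q ]≔ ρ ∷ Ns) st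

    closed-∷ : ∀ {S Ns q m ρ} → Closed S Ns → m ∈ Ns → Closed (ρ ∷ S) (m [ q ]≔ ρ ∷ Ns)
    closed-∷ {q = q} {m} {ρ} cl m∈ (here refl) i with i FinP.≟ q
    ... | yes refl = here (VecP.lookup∘updateAt q m)
    ... | no  i≢q  = there (subst (_∈ _) (sym (VecP.lookup∘updateAt′ i q i≢q m)) (cl m∈ i))
    closed-∷ cl m∈ (there p) i = there (cl p i)

    length-used : ∀ (f : Cfg) S → (∀ {ρ} → ρ ∈ S → length (f ρ) ≡ widthR ρ) → length (concatMap f S) ≡ sum (map widthR S)
    length-used f []      h = refl
    length-used f (ρ ∷ S) h = trans (length-++ (f ρ)) (cong₂ _+_ (h (here refl)) (length-used f S (h ∘ there)))

    module Extend {S Ns q m ρ f} (m∈ : m ∈ Ns) (ρ∉ : ρ ∉ S) (ρ∈ : ρ ∈ roles) (wid≡ : widthR ρ ≡ widthQ q)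
                  (uS : Unique S) (S⊆ : ∀ {ρ′} → ρ′ ∈ S → ρ′ ∈ roles) (cl : Closed S Ns) (inv : Inv S Ns f) where

      a : Vec (List (Fin n)) 4
      a = Vec.map f m

      used : List (Fin n)
      used = concatMap f S

      values : List (List (Fin n))
      values = map (λ x → lookup x q) (block q a)

      meets? : ∀ v → Dec (Any (_∈ used) v)
      meets? = Any.any? (_∈F? used)

      good : List (List (Fin n))
      good = filter (¬? ∘ meets?) values

      a∈A : a ∈ A
      a∈A = node inv m∈

      values-unique : Unique values
      values-unique = map-lookup-unique q a (block-unique q a∈A) (All.tabulate (proj₂ ∘ block-⊆ q a))

      good-unique : Unique good
      good-unique = UniqueP.filter⁺ (¬? ∘ meets?) values-unique

      values-width : ∀ {v} → v ∈ values → length v ≡ widthQ q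
      values-width v∈ with ∈-map⁻ (λ x → lookup x q) v∈
      ... | x , x∈ , refl = A-width x q (proj₁ (block-⊆ q a x∈))

      used-room : length used + widthQ q ≤ M
      used-room = begin
        length used + widthQ q                ≡⟨ cong₂ _+_ (length-used f S (width inv)) (sym wid≡) ⟩
        sum (map widthR S) + widthR ρ         ≡⟨ +-comm (sum (map widthR S)) (widthR ρ) ⟩
        sum (map widthR (ρ ∷ S))              ≤⟨ unique-⊆⇒sum≤ (AllP.¬Any⇒All¬ S ρ∉ ∷ uS)
                                                   (λ { (here refl) → ρ∈ ; (there p) → S⊆ p }) widthR ⟩
        sum (map widthR roles)                ≤⟨ room ⟩
        M                                     ∎
        where open ≤-Reasoning

      good-many : dQ q ≤ M * length good
      good-many = survivors-bound n (widthQ q) M (length used) (dQ q) (length good) 1≤M used-room (big q) (begin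
        dQ q                                            ≤⟨ proj₁ (block-size q a∈A) ⟩
        length (block q a)                              ≡⟨ length-map _ (block q a) ⟨
        length values                                   ≡⟨ length-filter-¬ meets? values ⟨
        length (filter meets? values) + length good     ≤⟨ +-monoˡ-≤ (length good) few ⟩
        length used * meetCoeff n (widthQ q) + length good ∎)
        where
        open ≤-Reasoning
        few : length (filter meets? values) ≤ length used * meetCoeff n (widthQ q)
        few = ≤-trans (unique-⊆⇒length≤ (UniqueP.filter⁺ meets? values-unique)
                        (λ v∈ → let v∈′ , mt = ∈-filter⁻ meets? v∈ in ∈-listsMeeting (widthQ q) (values-width v∈′) mt))
                      (≤-reflexive (length-listsMeeting (widthQ q) used))

      module _ {v} (v∈ : v ∈ good) where

        f′ : Cfg
        f′ = f [ ρ ↦ v ]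

        agree : Agree S f′ f
        agree ρ′ ρ′∈ = update-other f v (λ { refl → ρ∉ ρ′∈ })

        map-agree : ∀ {m′} → m′ ∈ Ns → Vec.map f′ m′ ≡ Vec.map f m′
        map-agree m′∈ = map-cong-lookup _ (λ i → agree _ (cl m′∈ i))

        private
          v∈values : v ∈ values
          v∈values = proj₁ (∈-filter⁻ (¬? ∘ meets?) {xs = values} v∈)

          fresh : ¬ Any (_∈ used) v
          fresh = proj₂ (∈-filter⁻ (¬? ∘ meets?) {xs = values} v∈)

          target : ∃ λ x → x ∈ block q a × v ≡ lookup x q
          target = ∈-map⁻ (λ x → lookup x q) v∈values

        dst≡ : Vec.map f′ (m [ q ]≔ ρ) ≡ proj₁ target
        dst≡ = begin
          Vec.map f′ (m [ q ]≔ ρ)             ≡⟨ VecP.map-[]≔ f′ m q ⟩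
          Vec.map f′ m [ q ]≔ f′ ρ            ≡⟨ cong₂ (_[ q ]≔_) (map-agree m∈) (trans (update-same ρ f v) (proj₂ (proj₂ target))) ⟩
          a [ q ]≔ lookup (proj₁ target) q    ≡⟨ erase-≡⇒[]≔ q (proj₂ (block-⊆ q a (proj₁ (proj₂ target)))) ⟩
          proj₁ target                        ∎
          where open ≡-Reasoning

        sat : Sat f′ (q , m , ρ)
        sat rewrite map-agree m∈ | dst≡ = a∈A , proj₁ (proj₂ target)

        x∈A : proj₁ target ∈ A
        x∈A = proj₁ (block-⊆ q a (proj₁ (proj₂ target)))

        clash : ∀ {ρ′ u} → ρ′ ∈ S → u ∈ f′ ρ → u ∈ f′ ρ′ → ⊥
        clash {ρ′} {u} ρ′∈ u∈ u∈′ = fresh (Any.map (λ { refl → ∈-concatMap⁺ f (Any.map (λ { refl → subst (u ∈_) (agree ρ′ ρ′∈) u∈′ }) ρ′∈) })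
                                          (subst (u ∈_) (update-same ρ f v) u∈))

        inv′ : Inv (ρ ∷ S) (m [ q ]≔ ρ ∷ Ns) f′
        width inv′ (here refl) = trans (cong length (update-same ρ f v)) (trans (values-width v∈values) (sym wid≡))
        width inv′ (there p)   = trans (cong length (agree _ p)) (width inv p)
        unique inv′ (here refl) = subst Unique (sym (trans (update-same ρ f v) (proj₂ (proj₂ target)))) (A-unique _ q x∈A)
        unique inv′ (there p)   = subst Unique (sym (agree _ p)) (unique inv p)
        disjoint inv′ (here refl) (here refl) _ _ = refl
        disjoint inv′ (here refl) (there p) u u′ = ⊥-elim (clash p u u′)
        disjoint inv′ (there p) (here refl) u u′ = ⊥-elim (clash p u′ u)
        disjoint inv′ (there p) (there p′) u u′ =
          disjoint inv p p′ (subst (_ ∈_) (agree _ p) u) (subst (_ ∈_) (agree _ p′) u′)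
        node inv′ (here refl) = subst (_∈ A) (sym dst≡) x∈A
        node inv′ (there p)   = subst (_∈ A) (sym (map-agree p)) (node inv p)

    -- Each step leaves at least a fraction 1/`M` of a block of size at least `dR` of its role. The
    -- factors `M` are gathered on the right, so no division occurs.
    greedy : ∀ st S Ns f → WF S Ns st → Unique S → (∀ {ρ} → ρ ∈ S → ρ ∈ roles) → Closed S Ns → Inv S Ns f →
             Σ (List Cfg) λ L → product (map (dR ∘ role) st) ≤ M ^ length st * length L ×
               All (λ g → Agree S g f × Inv (finalS S st) (finalN Ns st) g × All (Sat g) st) L × AllPairs Diff L
    greedy [] S Ns f [] uS S⊆ cl inv = [ f ] , ≤-refl , ((λ _ _ → refl) , inv , []) ∷ [] , [] ∷ []
    greedy ((q , m , ρ) ∷ st) S Ns f (step m∈ ρ∉ ρ∈ wid≡ d≡ wf) uS S⊆ cl inv =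
      let L , large , goods , ap = collect Good Tag tag-inj c N Ex.good Ex.good-unique next
      in L , bound (length L) large , All.map proj₂ goods , ap
      where
      module Ex = Extend m∈ ρ∉ ρ∈ wid≡ uS S⊆ cl inv
      c = product (map (dR ∘ role) st)
      N = M ^ length st
      Good : Cfg → Set
      Good g = Agree S g f × Inv (finalS (ρ ∷ S) st) (finalN (m [ q ]≔ ρ ∷ Ns) st) g × All (Sat g) ((q , m , ρ) ∷ st)
      Tag : List (Fin n) → Cfg → Set
      Tag v g = g ρ ≡ v
      tag-inj : ∀ {v v′ g g′} → Tag v g → Tag v′ g′ → Agree roles g g′ → v ≡ v′
      tag-inj t t′ agree = trans (sym t) (trans (agree ρ ρ∈) t′)
      next : ∀ v → v ∈ Ex.good → Σ (List Cfg) λ L → c ≤ N * length L × All (λ g → Tag v g × Good g) L × AllPairs Diff L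
      next v v∈ =
        let L , large , goods , ap = greedy st (ρ ∷ S) (m [ q ]≔ ρ ∷ Ns) (Ex.f′ v∈) wf (AllP.¬Any⇒All¬ S ρ∉ ∷ uS)
                                       (λ { (here refl) → ρ∈ ; (there p) → S⊆ p }) (closed-∷ cl m∈) (Ex.inv′ v∈)
        in L , large , All.map (λ { {g} (agree , inv′ , sats) → trans (agree ρ (here refl)) (update-same ρ f v) ,
             (λ ρ′ p → trans (agree ρ′ (there p)) (Ex.agree v∈ ρ′ p)) , inv′ , transport agree ∷ sats }) goods , ap
        where
        transport : ∀ {g} → Agree (ρ ∷ S) g (Ex.f′ v∈) → Sat g (q , m , ρ)
        transport {g} agree = subst₂ (R q) (sym (map-cong-lookup m (λ i → agree _ (there (cl m∈ i)))))
                                (sym (map-cong-lookup (m [ q ]≔ ρ) (λ i → agree _ (closed-∷ cl m∈ (here refl) i)))) (Ex.sat v∈)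
      bound : ∀ l → length Ex.good * c ≤ N * l → dR ρ * c ≤ M * N * l
      bound l large = begin
        dR ρ * c                     ≡⟨ cong (_* c) d≡ ⟩
        dQ q * c                     ≤⟨ *-monoˡ-≤ c Ex.good-many ⟩
        M * length Ex.good * c       ≡⟨ *-assoc M _ c ⟩
        M * (length Ex.good * c)     ≤⟨ *-monoʳ-≤ M large ⟩
        M * (N * l)                  ≡⟨ *-assoc M N l ⟨
        M * N * l                    ∎
        where open ≤-Reasoning

  -- Counting configurations by revealing their roles one after another

  module Reveal (uRoles : Unique roles) (Valid : Cfg → Set) (B : Role → ℕ) (1≤B : ∀ ρ → 1 ≤ B ρ) where

    open import Data.List.Membership.DecPropositional _≟R_ using () renaming (_∈?_ to _∈R?_)

    hidden : List Role → List Role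
    hidden S = filter (λ ρ → ¬? (ρ ∈R? S)) roles

    record Family (S : List Role) (L : List Cfg) : Set where
      constructor family
      field
        differ : AllPairs Diff L
        valid    : All Valid L
        agree    : ∀ {f g} → f ∈ L → g ∈ L → Agree S f g
    open Family

    Bounded : List Role → Set
    Bounded S = ∀ L → Family S L → length L ≤ product (map B (hidden S))

    family-filter : ∀ {S} {P : Cfg → Set} (P? : Decidable P) {L} → Family S L → Family S (filter P? L)
    family-filter P? (family d v a) = family (AllPairsP.filter⁺ P? d) (AllP.filter⁺ P? v)
      (λ f∈ g∈ → a (proj₁ (∈-filter⁻ P? f∈)) (proj₁ (∈-filter⁻ P? g∈)))

    1≤product : ∀ ρs → 1 ≤ product (map B ρs)
    1≤product []       = ≤-refl
    1≤product (ρ ∷ ρs) = *-mono-≤ (1≤B ρ) (1≤product ρs)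

    bounded-full : ∀ {S} → (∀ {ρ} → ρ ∈ roles → ρ ∈ S) → Bounded S
    bounded-full full [] _ = z≤n
    bounded-full {S} full (f ∷ []) _ = 1≤product (hidden S)
    bounded-full full (f ∷ g ∷ L) (family ((f≠g ∷ _) ∷ _) _ a) =
      contradiction (λ ρ ρ∈ → a (here refl) (there (here refl)) ρ (full ρ∈)) f≠g

    hidden-⊆ : ∀ S {ρ} → ρ ∈ hidden S → ρ ∈ roles
    hidden-⊆ S = proj₁ ∘ ∈-filter⁻ (λ ρ → ¬? (ρ ∈R? S))

    hidden-unique : ∀ S → Unique (hidden S)
    hidden-unique S = UniqueP.filter⁺ (λ ρ → ¬? (ρ ∈R? S)) uRoles

    -- The family is divided by its value at `ρ`. The candidates may depend on a configuration `g`,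
    -- but all members agree on `S`, so the candidates read off from the first member serve the
    -- whole family.
    reveal : ∀ {S ρ} → ρ ∈ roles → (cand : Cfg → List (List (Fin n))) → (∀ g → Valid g → length (cand g) ≤ B ρ) →
             (∀ f g → Valid f → Valid g → Agree S f g → f ρ ∈ cand g) → Bounded (ρ ∷ S) → Bounded S
    reveal _ cand small complete bd [] _ = z≤n
    reveal {S} {ρ} ρ∈ cand small complete bd L@(g ∷ _) fam with ρ ∈R? S
    -- A role met a second time separates nothing and is charged nothing, so exploring the tree with
    -- repetitions does no harm.
    ... | yes ρ∈S = ≤-trans (bd L (family (differ fam) (valid fam)
                      (λ { f∈ g∈ ρ′ (here refl) → agree fam f∈ g∈ ρ ρ∈S ; f∈ g∈ ρ′ (there p) → agree fam f∈ g∈ ρ′ p })))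
                      (unique-⊆⇒product≤ (hidden-unique (ρ ∷ S)) weaken B 1≤B)
      where
      weaken : ∀ {x} → x ∈ hidden (ρ ∷ S) → x ∈ hidden S
      weaken x∈ with ∈-filter⁻ (λ y → ¬? (y ∈R? (ρ ∷ S))) {xs = roles} x∈
      ... | x∈r , x∉ = ∈-filter⁺ (λ y → ¬? (y ∈R? S)) x∈r (x∉ ∘ there)
    ... | no ρ∉S = begin
      length L                                                   ≤⟨ length≤classes*size (Family S) family-filter (λ v f → ≡-dec FinP._≟_ (f ρ) v)
                                                                      (product (map B (hidden (ρ ∷ S)))) (cand g) L fam covered bounded ⟩
      length (cand g) * product (map B (hidden (ρ ∷ S)))         ≤⟨ *-monoˡ-≤ _ (small g (All.head (valid fam))) ⟩
      product (map B (ρ ∷ hidden (ρ ∷ S)))                       ≤⟨ unique-⊆⇒product≤ unique⁺ weaken⁺ B 1≤B ⟩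
      product (map B (hidden S))                                 ∎
      where
      open ≤-Reasoning
      covered : All (λ f → ∃ λ v → v ∈ cand g × f ρ ≡ v) L
      covered = All.tabulate λ {f} f∈ → f ρ ,
        complete f g (All.lookup (valid fam) f∈) (All.head (valid fam)) (agree fam f∈ (here refl)) , refl
      bounded : ∀ v → v ∈ cand g → ∀ L′ → Family S L′ → All (λ f → f ρ ≡ v) L′ → length L′ ≤ product (map B (hidden (ρ ∷ S)))
      bounded v _ L′ fam′ eqs = bd L′ (family (differ fam′) (valid fam′)
        (λ { f∈ g∈ ρ′ (here refl) → trans (All.lookup eqs f∈) (sym (All.lookup eqs g∈)) ; f∈ g∈ ρ′ (there p) → agree fam′ f∈ g∈ ρ′ p }))
      weaken⁺ : ∀ {x} → x ∈ ρ ∷ hidden (ρ ∷ S) → x ∈ hidden S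
      weaken⁺ (here refl) = ∈-filter⁺ (λ y → ¬? (y ∈R? S)) ρ∈ ρ∉S
      weaken⁺ (there x∈) with ∈-filter⁻ (λ y → ¬? (y ∈R? (ρ ∷ S))) {xs = roles} x∈
      ... | x∈r , x∉ = ∈-filter⁺ (λ y → ¬? (y ∈R? S)) x∈r (x∉ ∘ there)
      unique⁺ : Unique (ρ ∷ hidden (ρ ∷ S))
      unique⁺ = All.tabulate (λ { x∈ refl → proj₂ (∈-filter⁻ (λ y → ¬? (y ∈R? (ρ ∷ S))) {xs = roles} x∈) (here refl) }) ∷ hidden-unique (ρ ∷ S)

    Cheap : Role → Set
    Cheap ρ = Σ (List (List (Fin n))) λ vs → length vs ≤ B ρ × (∀ f → Valid f → f ρ ∈ vs)

    reveal-cheap : ∀ {S ρ} → ρ ∈ roles → Cheap ρ → Bounded (ρ ∷ S) → Bounded S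
    reveal-cheap ρ∈ (vs , small , complete) = reveal ρ∈ (λ _ → vs) (λ _ _ → small) (λ f _ vf _ _ → complete f vf)

    -- Once the node `m` is known, the new coordinate comes from the block of its tuple, which has
    -- at most twice `dQ q` members. A cheaper list of candidates, if there is one, takes
    -- precedence.
    reveal-edge : ∀ {S ρ} q m → ρ ∈ roles → Cheap ρ ⊎ 2 * dQ q ≤ B ρ → (∀ i → lookup m i ∈ S) →
                  (∀ f → Valid f → Sat f (q , m , ρ)) → Bounded (ρ ∷ S) → Bounded S
    reveal-edge q m ρ∈ (inj₁ cheap) _ _ = reveal-cheap ρ∈ cheap
    reveal-edge {S} {ρ} q m ρ∈ (inj₂ large) m⊆S sat =
      reveal ρ∈ (λ g → map (λ x → lookup x q) (block q (Vec.map g m)))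
        (λ g vg → ≤-trans (≤-reflexive (length-map _ (block q (Vec.map g m)))) (≤-trans (proj₂ (block-size q (proj₁ (sat g vg)))) large))
        (λ f g vf vg ag → subst₂ (λ v a → v ∈ map (λ x → lookup x q) (block q a)) (new f)
           (map-cong-lookup m (λ i → ag _ (m⊆S i))) (∈-map⁺ (λ x → lookup x q) (proj₂ (sat f vf))))
      where
      new : ∀ f → lookup (Vec.map f (m [ q ]≔ ρ)) q ≡ f ρ
      new f = trans (VecP.lookup-map q f (m [ q ]≔ ρ)) (cong f (VecP.lookup∘updateAt q m))

-- Cycle edge l (l < k) consists of X l, Y l, the block W l and the vertex X (l + 1 mod k).
data Role : Set where
  X Y W : ℕ → Role

_≟R_ : DecidableEquality Role
X i ≟R X j = map′ (cong X) (λ { refl → refl }) (i ≟ j)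
X i ≟R Y j = no λ ()
X i ≟R W j = no λ ()
Y i ≟R X j = no λ ()
Y i ≟R Y j = map′ (cong Y) (λ { refl → refl }) (i ≟ j)
Y i ≟R W j = no λ ()
W i ≟R X j = no λ ()
W i ≟R Y j = no λ ()
W i ≟R W j = map′ (cong W) (λ { refl → refl }) (i ≟ j)

index : Role → ℕ
index (X l) = l
index (Y l) = l
index (W l) = l

byRole : {I : Set} → I → I → Role → I
byRole x y (X _) = x
byRole x y (Y _) = x
byRole x y (W _) = y

byCoord : {I : Set} → I → I → Fin 4 → I
byCoord x y 0F = x
byCoord x y 1F = x
byCoord x y 2F = x
byCoord x y 3F = y

-- The tree of triangles inside the linear cycle

module Tree (κ : ℕ) where

  k : ℕ
  k = suc (suc κ)

  roles : List Role
  roles = map X (upTo k) ++ map Y (upTo k) ++ map W (upTo k)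

  X∈ : ∀ {l} → l < k → X l ∈ roles
  X∈ l< = ∈-++⁺ˡ (∈-map⁺ X (∈-upTo⁺ l<))

  Y∈ : ∀ {l} → l < k → Y l ∈ roles
  Y∈ l< = ∈-++⁺ʳ (map X (upTo k)) (∈-++⁺ˡ (∈-map⁺ Y (∈-upTo⁺ l<)))

  W∈ : ∀ {l} → l < k → W l ∈ roles
  W∈ l< = ∈-++⁺ʳ (map X (upTo k)) (∈-++⁺ʳ (map Y (upTo k)) (∈-map⁺ W (∈-upTo⁺ l<)))

  roles-elim : (P : Role → Set) → (∀ l → l < k → P (X l)) → (∀ l → l < k → P (Y l)) → (∀ l → l < k → P (W l)) →
               ∀ {ρ} → ρ ∈ roles → P ρ
  roles-elim P x y w ρ∈ with ∈-++⁻ (map X (upTo k)) ρ∈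
  ... | inj₁ x∈ with ∈-map⁻ X x∈
  ...   | l , l∈ , refl = x l (∈-upTo⁻ l∈)
  roles-elim P x y w ρ∈ | inj₂ yw∈ with ∈-++⁻ (map Y (upTo k)) yw∈
  ... | inj₁ y∈ with ∈-map⁻ Y y∈
  ...   | l , l∈ , refl = y l (∈-upTo⁻ l∈)
  roles-elim P x y w ρ∈ | inj₂ yw∈ | inj₂ w∈ with ∈-map⁻ W w∈
  ... | l , l∈ , refl = w l (∈-upTo⁻ l∈)

  roles-unique : Unique roles
  roles-unique = UniqueP.++⁺ (UniqueP.map⁺ (λ { refl → refl }) (UniqueP.upTo⁺ k))
    (UniqueP.++⁺ (UniqueP.map⁺ (λ { refl → refl }) (UniqueP.upTo⁺ k)) (UniqueP.map⁺ (λ { refl → refl }) (UniqueP.upTo⁺ k))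
      (λ { (y , w) → case₂ (∈-map⁻ Y y) (∈-map⁻ W w) }))
    (λ { (x , yw) → case₃ (∈-map⁻ X x) (∈-++⁻ (map Y (upTo k)) yw) })
    where
    case₂ : ∀ {ρ} → (∃ λ i → i ∈ upTo k × ρ ≡ Y i) → (∃ λ i → i ∈ upTo k × ρ ≡ W i) → ⊥
    case₂ (_ , _ , refl) (_ , _ , ())
    case₃ : ∀ {ρ} → (∃ λ i → i ∈ upTo k × ρ ≡ X i) → ρ ∈ map Y (upTo k) ⊎ ρ ∈ map W (upTo k) → ⊥
    case₃ (_ , _ , refl) (inj₁ y) with () ← proj₂ (proj₂ (∈-map⁻ Y y))
    case₃ (_ , _ , refl) (inj₂ w) with () ← proj₂ (proj₂ (∈-map⁻ W w))

  -- The core of the cycle is triangulated as a fan: T l is the triangle on the apex X 0 and the two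
  -- consecutive vertices p l, p (l + 1) of the path Y 0, X 1, …, X (k - 1), Y (k - 1), together with W 0.
  -- F l and E l arise from T l by replacing first the apex and then the block W 0; E l is the l-th cycle edge.
  p : ℕ → Role
  p zero    = Y 0
  p (suc l) with l ≟ suc κ
  ... | yes _ = Y (suc κ)
  ... | no  _ = X (suc l)

  -- The two end triangles of the fan already lie on the cycle edges 0 and k - 1, both of which
  -- contain `X 0`. Only the triangles in between exchange the apex for the private vertex `Y` of
  -- their edge.
  apex : ℕ → Role
  apex zero    = X 0
  apex (suc l) with l ≟ κ
  ... | yes _ = X 0
  ... | no  _ = Y (suc l)

  even : ℕ → Bool
  even zero    = true
  even (suc l) = not (even l)

  -- The two path vertices alternate between coordinates 1 and 2, so that consecutive triangles of the
  -- fan differ in a single coordinate.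
  node : Bool → Role → Role → Role → Role → Vec Role 4
  node true  x u v y = x Vec.∷ u Vec.∷ v Vec.∷ y Vec.∷ Vec.[]
  node false x u v y = x Vec.∷ v Vec.∷ u Vec.∷ y Vec.∷ Vec.[]

  T F E : ℕ → Vec Role 4
  T l = node (even l) (X 0)    (p l) (p (suc l)) (W 0)
  F l = node (even l) (apex l) (p l) (p (suc l)) (W 0)
  E l = node (even l) (apex l) (p l) (p (suc l)) (W l)

  dir : ℕ → Fin 4
  dir l with even l
  ... | true  = 1F
  ... | false = 2F

  T-next : ∀ l → T l [ dir l ]≔ p (2 + l) ≡ T (suc l)
  T-next l with even l
  ... | true  = refl
  ... | false = refl

  T-prev : ∀ l → T (suc l) [ dir l ]≔ p l ≡ T l
  T-prev l with even l
  ... | true  = refl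
  ... | false = refl

  T⇒F : ∀ l → T l [ 0F ]≔ apex l ≡ F l
  T⇒F l with even l
  ... | true  = refl
  ... | false = refl

  F⇒T : ∀ l → F l [ 0F ]≔ X 0 ≡ T l
  F⇒T l with even l
  ... | true  = refl
  ... | false = refl

  F⇒E : ∀ l → F l [ 3F ]≔ W l ≡ E l
  F⇒E l with even l
  ... | true  = refl
  ... | false = refl

  E⇒F : ∀ l → E l [ 3F ]≔ W 0 ≡ F l
  E⇒F l with even l
  ... | true  = refl
  ... | false = refl

  apex-last : apex (suc κ) ≡ X 0
  apex-last with κ ≟ κ
  ... | yes _ = refl
  ... | no ¬p = contradiction refl ¬p

  apex-mid : ∀ {l} → l < κ → apex (suc l) ≡ Y (suc l)
  apex-mid {l} l< with l ≟ κ
  ... | yes refl = contradiction l< (<-irrefl refl)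
  ... | no  _    = refl

  p-mid : ∀ {l} → suc l < k → p (suc l) ≡ X (suc l)
  p-mid {l} l< with l ≟ suc κ
  ... | yes refl = contradiction l< (<-irrefl refl)
  ... | no  _    = refl

  p-last : p k ≡ Y (suc κ)
  p-last with suc κ ≟ suc κ
  ... | yes _ = refl
  ... | no ¬p = contradiction refl ¬p

  F-last : F (suc κ) ≡ T (suc κ)
  F-last = cong (λ x → node (even (suc κ)) x (p (suc κ)) (p k) (W 0)) apex-last

  p∈ : ∀ {l} → l ≤ k → p l ∈ roles
  p∈ {zero}  _ = Y∈ (s≤s z≤n)
  p∈ {suc l} l≤ with l ≟ suc κ
  ... | yes _ = Y∈ ≤-refl
  ... | no  ≢ = X∈ (≤∧≢⇒< l≤ (≢ ∘ suc-injective))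

  apex∈ : ∀ {l} → l < k → apex l ∈ roles
  apex∈ {zero}  _ = X∈ (s≤s z≤n)
  apex∈ {suc l} l< with l ≟ κ
  ... | yes _ = X∈ (s≤s z≤n)
  ... | no  _ = Y∈ l<

  byRole-p : ∀ {I : Set} {x y : I} l → byRole x y (p l) ≡ x
  byRole-p zero = refl
  byRole-p (suc l) with l ≟ suc κ
  ... | yes _ = refl
  ... | no  _ = refl

  byCoord-dir : ∀ {I : Set} {x y : I} l → byCoord x y (dir l) ≡ x
  byCoord-dir l with even l
  ... | true  = refl
  ... | false = refl

  -- The order in which the greedy construction assigns the roles.
  rank : Role → ℕ
  rank (X l)       = l
  rank (Y zero)    = 0
  rank (Y (suc l)) with l ≟ κ
  ... | yes _ = k
  ... | no  _ = k + suc l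
  rank (W zero)    = 0
  rank (W (suc l)) = k + k + suc l

  rank-p : ∀ l → l ≤ k → rank (p l) ≡ l
  rank-p zero _ = refl
  rank-p (suc l) l≤ with l ≟ suc κ
  ... | no  _    = refl
  ... | yes refl with κ ≟ κ
  ...   | yes _ = refl
  ...   | no ¬p = contradiction refl ¬p

  rank-Y : ∀ {l} → l < κ → rank (Y (suc l)) ≡ k + suc l
  rank-Y {l} l< with l ≟ κ
  ... | yes refl = contradiction l< (<-irrefl refl)
  ... | no  _    = refl

  apex-in : ∀ l → ∃ λ q → lookup (E l) q ≡ apex l
  apex-in l with even l
  ... | true  = 0F , refl
  ... | false = 0F , refl

  p-in : ∀ l → ∃ λ q → lookup (E l) q ≡ p l
  p-in l with even l
  ... | true  = 1F , refl
  ... | false = 2F , refl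

  p-suc-in : ∀ l → ∃ λ q → lookup (E l) q ≡ p (suc l)
  p-suc-in l with even l
  ... | true  = 2F , refl
  ... | false = 1F , refl

  W-in : ∀ l → ∃ λ q → lookup (E l) q ≡ W l
  W-in l with even l
  ... | true  = 3F , refl
  ... | false = 3F , refl

  E-coords : ∀ l q → lookup (E l) q ≡ apex l ⊎ lookup (E l) q ≡ p l ⊎ lookup (E l) q ≡ p (suc l) ⊎ lookup (E l) q ≡ W l
  E-coords l q with even l | q
  ... | true  | 0F = inj₁ refl
  ... | true  | 1F = inj₂ (inj₁ refl)
  ... | true  | 2F = inj₂ (inj₂ (inj₁ refl))
  ... | true  | 3F = inj₂ (inj₂ (inj₂ refl))
  ... | false | 0F = inj₁ refl
  ... | false | 1F = inj₂ (inj₂ (inj₁ refl))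
  ... | false | 2F = inj₂ (inj₁ refl)
  ... | false | 3F = inj₂ (inj₂ (inj₂ refl))

  E∈roles : ∀ {l} → l < k → ∀ q → lookup (E l) q ∈ roles
  E∈roles {l} l< q with E-coords l q
  ... | inj₁ eq               = subst (_∈ roles) (sym eq) (apex∈ l<)
  ... | inj₂ (inj₁ eq)        = subst (_∈ roles) (sym eq) (p∈ (<⇒≤ l<))
  ... | inj₂ (inj₂ (inj₁ eq)) = subst (_∈ roles) (sym eq) (p∈ l<)
  ... | inj₂ (inj₂ (inj₂ eq)) = subst (_∈ roles) (sym eq) (W∈ l<)

  next : ℕ → ℕ
  next l with l ≟ suc κ
  ... | yes _ = 0
  ... | no  _ = suc l

  next-last : next (suc κ) ≡ 0
  next-last with suc κ ≟ suc κ
  ... | yes _ = refl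
  ... | no ¬p = contradiction refl ¬p

  next-mid : ∀ {l} → l < suc κ → next l ≡ suc l
  next-mid {l} l< with l ≟ suc κ
  ... | yes refl = contradiction l< (<-irrefl refl)
  ... | no  _    = refl

  InE : ℕ → Role → Set
  InE l ρ = ∃ λ q → lookup (E l) q ≡ ρ

  X-in : ∀ {l} → l < k → InE l (X l)
  X-in {zero}  l< = apex-in 0
  X-in {suc l} l< = let q , eq = p-in (suc l) in q , trans eq (p-mid l<)

  X-next-in : ∀ {l} → l < k → InE l (X (next l))
  X-next-in {l} l< with m≤n⇒m<n∨m≡n (s≤s⁻¹ l<)
  ... | inj₂ refl = let q , eq = apex-in (suc κ) in q , trans eq (trans apex-last (cong X (sym next-last)))
  ... | inj₁ l<′  = let q , eq = p-suc-in l in q , trans eq (trans (p-mid (s≤s l<′)) (cong X (sym (next-mid l<′))))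

  Y-in : ∀ {l} → l < k → InE l (Y l)
  Y-in {zero}  l< = p-in 0
  Y-in {suc l} l< with m≤n⇒m<n∨m≡n (s≤s⁻¹ (s≤s⁻¹ l<))
  ... | inj₂ refl = let q , eq = p-suc-in (suc κ) in q , trans eq p-last
  ... | inj₁ l<κ  = let q , eq = apex-in (suc l) in q , trans eq (apex-mid l<κ)

  -- Passes from the description by fan to the description around the cycle. The apex is `X l` for
  -- the first edge, `X (next l)` for the last and `Y l` otherwise; the ends of the path supply the
  -- remaining `Y` of the first and the last edge.
  E-roles : ∀ {l} → l < k → ∀ q →
            lookup (E l) q ≡ X l ⊎ lookup (E l) q ≡ Y l ⊎ lookup (E l) q ≡ W l ⊎ lookup (E l) q ≡ X (next l)
  E-roles {l} l< q with E-coords l q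
  E-roles {zero}  l< q | inj₁ eq = inj₁ eq
  E-roles {suc l} l< q | inj₁ eq with m≤n⇒m<n∨m≡n (s≤s⁻¹ (s≤s⁻¹ l<))
  ... | inj₁ l<κ  = inj₂ (inj₁ (trans eq (apex-mid l<κ)))
  ... | inj₂ refl = inj₂ (inj₂ (inj₂ (trans eq (trans apex-last (cong X (sym next-last))))))
  E-roles {zero}  l< q | inj₂ (inj₁ eq) = inj₂ (inj₁ eq)
  E-roles {suc l} l< q | inj₂ (inj₁ eq) = inj₁ (trans eq (p-mid l<))
  E-roles {l} l< q | inj₂ (inj₂ (inj₁ eq)) with m≤n⇒m<n∨m≡n (s≤s⁻¹ l<)
  ... | inj₂ refl = inj₂ (inj₁ (trans eq p-last))
  ... | inj₁ l<′  = inj₂ (inj₂ (inj₂ (trans eq (trans (p-mid (s≤s l<′)) (cong X (sym (next-mid l<′)))))))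
  E-roles {l} l< q | inj₂ (inj₂ (inj₂ eq)) = inj₂ (inj₂ (inj₁ eq))

segment : {I : Set} → (ℕ → I) → ℕ → ℕ → List I
segment g l zero    = []
segment g l (suc c) = g l ∷ segment g (suc l) c

∈-segment : ∀ {I : Set} (g : ℕ → I) l c {i} → l ≤ i → i < l + c → g i ∈ segment g l c
∈-segment g l zero    l≤i i< = contradiction (subst (_ <_) (+-identityʳ l) i<) (≤⇒≯ l≤i)
∈-segment g l (suc c) {i} l≤i i< with l ≟ i
... | yes refl = here refl
... | no  l≢i  = there (∈-segment g (suc l) c (≤∧≢⇒< l≤i l≢i) (subst (i <_) (+-suc l c) i<))

length-segment : ∀ {I : Set} (g : ℕ → I) l c → length (segment g l c) ≡ c
length-segment g l zero    = refl
length-segment g l (suc c) = cong suc (length-segment g (suc l) c)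

product-segment : ∀ {I : Set} (f : I → ℕ) (g : ℕ → I) d → (∀ l → f (g l) ≡ d) → ∀ l c → product (map f (segment g l c)) ≡ d ^ c
product-segment f g d h l zero    = refl
product-segment f g d h l (suc c) = cong₂ _*_ (h l) (product-segment f g d h (suc l) c)

sum-map-map-const : ∀ {I V : Set} (f : V → ℕ) (g : I → V) c → (∀ i → f (g i) ≡ c) → ∀ xs → sum (map f (map g xs)) ≡ length xs * c
sum-map-map-const f g c h []       = refl
sum-map-map-const f g c h (x ∷ xs) = cong₂ _+_ (h x) (sum-map-map-const f g c h xs)

-- Many configurations: walking along the tree greedily

module CycleConfig (κ w n s b : ℕ) (1≤d : ∀ q → 1 ≤ byCoord s b q)
  (A : List (Vec (List (Fin n)) 4)) (uA : Unique A)
  (thick : ∀ a q → a ∈ A → byCoord s b q ≤ length (filter (λ x → VecP.≡-dec (≡-dec FinP._≟_) (erase q x) (erase q a)) A))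
  where

  open Tree κ public
  open Config _≟R_ roles n (byRole 1 w) (byRole s b) (byCoord 1 w) (byCoord s b) 1≤d A uA thick public

  fanStep legStep blockStep : ℕ → Step
  fanStep l   = dir l , T l , p (2 + l)
  legStep l   = 0F , T (suc l) , Y (suc l)
  blockStep l = 3F , F (suc l) , W (suc l)

  steps : List Step
  steps = segment fanStep 0 (suc κ) ++ segment legStep 0 κ ++ segment blockStep 0 (suc κ)

  -- The block relations along the tree are kept besides the cycle edges themselves: the upper bound
  -- walks through the same relations, partly in reverse.
  record Proper (f : Cfg) : Set where
    field
      width    : ∀ {ρ} → ρ ∈ roles → length (f ρ) ≡ byRole 1 w ρ
      unique   : ∀ {ρ} → ρ ∈ roles → Unique (f ρ)
      disjoint : ∀ {ρ ρ′ v} → ρ ∈ roles → ρ′ ∈ roles → v ∈ f ρ → v ∈ f ρ′ → ρ ≡ ρ′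
      edge     : ∀ {l} → l < k → Vec.map f (E l) ∈ A
      fan      : ∀ {l} → l ≤ κ → R (dir l) (Vec.map f (T l)) (Vec.map f (T (suc l)))
      leg      : ∀ {l} → l < κ → R 0F (Vec.map f (T (suc l))) (Vec.map f (F (suc l)))
      swap     : ∀ {l} → l ≤ κ → R 3F (Vec.map f (F (suc l))) (Vec.map f (E (suc l)))

  -- The number k(r-1) of vertices of the cycle, so the vertices used at any stage and those about
  -- to be placed fit within `M`.
  M : ℕ
  M = k * (2 + w)

  room : sum (map (byRole 1 w) roles) ≤ M
  room = ≤-reflexive (begin
    sum (map (byRole 1 w) roles)
      ≡⟨ cong sum (trans (map-++ (byRole 1 w) xs _) (cong (map (byRole 1 w) xs ++_) (map-++ (byRole 1 w) ys ws))) ⟩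
    sum (map (byRole 1 w) xs ++ map (byRole 1 w) ys ++ map (byRole 1 w) ws)
      ≡⟨ trans (sum-++ (map (byRole 1 w) xs) _) (cong (sum (map (byRole 1 w) xs) +_) (sum-++ (map (byRole 1 w) ys) _)) ⟩
    sum (map (byRole 1 w) xs) + (sum (map (byRole 1 w) ys) + sum (map (byRole 1 w) ws))
      ≡⟨ cong₂ _+_ (total X 1 (λ _ → refl)) (cong₂ _+_ (total Y 1 (λ _ → refl)) (total W w (λ _ → refl))) ⟩
    k * 1 + (k * 1 + k * w)
      ≡⟨ rearrange k w ⟩
    M ∎)
    where
    open ≡-Reasoning
    xs = map X (upTo k)
    ys = map Y (upTo k)
    ws = map W (upTo k)
    total : ∀ (g : ℕ → Role) c → (∀ i → byRole 1 w (g i) ≡ c) → sum (map (byRole 1 w) (map g (upTo k))) ≡ k * c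
    total g c h = trans (sum-map-map-const (byRole 1 w) g c h (upTo k)) (cong (_* c) (length-upTo k))
    rearrange : ∀ k w → k * 1 + (k * 1 + k * w) ≡ k * (2 + w)
    rearrange = solve-∀

  module Lower (big : ∀ q → M * meetCoeff n (byCoord 1 w q) ≤ byCoord s b q)
    (A-width : ∀ a q → a ∈ A → length (lookup a q) ≡ byCoord 1 w q)
    (A-unique : ∀ a q → a ∈ A → Unique (lookup a q))
    (A-disjoint : ∀ a q q′ {v} → a ∈ A → v ∈ lookup a q → v ∈ lookup a q′ → q ≡ q′) where

    open Greedy M (s≤s z≤n) room big A-width A-unique

    S₀ : List Role
    S₀ = X 0 ∷ Y 0 ∷ X 1 ∷ W 0 ∷ []

    -- Freshness of the next role becomes a comparison of ranks, so the list of assigned roles need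
    -- not be described any further.
    Below : ℕ → List Role → Set
    Below r S = ∀ {ρ} → ρ ∈ S → rank ρ < r

    below-∉ : ∀ {S r ρ} → Below r S → rank ρ ≡ r → ρ ∉ S
    below-∉ bl refl ρ∈ = <-irrefl refl (bl ρ∈)

    below-∷ : ∀ {S r r′ ρ} → Below r S → rank ρ ≡ r → r < r′ → Below r′ (ρ ∷ S)
    below-∷ bl refl r< (here refl) = r<
    below-∷ bl refl r< (there i)   = <-trans (bl i) r<

    below-≤ : ∀ {S r r′} → Below r S → r ≤ r′ → Below r′ S
    below-≤ bl r≤ i = <-≤-trans (bl i) r≤

    wf-blocks : ∀ c l S Ns → l + c ≡ suc κ → (∀ {i} → i ≤ κ → F (suc i) ∈ Ns) → Below (k + k + suc l) S →
                WF S Ns (segment blockStep l c)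
    wf-blocks zero    l S Ns eq srcs bl = []
    wf-blocks (suc c) l S Ns eq srcs bl =
      step (srcs (s≤s⁻¹ l<)) (below-∉ bl refl) (W∈ (s≤s l<)) refl refl
        (wf-blocks c (suc l) _ _ (trans (sym (+-suc l c)) eq) (there ∘ srcs) (below-∷ bl refl (+-monoʳ-< (k + k) ≤-refl)))
      where
      l< : l < suc κ
      l< = subst (suc l ≤_) eq (≤-trans (s≤s (m≤m+n l c)) (≤-reflexive (sym (+-suc l c))))

    -- The phases are chained by continuations, because the lists `S` and `Ns` reached at the end of
    -- a phase are never written out; the next phase needs only the nodes available and a bound on
    -- the ranks.
    wf-legs : ∀ c l S Ns st → l + c ≡ κ → (∀ {i} → i ≤ suc κ → T i ∈ Ns) → (∀ {i} → i < l → F (suc i) ∈ Ns) →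
              Below (k + suc l) S →
              (∀ S′ Ns′ → (∀ {i} → i ≤ κ → F (suc i) ∈ Ns′) → Below (k + k + 1) S′ → WF S′ Ns′ st) →
              WF S Ns (segment legStep l c ++ st)
    wf-legs zero l S Ns st eq Ts Fs bl cont = cont S Ns all (below-≤ bl (≤-trans (+-monoʳ-≤ k (≤-trans (s≤s (≤-reflexive l≡)) (≤-trans (n≤1+n _) (m≤m+n k 1)))) (≤-reflexive (sym (+-assoc k k 1)))))
      where
      l≡ : l ≡ κ
      l≡ = trans (sym (+-identityʳ l)) eq
      -- The last triangle of the fan keeps its apex, so `F (suc κ)` is available without a leg
      -- step.
      all : ∀ {i} → i ≤ κ → F (suc i) ∈ Ns
      all {i} i≤ = [ (λ i< → Fs (subst (i <_) (sym l≡) i<)) ,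
                     (λ i≡ → subst (λ j → F (suc j) ∈ Ns) (sym i≡) (subst (_∈ Ns) (sym F-last) (Ts ≤-refl))) ]′ (m≤n⇒m<n∨m≡n i≤)
    wf-legs (suc c) l S Ns st eq Ts Fs bl cont =
      step (Ts (≤-trans l< (n≤1+n κ))) (below-∉ bl (rank-Y l<)) (Y∈ (≤-trans (s≤s l<) (n≤1+n _))) refl refl
        (wf-legs c (suc l) _ _ st (trans (sym (+-suc l c)) eq) (there ∘ Ts) Fs′
          (below-∷ bl (rank-Y l<) (+-monoʳ-< k ≤-refl)) cont)
      where
      l< : l < κ
      l< = subst (suc l ≤_) eq (≤-trans (s≤s (m≤m+n l c)) (≤-reflexive (sym (+-suc l c))))
      new : T (suc l) [ 0F ]≔ Y (suc l) ≡ F (suc l)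
      new = trans (cong (T (suc l) [ 0F ]≔_) (sym (apex-mid l<))) (T⇒F (suc l))
      Fs′ : ∀ {i} → i < suc l → F (suc i) ∈ T (suc l) [ 0F ]≔ Y (suc l) ∷ Ns
      Fs′ {i} i< = [ (λ i<l → there (Fs i<l)) , (λ i≡ → here (trans (cong (F ∘ suc) i≡) (sym new))) ]′ (m≤n⇒m<n∨m≡n (s≤s⁻¹ i<))

    wf-fan : ∀ c l S Ns st → l + c ≡ suc κ → (∀ {i} → i ≤ l → T i ∈ Ns) → Below (2 + l) S →
             (∀ S′ Ns′ → (∀ {i} → i ≤ suc κ → T i ∈ Ns′) → Below (k + 1) S′ → WF S′ Ns′ st) →
             WF S Ns (segment fanStep l c ++ st)
    wf-fan zero l S Ns st eq Ts bl cont = cont S Ns (λ i≤ → Ts (≤-trans i≤ (≤-reflexive (sym l≡))))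
      (below-≤ bl (≤-trans (≤-reflexive (cong (2 +_) l≡)) (≤-reflexive (+-comm 1 k))))
      where
      l≡ : l ≡ suc κ
      l≡ = trans (sym (+-identityʳ l)) eq
    wf-fan (suc c) l S Ns st eq Ts bl cont =
      step (Ts ≤-refl) (below-∉ bl (rank-p (2 + l) (s≤s l<))) (p∈ (s≤s l<)) (trans (byRole-p (2 + l)) (sym (byCoord-dir l)))
        (trans (byRole-p (2 + l)) (sym (byCoord-dir l)))
        (wf-fan c (suc l) _ _ st (trans (sym (+-suc l c)) eq) Ts′ (below-∷ bl (rank-p (2 + l) (s≤s l<)) ≤-refl) cont)
      where
      l< : l < suc κ
      l< = subst (suc l ≤_) eq (≤-trans (s≤s (m≤m+n l c)) (≤-reflexive (sym (+-suc l c))))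
      Ts′ : ∀ {i} → i ≤ suc l → T i ∈ T l [ dir l ]≔ p (2 + l) ∷ Ns
      Ts′ {i} i≤ = [ (λ i< → there (Ts (s≤s⁻¹ i<))) , (λ i≡ → here (trans (cong T i≡) (sym (T-next l)))) ]′ (m≤n⇒m<n∨m≡n i≤)

    wf : WF S₀ [ T 0 ] steps
    wf = wf-fan (suc κ) 0 S₀ [ T 0 ] _ refl (λ { z≤n → here refl }) below₀
           (λ S Ns Ts bl → wf-legs κ 0 S Ns _ refl Ts (λ ()) bl
             (λ S′ Ns′ Fs bl′ → wf-blocks (suc κ) 0 S′ Ns′ refl Fs bl′))
      where
      below₀ : Below 2 S₀
      below₀ (here refl) = s≤s z≤n
      below₀ (there (here refl)) = s≤s z≤n
      below₀ (there (there (here refl))) = s≤s (s≤s z≤n)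
      below₀ (there (there (there (here refl)))) = s≤s z≤n

    finalS-⊇ : ∀ st {S ρ} → ρ ∈ S → ρ ∈ finalS S st
    finalS-⊇ []       ρ∈ = ρ∈
    finalS-⊇ (_ ∷ st) ρ∈ = finalS-⊇ st (there ρ∈)

    finalS-role : ∀ {st S x} → x ∈ st → role x ∈ finalS S st
    finalS-role {_ ∷ st} (here refl) = finalS-⊇ st (here refl)
    finalS-role {_ ∷ st} (there x∈)  = finalS-role x∈

    finalN-⊇ : ∀ st {Ns m} → m ∈ Ns → m ∈ finalN Ns st
    finalN-⊇ []       m∈ = m∈
    finalN-⊇ (_ ∷ st) m∈ = finalN-⊇ st (there m∈)

    finalN-node : ∀ {st Ns q m ρ} → (q , m , ρ) ∈ st → m [ q ]≔ ρ ∈ finalN Ns st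
    finalN-node {_ ∷ st} (here refl) = finalN-⊇ st (here refl)
    finalN-node {_ ∷ st} (there x∈)  = finalN-node x∈

    fan∈ : ∀ {l} → l ≤ κ → fanStep l ∈ steps
    fan∈ l≤ = ∈-++⁺ˡ (∈-segment fanStep 0 (suc κ) z≤n (s≤s l≤))

    leg∈ : ∀ {l} → l < κ → legStep l ∈ steps
    leg∈ l< = ∈-++⁺ʳ (segment fanStep 0 (suc κ)) (∈-++⁺ˡ (∈-segment legStep 0 κ z≤n l<))

    block∈ : ∀ {l} → l ≤ κ → blockStep l ∈ steps
    block∈ l≤ = ∈-++⁺ʳ (segment fanStep 0 (suc κ)) (∈-++⁺ʳ (segment legStep 0 κ) (∈-segment blockStep 0 (suc κ) z≤n (s≤s l≤)))

    Assigned : Role → Set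
    Assigned ρ = ρ ∈ finalS S₀ steps

    assigned-X : ∀ l → l < k → Assigned (X l)
    assigned-X zero          _  = finalS-⊇ steps (here refl)
    assigned-X (suc zero)    _  = finalS-⊇ steps (there (there (here refl)))
    assigned-X (suc (suc l)) l< = subst Assigned (p-mid l<) (finalS-role (fan∈ (≤-trans (n≤1+n l) (s≤s⁻¹ (s≤s⁻¹ l<)))))

    assigned-Y : ∀ l → l < k → Assigned (Y l)
    assigned-Y zero    _  = finalS-⊇ steps (there (here refl))
    assigned-Y (suc l) l< =
      [ (λ l<κ → finalS-role (leg∈ l<κ)) ,
        (λ l≡κ → subst (λ i → Assigned (Y (suc i))) (sym l≡κ) (subst Assigned p-last (finalS-role (fan∈ {κ} ≤-refl)))) ]′
      (m≤n⇒m<n∨m≡n (s≤s⁻¹ (s≤s⁻¹ l<)))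

    assigned-W : ∀ l → l < k → Assigned (W l)
    assigned-W zero    _  = finalS-⊇ steps (there (there (there (here refl))))
    assigned-W (suc l) l< = finalS-role (block∈ (s≤s⁻¹ (s≤s⁻¹ l<)))

    roles⊆ : ∀ {ρ} → ρ ∈ roles → Assigned ρ
    roles⊆ {ρ} = roles-elim Assigned assigned-X assigned-Y assigned-W

    proper : ∀ {f} → Inv (finalS S₀ steps) (finalN [ T 0 ] steps) f → All (Sat f) steps → Proper f
    proper {f} inv sats = record
      { width    = λ ρ∈ → Inv.width inv (roles⊆ ρ∈)
      ; unique   = λ ρ∈ → Inv.unique inv (roles⊆ ρ∈)
      ; disjoint = λ ρ∈ ρ′∈ → Inv.disjoint inv (roles⊆ ρ∈) (roles⊆ ρ′∈)
      ; edge     = λ { {zero} _ → Inv.node inv (finalN-⊇ steps (here refl))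
                     ; {suc l} l< → Inv.node inv (subst (_∈ finalN [ T 0 ] steps) (F⇒E (suc l)) (finalN-node (block∈ (s≤s⁻¹ (s≤s⁻¹ l<))))) }
      ; fan      = λ {l} l≤ → subst (λ m → R (dir l) (Vec.map f (T l)) (Vec.map f m)) (T-next l) (All.lookup sats (fan∈ l≤))
      ; leg      = λ {l} l< → subst (λ m → R 0F (Vec.map f (T (suc l))) (Vec.map f m))
                              (trans (cong (T (suc l) [ 0F ]≔_) (sym (apex-mid l<))) (T⇒F (suc l))) (All.lookup sats (leg∈ l<))
      ; swap     = λ {l} l≤ → subst (λ m → R 3F (Vec.map f (F (suc l))) (Vec.map f m)) (F⇒E (suc l)) (All.lookup sats (block∈ l≤))
      }

    -- The starting tuple is laid on the triangle `T 0`, which is also cycle edge 0. The empty list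
    -- is a placeholder for roles that a later step assigns.
    base : Vec (List (Fin n)) 4 → Cfg
    base a (X zero)       = lookup a 0F
    base a (X (suc zero)) = lookup a 2F
    base a (Y zero)       = lookup a 1F
    base a (W zero)       = lookup a 3F
    base a _              = []

    base-T0 : ∀ a → Vec.map (base a) (T 0) ≡ a
    base-T0 (_ Vec.∷ _ Vec.∷ _ Vec.∷ _ Vec.∷ Vec.[]) = refl

    coordinate : ∀ a {ρ} → ρ ∈ S₀ → ∃ λ q → ρ ≡ lookup (T 0) q × base a ρ ≡ lookup a q × byRole 1 w ρ ≡ byCoord 1 w q
    coordinate a (here refl)                         = 0F , refl , refl , refl
    coordinate a (there (here refl))                 = 1F , refl , refl , refl
    coordinate a (there (there (here refl)))         = 2F , refl , refl , refl
    coordinate a (there (there (there (here refl)))) = 3F , refl , refl , refl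

    base-inv : ∀ {a} → a ∈ A → Inv S₀ [ T 0 ] (base a)
    base-inv {a} a∈ = record
      { width    = λ ρ∈ → let q , _ , f≡ , w≡ = coordinate a ρ∈ in trans (cong length f≡) (trans (A-width a q a∈) (sym w≡))
      ; unique   = λ ρ∈ → let q , _ , f≡ , _ = coordinate a ρ∈ in subst Unique (sym f≡) (A-unique a q a∈)
      ; disjoint = λ ρ∈ ρ′∈ v v′ → let q , ρ≡ , f≡ , _ = coordinate a ρ∈
                                       q′ , ρ′≡ , f≡′ , _ = coordinate a ρ′∈
                                   in trans ρ≡ (trans (cong (lookup (T 0)) (A-disjoint a q q′ a∈ (subst (_ ∈_) f≡ v) (subst (_ ∈_) f≡′ v′))) (sym ρ′≡))
      ; node     = λ { (here refl) → subst (_∈ A) (sym (base-T0 a)) a∈ }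
      }

    S₀-unique : Unique S₀
    S₀-unique = ((λ ()) ∷ (λ ()) ∷ (λ ()) ∷ []) ∷ ((λ ()) ∷ (λ ()) ∷ []) ∷ ((λ ()) ∷ []) ∷ [] ∷ []

    S₀⊆ : ∀ {ρ} → ρ ∈ S₀ → ρ ∈ roles
    S₀⊆ (here refl) = X∈ (s≤s z≤n)
    S₀⊆ (there (here refl)) = Y∈ (s≤s z≤n)
    S₀⊆ (there (there (here refl))) = X∈ (s≤s (s≤s z≤n))
    S₀⊆ (there (there (there (here refl)))) = W∈ (s≤s z≤n)

    closed₀ : Closed S₀ [ T 0 ]
    closed₀ (here refl) 0F = here refl
    closed₀ (here refl) 1F = there (here refl)
    closed₀ (here refl) 2F = there (there (here refl))
    closed₀ (here refl) 3F = there (there (there (here refl)))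

    -- Beyond the initial edge there are κ + 1 fan steps and κ legs, each a choice among about s
    -- vertices, and κ + 1 choices of a block of about b. As k = κ + 2, the exponents are 2k - 3 and
    -- k - 1. Different initial tuples give different configurations, since the tuple can be read
    -- off at `T 0`.
    configurations : Σ (List Cfg) λ L → length A * (s ^ suc (κ + κ) * b ^ suc κ) ≤ M ^ length steps * length L ×
                       All Proper L × AllPairs Diff L
    configurations =
      let L , large , props , ap = collect Proper (λ a g → Vec.map g (T 0) ≡ a) tag-inj
            (product (map (byRole s b ∘ role) steps)) (M ^ length steps) A uA from
      in L , subst (λ c → length A * c ≤ M ^ length steps * length L) costs large , All.map proj₂ props , ap
      where
      tag-inj : ∀ {a a′ g g′} → Vec.map g (T 0) ≡ a → Vec.map g′ (T 0) ≡ a′ → Agree roles g g′ → a ≡ a′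
      tag-inj {g = g} {g′} refl refl agree = map-cong-lookup {f = g} {g = g′} (T 0) (λ i → agree _ (S₀⊆ (closed₀ (here refl) i)))
      from : ∀ a → a ∈ A → Σ (List Cfg) λ L → product (map (byRole s b ∘ role) steps) ≤ M ^ length steps * length L ×
               All (λ g → Vec.map g (T 0) ≡ a × Proper g) L × AllPairs Diff L
      from a a∈ =
        let L , large , props , ap = greedy steps S₀ [ T 0 ] (base a) wf S₀-unique S₀⊆ closed₀ (base-inv a∈)
        in L , large , All.map (λ { {g} (agree , inv , sats) →
             trans (map-cong-lookup {f = g} {g = base a} (T 0) (λ i → agree _ (closed₀ (here refl) i))) (base-T0 a) , proper inv sats }) props , ap
      open ≡-Reasoning
      cost : Step → ℕ
      cost = byRole s b ∘ role
      costs : product (map cost steps) ≡ s ^ suc (κ + κ) * b ^ suc κ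
      costs = begin
        product (map cost (fs ++ ls ++ bs))
          ≡⟨ cong product (trans (map-++ cost fs _) (cong (map cost fs ++_) (map-++ cost ls bs))) ⟩
        product (map cost fs ++ map cost ls ++ map cost bs)
          ≡⟨ trans (product-++ (map cost fs) _) (cong (product (map cost fs) *_) (product-++ (map cost ls) _)) ⟩
        product (map cost fs) * (product (map cost ls) * product (map cost bs))
          ≡⟨ cong₂ _*_ (product-segment cost fanStep s (λ l → byRole-p (2 + l)) 0 (suc κ))
                       (cong₂ _*_ (product-segment cost legStep s (λ _ → refl) 0 κ) (product-segment cost blockStep b (λ _ → refl) 0 (suc κ))) ⟩
        s ^ suc κ * (s ^ κ * b ^ suc κ)
          ≡⟨ *-assoc (s ^ suc κ) (s ^ κ) _ ⟨
        s ^ suc κ * s ^ κ * b ^ suc κ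
          ≡⟨ cong (_* b ^ suc κ) (^-distribˡ-+-* s (suc κ) κ) ⟨
        s ^ suc (κ + κ) * b ^ suc κ ∎
        where
        fs = segment fanStep 0 (suc κ)
        ls = segment legStep 0 κ
        bs = segment blockStep 0 (suc κ)

-- Few configurations through given edges: exploring the tree from one of them

module Upper (κ w n s b : ℕ) (1≤d : ∀ q → 1 ≤ byCoord s b q)
  (A : List (Vec (List (Fin n)) 4)) (uA : Unique A)
  (thick : ∀ a q → a ∈ A → byCoord s b q ≤ length (filter (λ x → VecP.≡-dec (≡-dec FinP._≟_) (erase q x) (erase q a)) A))
  where

  open CycleConfig κ w n s b 1≤d A uA thick

  module Count (Valid : Cfg → Set) (valid⇒proper : ∀ {f} → Valid f → Proper f) (B : Role → ℕ) (1≤B : ∀ ρ → 1 ≤ B ρ) where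

    open Reveal roles-unique Valid B 1≤B public

    module From (price : ∀ {ρ} → ρ ∈ roles → Cheap ρ ⊎ 2 * byRole s b ρ ≤ B ρ)
                {l₀ : ℕ} (l₀<k : l₀ < k) (E∈ : ∀ q → lookup (E l₀) q ∈ roles) (cheap : ∀ q → Cheap (lookup (E l₀) q)) where

      _⊑_ : Node → List Role → Set
      m ⊑ S = ∀ i → lookup m i ∈ S

      -- `Bounded` propagates from larger sets of revealed roles to smaller ones, whereas the tree
      -- is explored in the direction of growing sets. Each stage therefore takes the rest of the
      -- exploration as a continuation; all costs are already contained in `Bounded`.
      Gain : List Role → (List Role → Set) → Set
      Gain S P = (∀ S′ → (∀ {ρ} → ρ ∈ S → ρ ∈ S′) → P S′ → Bounded S′) → Bounded S

      gain-all : ∀ N (m : ℕ → Node) S →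
        (∀ l S′ → l < N → (∀ {ρ} → ρ ∈ S → ρ ∈ S′) → (∀ i → i < l → m i ⊑ S′) → Gain S′ (m l ⊑_)) →
        Gain S (λ S′ → ∀ i → i < N → m i ⊑ S′)
      gain-all zero    m S next cont = cont S id (λ i ())
      gain-all (suc N) m S next cont =
        gain-all N m S (λ l S′ l< → next l S′ (≤-trans l< (n≤1+n N))) λ S′ sub done →
          next N S′ ≤-refl sub done λ S″ sub′ m⊑ →
            cont S″ (sub′ ∘ sub) λ i i< j → [ (λ i<N → sub′ (done i i<N j)) , (λ { refl → m⊑ j }) ]′ (m≤n⇒m<n∨m≡n (s≤s⁻¹ i<))

      gain-edge : ∀ {S} q m ρ m′ → m [ q ]≔ ρ ≡ m′ → ρ ∈ roles → byRole s b ρ ≡ byCoord s b q → m ⊑ S →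
                  (∀ f → Valid f → R q (Vec.map f m) (Vec.map f m′)) → Gain S (m′ ⊑_)
      gain-edge {S} q m ρ _ refl ρ∈ eq m⊑ sat cont =
        reveal-edge q m ρ∈ ([ inj₁ , (λ large → inj₂ (subst (λ d → 2 * d ≤ B ρ) eq large)) ]′ (price ρ∈)) m⊑ sat (cont (ρ ∷ S) there new)
        where
        new : (m [ q ]≔ ρ) ⊑ (ρ ∷ S)
        new i with i FinP.≟ q
        ... | yes refl = here (VecP.lookup∘updateAt q m)
        ... | no  i≢q  = there (subst (_∈ S) (sym (VecP.lookup∘updateAt′ i q i≢q m)) (m⊑ i))

      weaken : ∀ {m S S′} → (∀ {ρ} → ρ ∈ S → ρ ∈ S′) → m ⊑ S → m ⊑ S′
      weaken sub m⊑ i = sub (m⊑ i)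

      gain-E : ∀ {S} → Gain S (E l₀ ⊑_)
      gain-E {S} cont =
        reveal-cheap (E∈ 0F) (cheap 0F) (reveal-cheap (E∈ 1F) (cheap 1F) (reveal-cheap (E∈ 2F) (cheap 2F) (reveal-cheap (E∈ 3F) (cheap 3F)
          (cont _ (λ ρ∈ → there (there (there (there ρ∈))))
            (λ { 0F → there (there (there (here refl))) ; 1F → there (there (here refl)) ; 2F → there (here refl) ; 3F → here refl })))))

      gain-F : ∀ l {S} → l < k → E l ⊑ S → Gain S (F l ⊑_)
      gain-F zero    l< E⊑ cont = cont _ id E⊑
      gain-F (suc l) l< E⊑ = gain-edge 3F (E (suc l)) (W 0) (F (suc l)) (E⇒F (suc l)) (W∈ (s≤s z≤n)) refl E⊑
        (λ f vf → R-sym (Proper.swap (valid⇒proper vf) (s≤s⁻¹ (s≤s⁻¹ l<))))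

      gain-T : ∀ l {S} → l < k → F l ⊑ S → Gain S (T l ⊑_)
      gain-T zero    l< F⊑ cont = cont _ id F⊑
      gain-T (suc l) {S} l< F⊑ with m≤n⇒m<n∨m≡n (s≤s⁻¹ (s≤s⁻¹ l<))
      ... | inj₂ refl = λ cont → cont S id (subst (_⊑ S) F-last F⊑)
      ... | inj₁ l<κ  = gain-edge 0F (F (suc l)) (X 0) (T (suc l)) (F⇒T (suc l)) (X∈ (s≤s z≤n)) refl F⊑
                          (λ f vf → R-sym (Proper.leg (valid⇒proper vf) l<κ))

      gain-next : ∀ l {S} → l ≤ κ → T l ⊑ S → Gain S (T (suc l) ⊑_)
      gain-next l l≤ T⊑ = gain-edge (dir l) (T l) (p (2 + l)) (T (suc l)) (T-next l) (p∈ (s≤s (s≤s l≤)))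
        (trans (byRole-p (2 + l)) (sym (byCoord-dir l))) T⊑ (λ f vf → Proper.fan (valid⇒proper vf) l≤)

      gain-prev : ∀ l {S} → l ≤ κ → T (suc l) ⊑ S → Gain S (T l ⊑_)
      gain-prev l l≤ T⊑ = gain-edge (dir l) (T (suc l)) (p l) (T l) (T-prev l) (p∈ (≤-trans l≤ (≤-trans (n≤1+n κ) (n≤1+n _))))
        (trans (byRole-p l) (sym (byCoord-dir l))) T⊑ (λ f vf → R-sym (Proper.fan (valid⇒proper vf) l≤))

      gain-up : ∀ {S} → T l₀ ⊑ S → Gain S (λ S′ → ∀ i → i < k ∸ l₀ → T (l₀ + i) ⊑ S′)
      gain-up {S} T⊑ = gain-all (k ∸ l₀) (λ i → T (l₀ + i)) S climb
        where
        climb : ∀ l S′ → l < k ∸ l₀ → (∀ {ρ} → ρ ∈ S → ρ ∈ S′) → (∀ i → i < l → T (l₀ + i) ⊑ S′) → Gain S′ (T (l₀ + l) ⊑_)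
        climb zero    S′ l< sub done cont = cont S′ id (subst (λ i → T i ⊑ S′) (sym (+-identityʳ l₀)) (weaken {T l₀} sub T⊑))
        climb (suc l) S′ l< sub done rewrite +-suc l₀ l = gain-next (l₀ + l) (s≤s⁻¹ (s≤s⁻¹ below)) (done l ≤-refl)
          where
          below : 2 + (l₀ + l) ≤ k
          below = ≤-trans (≤-reflexive (trans (cong suc (sym (+-suc l₀ l))) (sym (+-suc l₀ (suc l)))))
                    (≤-trans (+-monoʳ-≤ l₀ l<) (≤-reflexive (m+[n∸m]≡n (<⇒≤ l₀<k))))

      gain-down : ∀ {S} → T l₀ ⊑ S → Gain S (λ S′ → ∀ i → i < suc l₀ → T (l₀ ∸ i) ⊑ S′)
      gain-down {S} T⊑ = gain-all (suc l₀) (λ i → T (l₀ ∸ i)) S descend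
        where
        descend : ∀ l S′ → l < suc l₀ → (∀ {ρ} → ρ ∈ S → ρ ∈ S′) → (∀ i → i < l → T (l₀ ∸ i) ⊑ S′) → Gain S′ (T (l₀ ∸ l) ⊑_)
        descend zero    S′ l< sub done cont = cont S′ id (weaken {T l₀} sub T⊑)
        descend (suc l) S′ l< sub done = gain-prev (l₀ ∸ suc l)
            (≤-trans (∸-monoʳ-≤ {1} {suc l} l₀ (s≤s z≤n)) (∸-monoˡ-≤ 1 (s≤s⁻¹ l₀<k)))
            (subst (λ i → T i ⊑ S′) (∸-suc-suc (s≤s⁻¹ l<)) (done l ≤-refl))
          where
          ∸-suc-suc : ∀ {m i} → i < m → m ∸ i ≡ suc (m ∸ suc i)
          ∸-suc-suc {suc m} {zero}  _       = refl
          ∸-suc-suc {suc m} {suc i} (s≤s h) = ∸-suc-suc h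

      -- The triangles of the fan form a path in which neighbours differ in a single coordinate, so
      -- one of them gives access to all in both directions.
      gain-fan : ∀ {S} → T l₀ ⊑ S → Gain S (λ S′ → ∀ i → i < k → T i ⊑ S′)
      gain-fan T⊑ cont = gain-up T⊑ λ S₁ sub₁ up → gain-down (weaken {T l₀} sub₁ T⊑) λ S₂ sub₂ down →
        cont S₂ (sub₂ ∘ sub₁) λ i i<k → [ (λ i≤ → subst (λ j → T j ⊑ S₂) (m∸[m∸n]≡n i≤) (down (l₀ ∸ i) (s≤s (m∸n≤m l₀ i)))) ,
          (λ l₀≤i → subst (λ j → T j ⊑ S₂) (m+[n∸m]≡n l₀≤i) (weaken {T (l₀ + (i ∸ l₀))} sub₂ (up (i ∸ l₀) (∸-monoˡ-< i<k l₀≤i)))) ]′ (≤-total i l₀)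

      gain-legs : ∀ {S} → (∀ i → i < k → T i ⊑ S) → Gain S (λ S′ → ∀ i → i < κ → F (suc i) ⊑ S′)
      gain-legs {S} Ts = gain-all κ (F ∘ suc) S λ l S′ l< sub _ →
        gain-edge 0F (T (suc l)) (apex (suc l)) (F (suc l)) (T⇒F (suc l)) (apex∈ (≤-trans (s≤s l<) (n≤1+n _)))
          (cong (byRole s b) (apex-mid l<)) (weaken {T (suc l)} sub (Ts (suc l) (≤-trans (s≤s l<) (n≤1+n _))))
          (λ f vf → Proper.leg (valid⇒proper vf) l<)

      gain-blocks : ∀ {S} → (∀ i → i ≤ κ → F (suc i) ⊑ S) → Gain S (λ S′ → ∀ i → i < suc κ → E (suc i) ⊑ S′)
      gain-blocks {S} Fs = gain-all (suc κ) (E ∘ suc) S λ l S′ l< sub _ →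
        gain-edge 3F (F (suc l)) (W (suc l)) (E (suc l)) (F⇒E (suc l)) (W∈ (s≤s l<)) refl
          (weaken {F (suc l)} sub (Fs l (s≤s⁻¹ l<))) (λ f vf → Proper.swap (valid⇒proper vf) (s≤s⁻¹ l<))

      T-p : ∀ l {S} → T l ⊑ S → p l ∈ S × p (suc l) ∈ S
      T-p l T⊑ with even l
      ... | true  = T⊑ 1F , T⊑ 2F
      ... | false = T⊑ 2F , T⊑ 1F

      F-apex : ∀ l {S} → F l ⊑ S → apex l ∈ S
      F-apex l F⊑ with even l
      ... | true  = F⊑ 0F
      ... | false = F⊑ 0F

      E-W : ∀ l {S} → E l ⊑ S → W l ∈ S
      E-W l E⊑ with even l
      ... | true  = E⊑ 3F
      ... | false = E⊑ 3F

      full : ∀ {S} → (∀ i → i < k → T i ⊑ S) → (∀ i → i < κ → F (suc i) ⊑ S) → (∀ i → i < suc κ → E (suc i) ⊑ S) →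
             ∀ {ρ} → ρ ∈ roles → ρ ∈ S
      full {S} Ts Fs Es = roles-elim (_∈ S) revealed-X revealed-Y revealed-W
        where
        revealed-X : ∀ l → l < k → X l ∈ S
        revealed-X zero    _  = Ts 0 (s≤s z≤n) 0F
        revealed-X (suc l) l< = subst (_∈ S) (p-mid l<) (proj₁ (T-p (suc l) (Ts (suc l) l<)))
        revealed-Y : ∀ l → l < k → Y l ∈ S
        revealed-Y zero    _  = Ts 0 (s≤s z≤n) 1F
        revealed-Y (suc l) l< =
          [ (λ l<κ → subst (_∈ S) (apex-mid l<κ) (F-apex (suc l) (Fs l l<κ))) ,
            (λ l≡κ → subst (λ i → Y (suc i) ∈ S) (sym l≡κ) (subst (_∈ S) p-last (proj₂ (T-p (suc κ) (Ts (suc κ) ≤-refl))))) ]′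
          (m≤n⇒m<n∨m≡n (s≤s⁻¹ (s≤s⁻¹ l<)))
        revealed-W : ∀ l → l < k → W l ∈ S
        revealed-W zero    _  = Ts 0 (s≤s z≤n) 3F
        revealed-W (suc l) l< = E-W (suc l) (Es l (s≤s⁻¹ l<))

      -- The exploration visits every node from a single known edge and pays no attention to the
      -- other known edges. These enter only through the prices: the charge is per role, and a role
      -- on any known edge is cheap whenever it is reached.
      bounded : Bounded []
      bounded = gain-E λ S₁ _ E⊑ → gain-F l₀ l₀<k E⊑ λ S₂ _ F⊑ → gain-T l₀ l₀<k F⊑ λ S₃ _ T⊑ → gain-fan T⊑ λ S₄ _ Ts →
        gain-legs Ts λ S₅ sub₅ Fs → gain-blocks (allF S₅ (λ i i< → weaken {T i} sub₅ (Ts i i<)) Fs) λ S₆ sub₆ Es →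
          bounded-full (full (λ i i< → weaken {T i} (sub₆ ∘ sub₅) (Ts i i<)) (λ i i< → weaken {F (suc i)} sub₆ (Fs i i<)) Es)
        where
        allF : ∀ S → (∀ i → i < k → T i ⊑ S) → (∀ i → i < κ → F (suc i) ⊑ S) → ∀ i → i ≤ κ → F (suc i) ⊑ S
        allF S Ts Fs i i≤ with m≤n⇒m<n∨m≡n i≤
        ... | inj₁ i<   = Fs i i<
        ... | inj₂ refl = subst (_⊑ S) (sym F-last) (Ts (suc κ) ≤-refl)

      count : ∀ L → AllPairs Diff L → All Valid L → length L ≤ product (map B roles)
      count L ap vs = ≤-trans (bounded L (family ap vs (λ _ _ _ ())))
        (unique-⊆⇒product≤ (hidden-unique []) (hidden-⊆ []) B 1≤B)

product-≤ : ∀ {I : Set} {P : I → Set} (P? : Decidable P) (f : I → ℕ) (C D : ℕ) (xs : List I) → 1 ≤ D →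
            (∀ i → i ∈ xs → f i ≤ C * D) → (∀ i → i ∈ xs → P i → f i ≤ C) →
            product (map f xs) ≤ C ^ length xs * D ^ length (filter (¬? ∘ P?) xs)
product-≤ P? f C D [] _ _ _ = ≤-refl
product-≤ P? f C D (x ∷ xs) 1≤D fD fC with product-≤ P? f C D xs 1≤D (λ i i∈ → fD i (there i∈)) (λ i i∈ → fC i (there i∈)) | P? x
... | ih | yes px = ≤-trans (*-mono-≤ (fC x (here refl) px) ih) (≤-reflexive (sym (*-assoc C _ _)))
... | ih | no  _  = ≤-trans (*-mono-≤ (fD x (here refl)) ih) (≤-reflexive (rearrange C D (C ^ length xs) _))
  where
  rearrange : ∀ c d x y → c * d * (x * y) ≡ c * x * (d * y)
  rearrange = solve-∀

last-switch : ∀ {P : ℕ → Set} (P? : Decidable P) {l l′} → l < l′ → P l → ¬ P l′ → ∃ λ i → i < l′ × P i × ¬ P (suc i)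
last-switch P? {l} {suc l′} l< pl ¬p with P? l′
... | yes p′ = l′ , ≤-refl , p′ , ¬p
... | no ¬p′ with m≤n⇒m<n∨m≡n (s≤s⁻¹ l<)
...   | inj₂ refl = contradiction pl ¬p′
...   | inj₁ l<l′ = let i , i< , pi , ¬pi = last-switch P? l<l′ pl ¬p′ in i , ≤-trans i< (n≤1+n l′) , pi , ¬pi

module Hidden (κ : ℕ) (ls : List ℕ) (ls-unique : Unique ls) (ls< : ∀ {l} → l ∈ ls → l < suc (suc κ)) (ls≢[] : ∃ λ l → l ∈ ls) where

  open import Data.List.Membership.DecPropositional _≟_ using (_∈?_)

  k : ℕ
  k = suc (suc κ)

  prev : ℕ → ℕ
  prev zero    = suc κ
  prev (suc l) = l

  -- `X l` is shared by the cycle edges `l` and `prev l`, so it is known as soon as one of them is.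
  touched? : ∀ l → Dec (l ∈ ls ⊎ prev l ∈ ls)
  touched? l = (l ∈? ls) ⊎-dec (prev l ∈? ls)

  missing untouched : List ℕ
  missing   = filter (λ l → ¬? (l ∈? ls)) (upTo k)
  untouched = filter (λ l → ¬? (touched? l)) (upTo k)

  missing≤ : length missing ≤ k ∸ length ls
  missing≤ = m+n≤o⇒m≤o∸n (length missing) (≤-trans (≤-reflexive (sym (length-++ missing)))
    (≤-trans (unique-⊆⇒length≤ (UniqueP.++⁺ (UniqueP.filter⁺ (λ l → ¬? (l ∈? ls)) (UniqueP.upTo⁺ k)) ls-unique
                                 (λ (m∈ , l∈) → proj₂ (∈-filter⁻ (λ l → ¬? (l ∈? ls)) {xs = upTo k} m∈) l∈)) sub)
             (≤-reflexive (length-upTo k))))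
    where
    sub : ∀ {l} → l ∈ missing ++ ls → l ∈ upTo k
    sub l∈ with ∈-++⁻ missing l∈
    ... | inj₁ m∈ = proj₁ (∈-filter⁻ (λ l → ¬? (l ∈? ls)) m∈)
    ... | inj₂ l∈′ = ∈-upTo⁺ (ls< l∈′)

  -- The X-vertex shared by these two edges is not hidden, so fewer X-vertices than edges are hidden:
  -- this is why the exponent of t is one less than that of D.
  boundary : ∀ {l} → l < k → l ∉ ls → ∃ λ i → i < k × i ∉ ls × prev i ∈ ls
  boundary {l} l< l∉ with 0 ∈? ls | suc κ ∈? ls
  ... | no 0∉ | yes last∈ = 0 , s≤s z≤n , 0∉ , last∈
  ... | yes 0∈ | _ = let i , i< , i∈ , si∉ = last-switch (_∈? ls) (n≢0⇒n>0 (λ { refl → l∉ 0∈ })) 0∈ l∉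
                     in suc i , <-≤-trans (s≤s i<) l< , si∉ , i∈
  ... | no _ | no last∉ = let i , i< , i∈ , si∉ = last-switch (_∈? ls) (≤∧≢⇒< (s≤s⁻¹ (ls< (proj₂ ls≢[]))) λ { refl → last∉ (proj₂ ls≢[]) }) (proj₂ ls≢[]) last∉
                          in suc i , s≤s i< , si∉ , i∈

  untouched⊆missing : ∀ {l} → l ∈ untouched → l ∈ missing
  untouched⊆missing l∈ = let l∈′ , ¬t = ∈-filter⁻ (λ l → ¬? (touched? l)) l∈ in ∈-filter⁺ (λ l → ¬? (l ∈? ls)) l∈′ (¬t ∘ inj₁)

  untouched-unique : Unique untouched
  untouched-unique = UniqueP.filter⁺ (λ l → ¬? (touched? l)) (UniqueP.upTo⁺ k)

  untouched≤ : length untouched ≤ k ∸ length ls ∸ 1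
  untouched≤ = by-cases missing refl
    where
    by-cases : ∀ ms → ms ≡ missing → length untouched ≤ k ∸ length ls ∸ 1
    -- If no cycle edge is missing there is no boundary to gain from, but then no X-vertex is
    -- untouched either, in accordance with the truncated subtraction.
    by-cases [] eq = ≤-trans (unique-⊆⇒length≤ untouched-unique (subst (_ ∈_) (sym eq) ∘ untouched⊆missing)) z≤n
    by-cases (l ∷ ms) eq =
      let l∈ , l∉ = ∈-filter⁻ (λ l → ¬? (l ∈? ls)) {xs = upTo k} (subst (l ∈_) eq (here refl))
          i , i<k , i∉ , prev∈ = boundary (∈-upTo⁻ l∈) l∉
          unique⁺ : Unique (i ∷ untouched)
          unique⁺ = All.tabulate (λ { u∈ refl → proj₂ (∈-filter⁻ (λ l → ¬? (touched? l)) {xs = upTo k} u∈) (inj₂ prev∈) }) ∷ untouched-unique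
          fewer : suc (length untouched) ≤ length missing
          fewer = unique-⊆⇒length≤ unique⁺
            (λ { (here refl) → ∈-filter⁺ (λ l → ¬? (l ∈? ls)) (∈-upTo⁺ i<k) i∉ ; (there u∈) → untouched⊆missing u∈ })
      in ∸-monoˡ-≤ 1 (≤-trans fewer missing≤)

module Degree (κ w n s b : ℕ) (1≤d : ∀ q → 1 ≤ byCoord s b q)
  (A : List (Vec (List (Fin n)) 4)) (uA : Unique A)
  (thick : ∀ a q → a ∈ A → byCoord s b q ≤ length (filter (λ x → VecP.≡-dec (≡-dec FinP._≟_) (erase q x) (erase q a)) A))
  (zs : List (ℕ × List (Fin n))) (zs-unique : Unique (map proj₁ zs))
  (zs< : ∀ {z} → z ∈ zs → proj₁ z < suc (suc κ)) (zs-size : ∀ {z} → z ∈ zs → length (proj₂ z) ≡ 3 + w)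
  (zs≢[] : ∃ λ z → z ∈ zs)
  where

  open CycleConfig κ w n s b 1≤d A uA thick
  open Upper κ w n s b 1≤d A uA thick

  -- A role on a known edge takes as its value a list of at most r entries from the r vertices of
  -- that edge, which allows at most r^r values.
  r C₀ : ℕ
  r  = 3 + w
  C₀ = r ^ r

  -- Each entry of `zs` gives a position on the cycle and the vertex set of the edge there. How
  -- those vertices are distributed over the roles of the edge stays unknown; the price `C₀` pays
  -- for this.
  Valid : Cfg → Set
  Valid f = Proper f × (∀ {z} → z ∈ zs → ∀ q → All (_∈ proj₂ z) (f (lookup (E (proj₁ z)) q)))

  Known : Role → Set
  Known ρ = Any (λ z → ∃ λ q → lookup (E (proj₁ z)) q ≡ ρ) zs

  known? : Decidable Known
  known? ρ = Any.any? (λ z → FinP.any? (λ q → lookup (E (proj₁ z)) q ≟R ρ)) zs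

  B : Role → ℕ
  B ρ with known? ρ
  ... | yes _ = C₀
  ... | no  _ = 2 * byRole s b ρ

  1≤C₀ : 1 ≤ C₀
  1≤C₀ = m^n>0 r r

  1≤2d : ∀ ρ → 1 ≤ 2 * byRole s b ρ
  1≤2d (X _) = ≤-trans (1≤d 0F) (m≤m+n s _)
  1≤2d (Y _) = ≤-trans (1≤d 0F) (m≤m+n s _)
  1≤2d (W _) = ≤-trans (1≤d 3F) (m≤m+n b _)

  1≤B : ∀ ρ → 1 ≤ B ρ
  1≤B ρ with known? ρ
  ... | yes _ = 1≤C₀
  ... | no  _ = 1≤2d ρ

  B≤ : ∀ ρ → B ρ ≤ C₀ * (2 * byRole s b ρ)
  B≤ ρ with known? ρ
  ... | yes _ = ≤-trans (≤-reflexive (sym (*-identityʳ C₀))) (*-monoʳ-≤ C₀ (1≤2d ρ))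
  ... | no  _ = 1≤n⇒m≤n*m 1≤C₀

  B-known : ∀ {ρ} → Known ρ → B ρ ≡ C₀
  B-known {ρ} kn with known? ρ
  ... | yes _  = refl
  ... | no ¬kn = contradiction kn ¬kn

  open Count Valid proj₁ B 1≤B

  width≤r : ∀ ρ → byRole 1 w ρ ≤ r
  width≤r (X _) = s≤s z≤n
  width≤r (Y _) = s≤s z≤n
  width≤r (W _) = m≤n+m w 3

  known⇒cheap : ∀ {ρ} → ρ ∈ roles → Known ρ → Cheap ρ
  known⇒cheap {ρ} ρ∈ kn with find kn
  ... | (l , U) , z∈ , q , refl = listsOver (byRole 1 w ρ) U ,
    ≤-trans (≤-reflexive (trans (length-listsOver (byRole 1 w ρ) U) (cong (_^ byRole 1 w ρ) (zs-size z∈))))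
      (≤-trans (^-monoʳ-≤ r (width≤r ρ)) (≤-reflexive (sym (B-known kn)))) ,
    λ { f (proper , within) → ∈-listsOver (byRole 1 w ρ) (Proper.width proper ρ∈) (within z∈ q) }

  price : ∀ {ρ} → ρ ∈ roles → Cheap ρ ⊎ 2 * byRole s b ρ ≤ B ρ
  price {ρ} ρ∈ = by-cases (known? ρ)
    where
    unknown : ¬ Known ρ → 2 * byRole s b ρ ≤ B ρ
    unknown ¬kn with known? ρ
    ... | yes kn = contradiction kn ¬kn
    ... | no  _  = ≤-refl
    by-cases : Dec (Known ρ) → Cheap ρ ⊎ 2 * byRole s b ρ ≤ B ρ
    by-cases (yes kn) = inj₁ (known⇒cheap ρ∈ kn)
    by-cases (no ¬kn) = inj₂ (unknown ¬kn)

  private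
    z₀ : ℕ × List (Fin n)
    z₀ = proj₁ zs≢[]
    z₀∈ : z₀ ∈ zs
    z₀∈ = proj₂ zs≢[]

    cheap₀ : ∀ q → Cheap (lookup (E (proj₁ z₀)) q)
    cheap₀ q = known⇒cheap (E∈roles (zs< z₀∈) q) (Any.map (λ { refl → q , refl }) z₀∈)

  open From price (zs< z₀∈) (E∈roles (zs< z₀∈)) cheap₀

  private
    ls : List ℕ
    ls = map proj₁ zs

    ls< : ∀ {l} → l ∈ ls → l < k
    ls< l∈ with ∈-map⁻ proj₁ l∈
    ... | z , z∈ , refl = zs< z∈

    module H = Hidden κ ls zs-unique ls< (proj₁ z₀ , ∈-map⁺ proj₁ z₀∈)

    in-E : ∀ {l ρ} → l ∈ ls → ∃ (λ q → lookup (E l) q ≡ ρ) → Known ρ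
    in-E l∈ q with ∈-map⁻ proj₁ l∈
    ... | z , z∈ , refl = Any.map (λ { refl → q }) z∈

    known-X : ∀ {l} → l < k → l ∈ ls ⊎ H.prev l ∈ ls → Known (X l)
    known-X l< (inj₁ l∈) = in-E l∈ (X-in l<)
    known-X {zero}  l< (inj₂ l∈) = in-E l∈ (let q , eq = apex-in (suc κ) in q , trans eq apex-last)
    known-X {suc l} l< (inj₂ l∈) = in-E l∈ (let q , eq = p-suc-in l in q , trans eq (p-mid l<))

    part : ∀ (g : ℕ → Role) d {P : ℕ → Set} (P? : Decidable P) → (∀ i → byRole s b (g i) ≡ d) →
           (∀ {l} → l < k → P l → Known (g l)) → ∀ {e} → length (filter (¬? ∘ P?) (upTo k)) ≤ e →
           product (map B (map g (upTo k))) ≤ C₀ ^ k * (2 * d) ^ e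
    part g d P? d≡ known {e} len≤ = begin
      product (map B (map g (upTo k)))                                            ≡⟨ cong product (map-∘ {g = B} {f = g} (upTo k)) ⟨
      product (map (B ∘ g) (upTo k))                                              ≤⟨ product-≤ P? (B ∘ g) C₀ (2 * d) (upTo k) 1≤2d′
                                                                                       (λ i _ → subst (λ x → B (g i) ≤ C₀ * (2 * x)) (d≡ i) (B≤ (g i)))
                                                                                       (λ i i∈ pi → ≤-reflexive (B-known (known (∈-upTo⁻ i∈) pi))) ⟩
      C₀ ^ length (upTo k) * (2 * d) ^ length (filter (¬? ∘ P?) (upTo k))         ≤⟨ *-mono-≤ (≤-reflexive (cong (C₀ ^_) (length-upTo k)))
                                                                                       (^-monoʳ-≤ (2 * d) {{>-nonZero 1≤2d′}} len≤) ⟩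
      C₀ ^ k * (2 * d) ^ e                                                        ∎
      where
      open ≤-Reasoning
      1≤2d′ : 1 ≤ 2 * d
      1≤2d′ = subst (λ x → 1 ≤ 2 * x) (d≡ 0) (1≤2d (g 0))

  -- With j positions given, at most k - j roles `Y` and as many `W` are unknown. The roles `X`
  -- number one fewer, because one X-vertex of the missing edges lies on a given edge.
  product-B : product (map B roles) ≤
    C₀ ^ k * (2 * s) ^ (k ∸ length zs ∸ 1) * (C₀ ^ k * (2 * s) ^ (k ∸ length zs) * (C₀ ^ k * (2 * b) ^ (k ∸ length zs)))
  product-B = begin
    product (map B roles)
      ≡⟨ cong product (trans (map-++ B (map X (upTo k)) _) (cong (map B (map X (upTo k)) ++_) (map-++ B (map Y (upTo k)) (map W (upTo k))))) ⟩
    product (map B (map X (upTo k)) ++ map B (map Y (upTo k)) ++ map B (map W (upTo k)))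
      ≡⟨ trans (product-++ (map B (map X (upTo k))) _) (cong (product (map B (map X (upTo k))) *_) (product-++ (map B (map Y (upTo k))) _)) ⟩
    product (map B (map X (upTo k))) * (product (map B (map Y (upTo k))) * product (map B (map W (upTo k))))
      ≤⟨ *-mono-≤ (part X s H.touched? (λ _ → refl) (λ l< t → known-X l< t) (subst (λ j → length H.untouched ≤ k ∸ j ∸ 1) (length-map proj₁ zs) H.untouched≤))
                  (*-mono-≤ (part Y s (_∈? ls) (λ _ → refl) (λ l< l∈ → in-E l∈ (Y-in l<)) (subst (λ j → length H.missing ≤ k ∸ j) (length-map proj₁ zs) H.missing≤))
                            (part W b (_∈? ls) (λ _ → refl) (λ l< l∈ → in-E l∈ (W-in _)) (subst (λ j → length H.missing ≤ k ∸ j) (length-map proj₁ zs) H.missing≤))) ⟩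
    C₀ ^ k * (2 * s) ^ (k ∸ length zs ∸ 1) * (C₀ ^ k * (2 * s) ^ (k ∸ length zs) * (C₀ ^ k * (2 * b) ^ (k ∸ length zs))) ∎
    where
    open ≤-Reasoning
    open import Data.List.Membership.DecPropositional _≟_ using (_∈?_)

  count-valid : ∀ L → AllPairs Diff L → All Valid L → length L ≤
    C₀ ^ k * (2 * s) ^ (k ∸ length zs ∸ 1) * (C₀ ^ k * (2 * s) ^ (k ∸ length zs) * (C₀ ^ k * (2 * b) ^ (k ∸ length zs)))
  count-valid L ap vs = ≤-trans (count L ap vs) product-B

-- Ordered edges

elements : ∀ {n} → Subset n → List (Fin n)
elements Vec.[]              = []
elements (inside  Vec.∷ e) = Fin.zero ∷ map Fin.suc (elements e)
elements (outside Vec.∷ e) = map Fin.suc (elements e)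

length-elements : ∀ {n} (e : Subset n) → length (elements e) ≡ ∣ e ∣
length-elements Vec.[]            = refl
length-elements (inside  Vec.∷ e) = cong suc (trans (length-map Fin.suc (elements e)) (length-elements e))
length-elements (outside Vec.∷ e) = trans (length-map Fin.suc (elements e)) (length-elements e)

elements-unique : ∀ {n} (e : Subset n) → Unique (elements e)
elements-unique Vec.[]            = []
elements-unique (inside  Vec.∷ e) = AllP.map⁺ (All.universal (λ _ ()) (elements e)) ∷ UniqueP.map⁺ FinP.suc-injective (elements-unique e)
elements-unique (outside Vec.∷ e) = UniqueP.map⁺ FinP.suc-injective (elements-unique e)

∈-elements⁺ : ∀ {n} {e : Subset n} {v} → v ∈ˢ e → v ∈ elements e
∈-elements⁺ {e = inside  Vec.∷ e} Vec.here      = here refl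
∈-elements⁺ {e = inside  Vec.∷ e} (Vec.there p) = there (∈-map⁺ Fin.suc (∈-elements⁺ p))
∈-elements⁺ {e = outside Vec.∷ e} (Vec.there p) = ∈-map⁺ Fin.suc (∈-elements⁺ p)

∈-elements⁻ : ∀ {n} {e : Subset n} {v} → v ∈ elements e → v ∈ˢ e
∈-elements⁻ {e = inside Vec.∷ e} (here refl) = Vec.here
∈-elements⁻ {e = inside Vec.∷ e} (there p) with ∈-map⁻ Fin.suc p
... | u , u∈ , refl = Vec.there (∈-elements⁻ u∈)
∈-elements⁻ {e = outside Vec.∷ e} p with ∈-map⁻ Fin.suc p
... | u , u∈ , refl = Vec.there (∈-elements⁻ u∈)

module _ {n : ℕ} {P : Fin n → Set} (P? : Decidable P) where

  subsetOf : Subset n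
  subsetOf = Vec.tabulate (λ v → does (P? v))

  ∈-subsetOf⁺ : ∀ {v} → P v → v ∈ˢ subsetOf
  ∈-subsetOf⁺ {v} pv = VecP.lookup⇒[]= v subsetOf (trans (VecP.lookup∘tabulate _ v) (dec-true (P? v) pv))

  ∈-subsetOf⁻ : ∀ {v} → v ∈ˢ subsetOf → P v
  ∈-subsetOf⁻ {v} v∈ with P? v in eq
  ... | yes p = p
  ... | no ¬p with () ← trans (sym (cong does eq)) (trans (sym (VecP.lookup∘tabulate (λ u → does (P? u)) v)) (VecP.[]=⇒lookup v∈))

module _ {n : ℕ} where

  open import Data.List.Membership.DecPropositional (FinP._≟_ {n}) using (_∈?_)

  setOf : List (Fin n) → Subset n
  setOf l = subsetOf (_∈? l)

  ∈-setOf⁺ : ∀ {l v} → v ∈ l → v ∈ˢ setOf l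
  ∈-setOf⁺ {l} = ∈-subsetOf⁺ (_∈? l)

  ∈-setOf⁻ : ∀ {l v} → v ∈ˢ setOf l → v ∈ l
  ∈-setOf⁻ {l} = ∈-subsetOf⁻ (_∈? l)

  setOf-≡ : ∀ {l} {e : Subset n} → (∀ {v} → v ∈ l → v ∈ˢ e) → (∀ {v} → v ∈ˢ e → v ∈ l) → setOf l ≡ e
  setOf-≡ to from = SubP.⊆-antisym (to ∘ ∈-setOf⁻) (∈-setOf⁺ ∘ from)

module _ {n : ℕ} where

  toTuple : List (Fin n) → Vec (List (Fin n)) 4
  toTuple (x ∷ y ∷ z ∷ l) = [ x ] Vec.∷ [ y ] Vec.∷ [ z ] Vec.∷ l Vec.∷ Vec.[]
  toTuple l               = [] Vec.∷ [] Vec.∷ [] Vec.∷ l Vec.∷ Vec.[]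

  flatten : Vec (List (Fin n)) 4 → List (Fin n)
  flatten a = concat (Vec.toList a)

  flatten-toTuple : ∀ l → flatten (toTuple l) ≡ l
  flatten-toTuple []              = refl
  flatten-toTuple (x ∷ [])        = refl
  flatten-toTuple (x ∷ y ∷ [])    = refl
  flatten-toTuple (x ∷ y ∷ z ∷ l) = cong (λ l → x ∷ y ∷ z ∷ l) (++-identityʳ l)

  ∈-flatten⁺ : ∀ a q {v} → v ∈ lookup a q → v ∈ flatten a
  ∈-flatten⁺ a q v∈ = ∈-concat⁺′ v∈ (∈-toList a q)
    where
    ∈-toList : ∀ {m} (a : Vec (List (Fin n)) m) q → lookup a q ∈ Vec.toList a
    ∈-toList (_ Vec.∷ a) Fin.zero    = here refl
    ∈-toList (_ Vec.∷ a) (Fin.suc q) = there (∈-toList a q)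

  ∈-flatten⁻ : ∀ a {v} → v ∈ flatten a → ∃ λ q → v ∈ lookup a q
  ∈-flatten⁻ = go
    where
    go : ∀ {m} (a : Vec (List (Fin n)) m) {v} → v ∈ concat (Vec.toList a) → ∃ λ q → v ∈ lookup a q
    go (l Vec.∷ a) v∈ with ∈-++⁻ l v∈
    ... | inj₁ p = Fin.zero , p
    ... | inj₂ p = let q , p′ = go a p in Fin.suc q , p′

  flatten-unique⁻ : ∀ {m} (a : Vec (List (Fin n)) m) → Unique (concat (Vec.toList a)) →
    (∀ q → Unique (lookup a q)) × (∀ q q′ {v} → v ∈ lookup a q → v ∈ lookup a q′ → q ≡ q′)
  flatten-unique⁻ Vec.[] u = (λ ()) , λ ()
  flatten-unique⁻ (l Vec.∷ a) u with flatten-unique⁻ a (unique-++ʳ l u)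
  ... | us , dis = (λ { Fin.zero → unique-++ˡ l u ; (Fin.suc q) → us q }) , apart
    where
    inside-tail : ∀ {m} (a : Vec (List (Fin n)) m) q {v} → v ∈ lookup a q → v ∈ concat (Vec.toList a)
    inside-tail (l Vec.∷ a) Fin.zero    v∈ = ∈-++⁺ˡ v∈
    inside-tail (l Vec.∷ a) (Fin.suc q) v∈ = ∈-++⁺ʳ l (inside-tail a q v∈)
    apart : ∀ q q′ {v} → v ∈ lookup (l Vec.∷ a) q → v ∈ lookup (l Vec.∷ a) q′ → q ≡ q′
    apart Fin.zero    Fin.zero     _ _  = refl
    apart Fin.zero    (Fin.suc q′) p p′ = ⊥-elim (unique-++-disjoint l u p (inside-tail a q′ p′))
    apart (Fin.suc q) Fin.zero     p p′ = ⊥-elim (unique-++-disjoint l u p′ (inside-tail a q p))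
    apart (Fin.suc q) (Fin.suc q′) p p′ = cong Fin.suc (dis q q′ p p′)

  toTuple-width : ∀ {w} l → length l ≡ 3 + w → ∀ q → length (lookup (toTuple l) q) ≡ byCoord 1 w q
  toTuple-width (x ∷ y ∷ z ∷ l) eq 0F = refl
  toTuple-width (x ∷ y ∷ z ∷ l) eq 1F = refl
  toTuple-width (x ∷ y ∷ z ∷ l) eq 2F = refl
  toTuple-width (x ∷ y ∷ z ∷ l) eq 3F = suc-injective (suc-injective (suc-injective eq))

  vectorsOver : ∀ {m} → Vec ℕ m → List (Vec (List (Fin n)) m)
  vectorsOver Vec.[]       = [ Vec.[] ]
  vectorsOver (l Vec.∷ ls) = cartesianProductWith Vec._∷_ (listsOver l (allFin n)) (vectorsOver ls)

  ∈-vectorsOver : ∀ {m} (ls : Vec ℕ m) a → (∀ q → length (lookup a q) ≡ lookup ls q) → a ∈ vectorsOver ls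
  ∈-vectorsOver Vec.[]       Vec.[]      h = here refl
  ∈-vectorsOver (l Vec.∷ ls) (x Vec.∷ a) h = ∈-cartesianProductWith⁺ Vec._∷_
    (∈-listsOver l (h Fin.zero) (All.universal ∈-allFin x)) (∈-vectorsOver ls a (h ∘ Fin.suc))

  length-vectorsOver : ∀ {m} (ls : Vec ℕ m) → length (vectorsOver ls) ≡ n ^ Vec.sum ls
  length-vectorsOver Vec.[] = refl
  length-vectorsOver (l Vec.∷ ls) = begin
    length (cartesianProductWith Vec._∷_ (listsOver l (allFin n)) (vectorsOver ls))
      ≡⟨ length-cartesianProductWith Vec._∷_ (listsOver l (allFin n)) (vectorsOver ls) ⟩
    length (listsOver l (allFin n)) * length (vectorsOver ls)
      ≡⟨ cong₂ _*_ (trans (length-listsOver l (allFin n)) (cong (_^ l) (length-tabulate {n = n} id))) (length-vectorsOver ls) ⟩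
    n ^ l * n ^ Vec.sum ls
      ≡⟨ ^-distribˡ-+-* n l (Vec.sum ls) ⟨
    n ^ (l + Vec.sum ls) ∎
    where open ≡-Reasoning

module Tuples {w n : ℕ} (G : RGraph (3 + w) n) where

  -- Listing the remaining vertices in their natural order gives one ordering for each first vertex.
  -- These r orderings per edge suffice for the pruning budget, and all permutations are avoided.
  rootedAt : Subset n → Fin n → List (Fin n)
  rootedAt e v = v ∷ filter (λ u → ¬? (u FinP.≟ v)) (elements e)

  tuplesOf : Subset n → List (Vec (List (Fin n)) 4)
  tuplesOf e = map (toTuple ∘ rootedAt e) (elements e)

  record IsTuple (a : Vec (List (Fin n)) 4) : Set where
    field
      width    : ∀ q → length (lookup a q) ≡ byCoord 1 w q
      unique   : ∀ q → Unique (lookup a q)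
      disjoint : ∀ q q′ {v} → v ∈ lookup a q → v ∈ lookup a q′ → q ≡ q′
      isEdge   : setOf (flatten a) ∈ edges G

  module _ (e : Subset n) {v : Fin n} (v∈ : v ∈ elements e) where

    rootedAt-⊆ : ∀ {u} → u ∈ rootedAt e v → u ∈ elements e
    rootedAt-⊆ (here refl) = v∈
    rootedAt-⊆ (there u∈)  = proj₁ (∈-filter⁻ (λ u → ¬? (u FinP.≟ v)) u∈)

    rootedAt-⊇ : ∀ {u} → u ∈ elements e → u ∈ rootedAt e v
    rootedAt-⊇ {u} u∈ with u FinP.≟ v
    ... | yes refl = here refl
    ... | no  u≢v  = there (∈-filter⁺ (λ u → ¬? (u FinP.≟ v)) u∈ u≢v)

    rootedAt-unique : Unique (rootedAt e v)
    rootedAt-unique = All.map (λ u≢v eq → u≢v (sym eq)) (all-filter (λ u → ¬? (u FinP.≟ v)) (elements e)) ∷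
                      UniqueP.filter⁺ (λ u → ¬? (u FinP.≟ v)) (elements-unique e)

    length-rootedAt : length (rootedAt e v) ≡ length (elements e)
    length-rootedAt = ≤-antisym (unique-⊆⇒length≤ rootedAt-unique rootedAt-⊆) (unique-⊆⇒length≤ (elements-unique e) rootedAt-⊇)

    setOf-rootedAt : setOf (flatten (toTuple (rootedAt e v))) ≡ e
    setOf-rootedAt = trans (cong setOf (flatten-toTuple (rootedAt e v)))
      (setOf-≡ (∈-elements⁻ ∘ rootedAt-⊆) (rootedAt-⊇ ∘ ∈-elements⁺))

  tuplesOf-set : ∀ {e a} → a ∈ tuplesOf e → setOf (flatten a) ≡ e
  tuplesOf-set {e} a∈ with ∈-map⁻ (toTuple ∘ rootedAt e) a∈
  ... | v , v∈ , refl = setOf-rootedAt e v∈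

  tuplesOf-unique : ∀ e → Unique (tuplesOf e)
  tuplesOf-unique e = UniqueP.map⁺ inj (elements-unique e)
    where
    inj : ∀ {u v} → toTuple (rootedAt e u) ≡ toTuple (rootedAt e v) → u ≡ v
    inj {u} {v} eq = proj₁ (∷-injective (trans (sym (flatten-toTuple (rootedAt e u))) (trans (cong flatten eq) (flatten-toTuple (rootedAt e v)))))

  A₀ : List (Vec (List (Fin n)) 4)
  A₀ = concat (map tuplesOf (edges G))

  A₀-unique : Unique A₀
  A₀-unique = UniqueP.concat⁺ (AllP.map⁺ (All.universal tuplesOf-unique (edges G)))
    (AllPairsP.map⁺ (AllPairs.map {S = λ e e′ → Disjoint (tuplesOf e) (tuplesOf e′)} (λ e≢e′ → apart e≢e′) (RGraph.distinct G)))
    where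
    apart : ∀ {e e′} → e ≢ e′ → Disjoint (tuplesOf e) (tuplesOf e′)
    apart e≢e′ (a∈ , a∈′) = e≢e′ (trans (sym (tuplesOf-set a∈)) (tuplesOf-set a∈′))

  length-A₀ : length A₀ ≡ numEdges G * (3 + w)
  length-A₀ = go (edges G) (uniform G)
    where
    go : ∀ es → All (λ e → ∣ e ∣ ≡ 3 + w) es → length (concat (map tuplesOf es)) ≡ length es * (3 + w)
    go [] [] = refl
    go (e ∷ es) (eq ∷ eqs) = trans (length-++ (tuplesOf e))
      (cong₂ _+_ (trans (length-map (toTuple ∘ rootedAt e) (elements e)) (trans (length-elements e) eq)) (go es eqs))

  A₀-tuple : ∀ {a} → a ∈ A₀ → IsTuple a
  A₀-tuple {a} a∈ with ∈-concat⁻′ (map tuplesOf (edges G)) a∈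
  ... | ts , a∈ts , ts∈ with ∈-map⁻ tuplesOf ts∈
  ...   | e , e∈ , refl with ∈-map⁻ (toTuple ∘ rootedAt e) a∈ts
  ...     | v , v∈ , refl = record
    { width    = toTuple-width (rootedAt e v) (trans (length-rootedAt e v∈) (trans (length-elements e) (All.lookup (uniform G) e∈)))
    ; unique   = proj₁ coords
    ; disjoint = proj₂ coords
    ; isEdge   = subst (_∈ edges G) (sym (setOf-rootedAt e v∈)) e∈
    }
    where
    coords = flatten-unique⁻ (toTuple (rootedAt e v)) (subst Unique (sym (flatten-toTuple (rootedAt e v))) (rootedAt-unique e v∈))

  module _ (s′ b′ : ℕ) (s′-small : 2 * (s′ * n ^ (2 + w)) ≤ numEdges G) (b′-small : 2 * (b′ * n ^ 3) ≤ w * numEdges G) where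

    private
      _≟T_ : DecidableEquality (Vec (List (Fin n)) 4)
      _≟T_ = VecP.≡-dec (≡-dec FinP._≟_)

      open Prune _≟T_ (allFin 4) erase (byCoord s′ b′)

      widths : Vec ℕ 4
      widths = 1 Vec.∷ 1 Vec.∷ 1 Vec.∷ w Vec.∷ Vec.[]

      label : Fin 4 → Vec (List (Fin n)) 4 → Fin 4 × Vec (List (Fin n)) 4
      label q a = q , a

      keysOf : Fin 4 → List (Fin 4 × Vec (List (Fin n)) 4)
      keysOf q = map (label q) (vectorsOver (widths [ q ]≔ 0))

      keys : List (Fin 4 × Vec (List (Fin n)) 4)
      keys = keysOf 0F ++ keysOf 1F ++ keysOf 2F ++ keysOf 3F

      keys⊇ : ∀ q {x} → x ∈ keysOf q → x ∈ keys
      keys⊇ 0F x∈ = ∈-++⁺ˡ x∈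
      keys⊇ 1F x∈ = ∈-++⁺ʳ (keysOf 0F) (∈-++⁺ˡ x∈)
      keys⊇ 2F x∈ = ∈-++⁺ʳ (keysOf 0F) (∈-++⁺ʳ (keysOf 1F) (∈-++⁺ˡ x∈))
      keys⊇ 3F x∈ = ∈-++⁺ʳ (keysOf 0F) (∈-++⁺ʳ (keysOf 1F) (∈-++⁺ʳ (keysOf 2F) x∈))

      lookup-widths : ∀ q → lookup widths q ≡ byCoord 1 w q
      lookup-widths 0F = refl
      lookup-widths 1F = refl
      lookup-widths 2F = refl
      lookup-widths 3F = refl

      erase∈ : ∀ {a} q → IsTuple a → erase q a ∈ vectorsOver (widths [ q ]≔ 0)
      erase∈ {a} q t = ∈-vectorsOver (widths [ q ]≔ 0) (erase q a) same
        where
        same : ∀ i → length (lookup (erase q a) i) ≡ lookup (widths [ q ]≔ 0) i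
        same i with i FinP.≟ q
        ... | yes refl = trans (cong length (VecP.lookup∘updateAt q a)) (sym (VecP.lookup∘updateAt q widths))
        ... | no  i≢q  = trans (cong length (VecP.lookup∘updateAt′ i q i≢q a))
                           (trans (IsTuple.width t i) (trans (sym (lookup-widths i)) (sym (VecP.lookup∘updateAt′ i q i≢q widths))))

      sum-keysOf : ∀ q → sum (map (byCoord s′ b′ ∘ proj₁) (keysOf q)) ≡ n ^ Vec.sum (widths [ q ]≔ 0) * byCoord s′ b′ q
      sum-keysOf q = trans (sum-map-map-const (byCoord s′ b′ ∘ proj₁) (label q) (byCoord s′ b′ q) (λ _ → refl) (vectorsOver (widths [ q ]≔ 0)))
                       (cong (_* byCoord s′ b′ q) (length-vectorsOver (widths [ q ]≔ 0)))

      loss : ℕ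
      loss = sum (map (byCoord s′ b′ ∘ proj₁) keys)

      -- Erasing one of the three vertices leaves n^(r-1) possible keys, and erasing the last w
      -- coordinates leaves n^3.
      loss≡ : loss ≡ 3 * (s′ * n ^ (2 + w)) + b′ * n ^ 3
      loss≡ = begin
        sum (map th (keysOf 0F ++ keysOf 1F ++ keysOf 2F ++ keysOf 3F))
          ≡⟨ split (keysOf 0F) _ ⟩
        σ 0F + sum (map th (keysOf 1F ++ keysOf 2F ++ keysOf 3F))
          ≡⟨ cong (σ 0F +_) (trans (split (keysOf 1F) _) (cong (σ 1F +_) (split (keysOf 2F) _))) ⟩
        σ 0F + (σ 1F + (σ 2F + σ 3F))
          ≡⟨ cong₂ _+_ (sum-keysOf 0F) (cong₂ _+_ (sum-keysOf 1F) (cong₂ _+_ (sum-keysOf 2F) (sum-keysOf 3F))) ⟩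
        n ^ (2 + (w + 0)) * s′ + (n ^ (2 + (w + 0)) * s′ + (n ^ (2 + (w + 0)) * s′ + n ^ 3 * b′))
          ≡⟨ cong (λ u → n ^ (2 + u) * s′ + (n ^ (2 + u) * s′ + (n ^ (2 + u) * s′ + n ^ 3 * b′))) (+-identityʳ w) ⟩
        n ^ (2 + w) * s′ + (n ^ (2 + w) * s′ + (n ^ (2 + w) * s′ + n ^ 3 * b′))
          ≡⟨ rearrange (n ^ (2 + w)) s′ (n ^ 3) b′ ⟩
        3 * (s′ * n ^ (2 + w)) + b′ * n ^ 3 ∎
        where
        open ≡-Reasoning
        th = byCoord s′ b′ ∘ proj₁
        σ : Fin 4 → ℕ
        σ q = sum (map th (keysOf q))
        split : ∀ xs ys → sum (map th (xs ++ ys)) ≡ sum (map th xs) + sum (map th ys)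
        split xs ys = trans (cong sum (map-++ th xs ys)) (sum-++ (map th xs) (map th ys))
        rearrange : ∀ N s N′ b → N * s + (N * s + (N * s + N′ * b)) ≡ 3 * (s * N) + b * N′
        rearrange = solve-∀

      2*loss≤ : 2 * loss ≤ (3 + w) * numEdges G
      2*loss≤ = begin
        2 * loss                                                  ≡⟨ cong (2 *_) loss≡ ⟩
        2 * (3 * (s′ * n ^ (2 + w)) + b′ * n ^ 3)                 ≡⟨ rearrange (s′ * n ^ (2 + w)) (b′ * n ^ 3) ⟩
        3 * (2 * (s′ * n ^ (2 + w))) + 2 * (b′ * n ^ 3)           ≤⟨ +-mono-≤ (*-monoʳ-≤ 3 s′-small) b′-small ⟩
        3 * numEdges G + w * numEdges G                           ≡⟨ *-distribʳ-+ (numEdges G) 3 w ⟨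
        (3 + w) * numEdges G                                      ∎
        where
        open ≤-Reasoning
        rearrange : ∀ x y → 2 * (3 * x + y) ≡ 3 * (2 * x) + 2 * y
        rearrange = solve-∀

    -- A fibre survives only if it has more members than the threshold, hence the successors. At
    -- most half of the r |E(G)| ordered edges are lost.
    thickTuples : Σ (List (Vec (List (Fin n)) 4)) λ A → Unique A × All IsTuple A × numEdges G ≤ length A ×
      (∀ a q → a ∈ A → byCoord (suc s′) (suc b′) q ≤ length (filter (λ x → VecP.≡-dec (≡-dec FinP._≟_) (erase q x) (erase q a)) A))
    thickTuples with prune keys A₀ A₀-unique (λ {a} {q} a∈ _ → keys⊇ q (∈-map⁺ (label q) (erase∈ q (A₀-tuple a∈))))
    ... | A , uA , A⊆ , large , thick = A , uA , All.tabulate (λ a∈ → A₀-tuple (A⊆ _ a∈)) , many ,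
            λ a q a∈ → ≤-trans (≤-reflexive (byCoord-suc q)) (thick a q a∈ (∈-allFin q))
      where
      byCoord-suc : ∀ q → byCoord (suc s′) (suc b′) q ≡ suc (byCoord s′ b′ q)
      byCoord-suc 0F = refl
      byCoord-suc 1F = refl
      byCoord-suc 2F = refl
      byCoord-suc 3F = refl
      open ≤-Reasoning
      m = numEdges G
      double : (3 + w) * m + (3 + w) * m ≤ 2 * length A + (3 + w) * m
      double = begin
        (3 + w) * m + (3 + w) * m       ≡⟨ cong ((3 + w) * m +_) (+-identityʳ ((3 + w) * m)) ⟨
        2 * ((3 + w) * m)               ≡⟨ cong (2 *_) (trans (*-comm (3 + w) m) (sym length-A₀)) ⟩
        2 * length A₀                   ≤⟨ *-monoʳ-≤ 2 large ⟩
        2 * (length A + loss)           ≡⟨ *-distribˡ-+ 2 (length A) loss ⟩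
        2 * length A + 2 * loss         ≤⟨ +-monoʳ-≤ (2 * length A) 2*loss≤ ⟩
        2 * length A + (3 + w) * m      ∎
      many : m ≤ length A
      -- Twice the number of survivors is at least r |E(G)|, and r ≥ 2.
      many = *-cancelˡ-≤ 2 (≤-trans (*-monoˡ-≤ m {2} {3 + w} (s≤s (s≤s z≤n))) (+-cancelʳ-≤ ((3 + w) * m) ((3 + w) * m) (2 * length A) double))

-- Embedding of the linear cycle

any-true⁺ : ∀ {I : Set} (f : I → Bool) {xs x} → x ∈ xs → f x ≡ true → any f xs ≡ true
any-true⁺ f (here refl) fx rewrite fx = refl
any-true⁺ f {y ∷ xs} (there x∈) fx with f y
... | true  = refl
... | false = any-true⁺ f x∈ fx

any-true⁻ : ∀ {I : Set} (f : I → Bool) xs → any f xs ≡ true → ∃ λ x → x ∈ xs × f x ≡ true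
any-true⁻ f (x ∷ xs) eq with f x in fx
... | true  = x , here refl , fx
... | false = let y , y∈ , fy = any-true⁻ f xs eq in y , there y∈ , fy

any-false⁻ : ∀ {I : Set} (f : I → Bool) {xs x} → x ∈ xs → any f xs ≡ false → f x ≡ false
any-false⁻ f {y ∷ xs} (here refl) eq with f y
... | false = refl
any-false⁻ f {y ∷ xs} (there x∈) eq with f y
... | false = any-false⁻ f x∈ eq

⌊⌋-true⁺ : ∀ {P : Set} (P? : Dec P) → P → ⌊ P? ⌋ ≡ true
⌊⌋-true⁺ (yes _) p = refl
⌊⌋-true⁺ (no ¬p) p = contradiction p ¬p

⌊⌋-true⁻ : ∀ {P : Set} (P? : Dec P) → ⌊ P? ⌋ ≡ true → P
⌊⌋-true⁻ (yes p) _ = p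

module _ {L n : ℕ} (φ : Fin L → Fin n) (e : Subset L) where

  ∈-image⁺ : ∀ {v} → v ∈ˢ e → φ v ∈ˢ image φ e
  ∈-image⁺ {v} v∈ with Vec.lookup (image φ e) (φ v) in u≡
  ... | true  = VecP.lookup⇒[]= (φ v) (image φ e) u≡
  ... | false with any-false⁻ _ (∈-allFin v) (trans (sym (VecP.lookup∘tabulate _ (φ v))) u≡)
  ...   | eq with Vec.lookup e v | VecP.[]=⇒lookup v∈
  ...     | true | _ with () ← trans (sym eq) (⌊⌋-true⁺ (φ v FinP.≟ φ v) refl)

  ∈-image⁻ : ∀ {u} → u ∈ˢ image φ e → ∃ λ v → v ∈ˢ e × φ v ≡ u
  ∈-image⁻ {u} u∈ with any-true⁻ _ (allFin L) (trans (sym (VecP.lookup∘tabulate _ u)) (VecP.[]=⇒lookup u∈))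
  ... | v , _ , eq with Vec.lookup e v in e≡
  ...   | true = v , VecP.lookup⇒[]= v e e≡ , ⌊⌋-true⁻ (φ v FinP.≟ u) eq

lookup-injective : ∀ {I : Set} {xs : List I} → Unique xs → ∀ i j → List.lookup xs i ≡ List.lookup xs j → i ≡ j
lookup-injective (_ ∷ _)  Fin.zero    Fin.zero    _  = refl
lookup-injective (x≢ ∷ _) Fin.zero    (Fin.suc j) eq = contradiction eq (All.lookup x≢ (∈-lookup j))
lookup-injective (x≢ ∷ _) (Fin.suc i) Fin.zero    eq = contradiction (sym eq) (All.lookup x≢ (∈-lookup i))
lookup-injective (_ ∷ u)  (Fin.suc i) (Fin.suc j) eq = cong Fin.suc (lookup-injective u i j eq)

module Embedding (κ w n : ℕ) where

  open Tree κ using (k; next; next-last; next-mid)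

  vertices : ℕ
  vertices = k * (2 + w)

  next< : ∀ {l} → l < k → next l < k
  next< {l} l< with m≤n⇒m<n∨m≡n (s≤s⁻¹ l<)
  ... | inj₂ refl = subst (_< k) (sym next-last) (s≤s z≤n)
  ... | inj₁ l<′  = subst (_< k) (sym (next-mid l<′)) (s≤s l<′)

  nextF : Fin k → Fin k
  nextF i = fromℕ< (next< (FinP.toℕ<n i))

  toℕ-combine′ : ∀ (i : Fin k) (j : Fin (2 + w)) → toℕ (combine i j) ≡ toℕ i * (2 + w) + toℕ j
  toℕ-combine′ i j = trans (FinP.toℕ-combine i j) (cong (_+ toℕ j) (*-comm (2 + w) (toℕ i)))

  own-position : ∀ (i : Fin k) (j : Fin (2 + w)) → (toℕ i * (2 + w) + toℕ j) % vertices ≡ toℕ (combine i j)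
  own-position i j = trans (cong (_% vertices) (sym (toℕ-combine′ i j))) (m<n⇒m%n≡m (FinP.toℕ<n (combine i j)))

  -- The last vertex of the i-th edge is at i(r-1) + (r-1) = (i+1)(r-1), where the next arc begins;
  -- for the last edge the remainder wraps around to 0.
  shared-position : ∀ (i : Fin k) → (toℕ i * (2 + w) + (2 + w)) % vertices ≡ toℕ (combine (nextF i) (Fin.zero {suc w}))
  shared-position i with m≤n⇒m<n∨m≡n (s≤s⁻¹ (FinP.toℕ<n i))
  ... | inj₂ last = trans (cong (_% vertices) (trans (+-comm (toℕ i * (2 + w)) (2 + w)) (cong (λ l → suc l * (2 + w)) last)))
                     (trans (n%n≡0 vertices) (sym (trans (toℕ-combine′ (nextF i) Fin.zero) (cong (λ l → l * (2 + w) + 0)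
                       (trans (FinP.toℕ-fromℕ< _) (trans (cong next last) next-last))))))
  ... | inj₁ i<   = trans (cong (_% vertices) eq) (m<n⇒m%n≡m (FinP.toℕ<n (combine (nextF i) Fin.zero)))
    where
    eq : toℕ i * (2 + w) + (2 + w) ≡ toℕ (combine (nextF i) (Fin.zero {suc w}))
    eq = trans (+-comm (toℕ i * (2 + w)) (2 + w)) (sym (trans (toℕ-combine′ (nextF i) Fin.zero)
           (trans (+-identityʳ _) (cong (_* (2 + w)) (trans (FinP.toℕ-fromℕ< _) (next-mid i<))))))

  private
    hits : ℕ → Fin vertices → ℕ → Bool
    hits l v j = ⌊ (l * (2 + w) + j) % vertices ≟ toℕ v ⌋

    lookup-cycleEdge : ∀ l v → Vec.lookup (cycleEdge k (3 + w) l) v ≡ any (hits l v) (upTo (3 + w))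
    lookup-cycleEdge l v = VecP.lookup∘tabulate (λ u → any (hits l u) (upTo (3 + w))) v

  ∈-cycleEdge⁺ : ∀ l {v : Fin vertices} {j} → j < 3 + w → (l * (2 + w) + j) % vertices ≡ toℕ v → v ∈ˢ cycleEdge k (3 + w) l
  ∈-cycleEdge⁺ l {v} {j} j< eq = VecP.lookup⇒[]= v (cycleEdge k (3 + w) l)
    (trans (lookup-cycleEdge l v) (any-true⁺ (hits l v) (∈-upTo⁺ j<) (⌊⌋-true⁺ ((l * (2 + w) + j) % vertices ≟ toℕ v) eq)))

  ∈-cycleEdge⁻ : ∀ l {v : Fin vertices} → v ∈ˢ cycleEdge k (3 + w) l → ∃ λ j → j < 3 + w × (l * (2 + w) + j) % vertices ≡ toℕ v
  ∈-cycleEdge⁻ l {v} v∈ with any-true⁻ (hits l v) (upTo (3 + w)) (trans (sym (lookup-cycleEdge l v)) (VecP.[]=⇒lookup v∈))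
  ... | j , j∈ , eq = j , ∈-upTo⁻ j∈ , ⌊⌋-true⁻ ((l * (2 + w) + j) % vertices ≟ toℕ v) eq

  module _ (ψ : Fin k → Fin (2 + w) → Fin n) where

    φ : Fin vertices → Fin n
    φ v = uncurry ψ (remQuot (2 + w) v)

    φ-combine : ∀ i j → φ (combine i j) ≡ ψ i j
    φ-combine i j = cong (uncurry ψ) (FinP.remQuot-combine i j)

    φ-injective : (∀ {i j i′ j′} → ψ i j ≡ ψ i′ j′ → i ≡ i′ × j ≡ j′) → Injective _≡_ _≡_ φ
    φ-injective inj {v} {v′} eq =
      trans (sym (FinP.combine-remQuot {k} (2 + w) v)) (trans (cong₂ combine (proj₁ same) (proj₂ same)) (FinP.combine-remQuot {k} (2 + w) v′))
      where
      same : proj₁ (remQuot {k} (2 + w) v) ≡ proj₁ (remQuot {k} (2 + w) v′) × proj₂ (remQuot {k} (2 + w) v) ≡ proj₂ (remQuot {k} (2 + w) v′)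
      same = inj eq

    edge⁺-own : ∀ i j → ψ i j ∈ˢ image φ (cycleEdge k (3 + w) (toℕ i))
    edge⁺-own i j = subst (_∈ˢ image φ (cycleEdge k (3 + w) (toℕ i))) (φ-combine i j)
      (∈-image⁺ φ (cycleEdge k (3 + w) (toℕ i))
        (∈-cycleEdge⁺ (toℕ i) (≤-trans (FinP.toℕ<n j) (n≤1+n _)) (own-position i j)))

    edge⁺-shared : ∀ i → ψ (nextF i) Fin.zero ∈ˢ image φ (cycleEdge k (3 + w) (toℕ i))
    edge⁺-shared i = subst (_∈ˢ image φ (cycleEdge k (3 + w) (toℕ i))) (φ-combine (nextF i) Fin.zero)
      (∈-image⁺ φ (cycleEdge k (3 + w) (toℕ i)) (∈-cycleEdge⁺ (toℕ i) ≤-refl (shared-position i)))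

    edge⁻ : ∀ i {u} → u ∈ˢ image φ (cycleEdge k (3 + w) (toℕ i)) → (∃ λ j → u ≡ ψ i j) ⊎ u ≡ ψ (nextF i) Fin.zero
    edge⁻ i {u} u∈ = locate (∈-image⁻ φ (cycleEdge k (3 + w) (toℕ i)) u∈)
      where
      own : ∀ v j (j< : j < 2 + w) → (toℕ i * (2 + w) + j) % vertices ≡ toℕ v → φ v ≡ ψ i (fromℕ< j<)
      own v j j< eq = trans (cong φ v≡) (φ-combine i (fromℕ< j<))
        where
        v≡ : v ≡ combine i (fromℕ< j<)
        v≡ = FinP.toℕ-injective (trans (sym eq) (trans (cong (λ x → (toℕ i * (2 + w) + x) % vertices) (sym (FinP.toℕ-fromℕ< j<)))
               (own-position i (fromℕ< j<))))
      shared : ∀ v j → j ≡ 2 + w → (toℕ i * (2 + w) + j) % vertices ≡ toℕ v → φ v ≡ ψ (nextF i) Fin.zero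
      shared v _ refl eq = trans (cong φ (FinP.toℕ-injective (trans (sym eq) (shared-position i)))) (φ-combine (nextF i) Fin.zero)
      position : ∀ v → φ v ≡ u → (∃ λ j → j < 3 + w × (toℕ i * (2 + w) + j) % vertices ≡ toℕ v) →
                 (∃ λ j → u ≡ ψ i j) ⊎ u ≡ ψ (nextF i) Fin.zero
      position v φv≡u (j , j< , eq) =
        [ (λ j<′ → inj₁ (fromℕ< j<′ , trans (sym φv≡u) (own v j j<′ eq))) , (λ j≡ → inj₂ (trans (sym φv≡u) (shared v j j≡ eq))) ]′
        (m≤n⇒m<n∨m≡n (s≤s⁻¹ j<))
      locate : (∃ λ v → v ∈ˢ cycleEdge k (3 + w) (toℕ i) × φ v ≡ u) → (∃ λ j → u ≡ ψ i j) ⊎ u ≡ ψ (nextF i) Fin.zero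
      locate (v , v∈ , φv≡u) = position v φv≡u (∈-cycleEdge⁻ (toℕ i) v∈)

-- The hypergraph of cycles

lookup-cast-zero : ∀ {I : Set} {l} (xs : List I) {ys : List I} (eq : suc l ≡ length (xs ++ ys)) → length xs ≡ 1 →
                   List.lookup (xs ++ ys) (cast eq Fin.zero) ∈ xs
lookup-cast-zero (x ∷ []) eq refl = here refl

∈-singleton : ∀ {I : Set} {xs : List I} {u v} → length xs ≡ 1 → u ∈ xs → v ∈ xs → u ≡ v
∈-singleton {xs = x ∷ []} refl (here refl) (here refl) = refl

labellings : ∀ {I : Set} → ℕ → List I → List (List (ℕ × I))
labellings k []       = [ [] ]
labellings k (i ∷ is) = cartesianProductWith (λ l ps → (l , i) ∷ ps) (upTo k) (labellings k is)

length-labellings : ∀ {I : Set} k (is : List I) → length (labellings k is) ≡ k ^ length is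
length-labellings k []       = refl
length-labellings k (i ∷ is) = trans (length-cartesianProductWith _ (upTo k) (labellings k is))
                                 (cong₂ _*_ (length-upTo k) (length-labellings k is))

∈-labellings⁺ : ∀ {I : Set} k {Q : ℕ × I → Set} (is : List I) → All (λ i → ∃ λ l → l < k × Q (l , i)) is →
                ∃ λ ps → ps ∈ labellings k is × All Q ps
∈-labellings⁺ k []       []                     = [] , here refl , []
∈-labellings⁺ k (i ∷ is) ((l , l< , q) ∷ qs) =
  let ps , ps∈ , all = ∈-labellings⁺ k is qs
  in (l , i) ∷ ps , ∈-cartesianProductWith⁺ (λ l ps → (l , i) ∷ ps) (∈-upTo⁺ l<) ps∈ , q ∷ all

∈-labellings⁻ : ∀ {I : Set} k (is : List I) {ps} → ps ∈ labellings k is → map proj₂ ps ≡ is × All (λ z → proj₁ z < k) ps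
∈-labellings⁻ k []       (here refl) = refl , []
∈-labellings⁻ k (i ∷ is) ps∈ with ∈-cartesianProductWith⁻ (λ l ps → (l , i) ∷ ps) (upTo k) (labellings k is) ps∈
... | l , ps , l∈ , ps∈′ , refl = let eq , all = ∈-labellings⁻ k is ps∈′ in cong (i ∷_) eq , ∈-upTo⁻ l∈ ∷ all

labels-unique : ∀ {I : Set} {Q : ℕ × I → Set} → (∀ {l i j} → Q (l , i) → Q (l , j) → i ≡ j) → ∀ {ps} →
                Unique (map proj₂ ps) → All Q ps → Unique (map proj₁ ps)
labels-unique func {[]}     _ _ = []
labels-unique func {(l , i) ∷ ps} (i≢ ∷ u) (q ∷ qs) =
  AllP.map⁺ (All.zipWith (λ { {_ , j} (i≢j , q′) refl → i≢j (func q q′) }) (AllP.map⁻ i≢ , qs)) ∷ labels-unique func u qs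

foldr-⊔-≤ : ∀ {I : Set} (f : I → ℕ) {B} xs → (∀ {x} → x ∈ xs → f x ≤ B) → foldr _⊔_ 0 (map f xs) ≤ B
foldr-⊔-≤ f []       h = z≤n
foldr-⊔-≤ f (x ∷ xs) h = ⊔-lub (h (here refl)) (foldr-⊔-≤ f xs (h ∘ there))

-- The three factors belong to the roles `X`, `Y` and `W`. In each, `C ^ k` pays generously for the
-- known roles, and the power counts the choices of the unknown ones.
degreeBound : ℕ → ℕ → ℕ → ℕ → ℕ → ℕ
degreeBound k r s b j = C ^ k * (2 * s) ^ (k ∸ j ∸ 1) * (C ^ k * (2 * s) ^ (k ∸ j) * (C ^ k * (2 * b) ^ (k ∸ j)))
  where C = r ^ r

module Hypergraph {w n : ℕ} (κ : ℕ) (G : RGraph (3 + w) n) (s b : ℕ) (1≤d : ∀ q → 1 ≤ byCoord s b q)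
  (A : List (Vec (List (Fin n)) 4)) (uA : Unique A) (A-tuple : All (Tuples.IsTuple G) A)
  (thick : ∀ a q → a ∈ A → byCoord s b q ≤ length (filter (λ x → VecP.≡-dec (≡-dec FinP._≟_) (erase q x) (erase q a)) A))
  where

  open CycleConfig κ w n s b 1≤d A uA thick
  open Tuples G using (IsTuple)

  m : ℕ
  m = numEdges G

  _≟S_ : ∀ {l} → DecidableEquality (Subset l)
  _≟S_ = VecP.≡-dec BoolP._≟_

  open import Data.List.Membership.DecPropositional (_≟S_ {n}) using () renaming (_∈?_ to _∈S?_)

  edgeSet : Cfg → ℕ → Subset n
  edgeSet f l = setOf (flatten (Vec.map f (E l)))

  edgeSets : Cfg → List (Subset n)
  edgeSets f = map (edgeSet f) (upTo k)

  hyperedge : Cfg → Subset m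
  hyperedge f = subsetOf (λ i → edgeAt G i ∈S? edgeSets f)

  ∈-hyperedge⁺ : ∀ f {i} → edgeAt G i ∈ edgeSets f → i ∈ˢ hyperedge f
  ∈-hyperedge⁺ f = ∈-subsetOf⁺ (λ i → edgeAt G i ∈S? edgeSets f)

  ∈-hyperedge⁻ : ∀ f {i} → i ∈ˢ hyperedge f → edgeAt G i ∈ edgeSets f
  ∈-hyperedge⁻ f = ∈-subsetOf⁻ (λ i → edgeAt G i ∈S? edgeSets f)

  ∈-edgeSet⁺ : ∀ f l q {v} → v ∈ f (lookup (E l) q) → v ∈ˢ edgeSet f l
  ∈-edgeSet⁺ f l q v∈ = ∈-setOf⁺ (∈-flatten⁺ (Vec.map f (E l)) q (subst (_ ∈_) (sym (VecP.lookup-map q f (E l))) v∈))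

  ∈-edgeSet⁻ : ∀ f l {v} → v ∈ˢ edgeSet f l → ∃ λ q → v ∈ f (lookup (E l) q)
  ∈-edgeSet⁻ f l v∈ = let q , v∈′ = ∈-flatten⁻ (Vec.map f (E l)) (∈-setOf⁻ v∈) in q , subst (_ ∈_) (VecP.lookup-map q f (E l)) v∈′

  edgeAt-injective : ∀ {i j} → edgeAt G i ≡ edgeAt G j → i ≡ j
  edgeAt-injective {i} {j} = lookup-injective (RGraph.distinct G) i j

  module _ {f : Cfg} (proper : Proper f) where

    open Proper proper

    edgeSet∈ : ∀ {l} → l < k → edgeSet f l ∈ edges G
    edgeSet∈ l< = IsTuple.isEdge (All.lookup A-tuple (edge l<))

    edgeSet-InE⁺ : ∀ l {ρ v} → InE l ρ → v ∈ f ρ → v ∈ˢ edgeSet f l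
    edgeSet-InE⁺ l (q , refl) v∈ = ∈-edgeSet⁺ f l q v∈

    -- The vertex at `Y l` lies on no other cycle edge, so it identifies the position.
    edgeSet-injective : ∀ {l l′} → l < k → l′ < k → edgeSet f l ≡ edgeSet f l′ → l ≡ l′
    edgeSet-injective {l} {l′} l< l′< eq with f (Y l) in fY | width (Y∈ l<)
    ... | y ∷ [] | _ with ∈-edgeSet⁻ f l′ (subst (y ∈ˢ_) eq (edgeSet-InE⁺ l (Y-in l<) (subst (y ∈_) (sym fY) (here refl))))
    ...   | q , y∈ with disjoint (Y∈ l<) (E∈roles l′< q) (subst (y ∈_) (sym fY) (here refl)) y∈ | E-roles l′< q
    ...     | Y≡ | inj₁ eq′ with () ← trans Y≡ eq′
    ...     | Y≡ | inj₂ (inj₁ eq′) with refl ← trans Y≡ eq′ = refl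
    ...     | Y≡ | inj₂ (inj₂ (inj₁ eq′)) with () ← trans Y≡ eq′
    ...     | Y≡ | inj₂ (inj₂ (inj₂ eq′)) with () ← trans Y≡ eq′

    edgeSets-unique : Unique (edgeSets f)
    edgeSets-unique = AllPairsP.map⁺ (AllPairsP.applyUpTo⁺₁ id k
      (λ i<j j<k eq → <⇒≢ i<j (edgeSet-injective (<-trans i<j j<k) j<k eq)))

    hyperedge-size : ∣ hyperedge f ∣ ≡ k
    hyperedge-size = begin
      ∣ hyperedge f ∣                                    ≡⟨ length-elements (hyperedge f) ⟨
      length (elements (hyperedge f))                    ≡⟨ length-map (edgeAt G) (elements (hyperedge f)) ⟨
      length (map (edgeAt G) (elements (hyperedge f)))   ≡⟨ ≤-antisym
        (unique-⊆⇒length≤ (UniqueP.map⁺ edgeAt-injective (elements-unique (hyperedge f))) to)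
        (unique-⊆⇒length≤ edgeSets-unique from) ⟩
      length (edgeSets f)                                ≡⟨ trans (length-map (edgeSet f) (upTo k)) (length-upTo k) ⟩
      k                                                  ∎
      where
      open ≡-Reasoning
      to : ∀ {x} → x ∈ map (edgeAt G) (elements (hyperedge f)) → x ∈ edgeSets f
      to x∈ with ∈-map⁻ (edgeAt G) x∈
      ... | i , i∈ , refl = ∈-hyperedge⁻ f (∈-elements⁻ i∈)
      from : ∀ {x} → x ∈ edgeSets f → x ∈ map (edgeAt G) (elements (hyperedge f))
      from {x} x∈ with ∈-map⁻ (edgeSet f) x∈
      ... | l , l∈ , refl = subst (_∈ map (edgeAt G) (elements (hyperedge f))) (sym (lookup-index e∈))
              (∈-map⁺ (edgeAt G) (∈-elements⁺ (∈-hyperedge⁺ f (subst (_∈ edgeSets f) (lookup-index e∈) x∈))))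
        where
        e∈ : edgeSet f l ∈ edges G
        e∈ = edgeSet∈ (∈-upTo⁻ l∈)

    -- The i-th edge without its last vertex, which opens the next arc. `X l` comes first because
    -- the shared vertex must stand at index 0 of its arc.
    arc : ℕ → List (Fin n)
    arc l = f (X l) ++ f (Y l) ++ f (W l)

    length-arc : ∀ {l} → l < k → length (arc l) ≡ 2 + w
    length-arc {l} l< = trans (length-++ (f (X l))) (cong₂ _+_ (width (X∈ l<)) (trans (length-++ (f (Y l))) (cong₂ _+_ (width (Y∈ l<)) (width (W∈ l<)))))

    ∈-arc⁻ : ∀ {l u} → u ∈ arc l → u ∈ f (X l) ⊎ u ∈ f (Y l) ⊎ u ∈ f (W l)
    ∈-arc⁻ {l} u∈ with ∈-++⁻ (f (X l)) u∈
    ... | inj₁ p = inj₁ p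
    ... | inj₂ p = inj₂ (∈-++⁻ (f (Y l)) p)

    arc-unique : ∀ {l} → l < k → Unique (arc l)
    arc-unique {l} l< = UniqueP.++⁺ (unique (X∈ l<)) (UniqueP.++⁺ (unique (Y∈ l<)) (unique (W∈ l<))
        (λ (y , v) → Y≢W (disjoint (Y∈ l<) (W∈ l<) y v)))
      (λ (x , yv) → [ (λ y → X≢Y (disjoint (X∈ l<) (Y∈ l<) x y)) , (λ v → X≢W (disjoint (X∈ l<) (W∈ l<) x v)) ]′ (∈-++⁻ (f (Y l)) yv))
      where
      Y≢W : Y l ≢ W l
      Y≢W ()
      X≢Y : X l ≢ Y l
      X≢Y ()
      X≢W : X l ≢ W l
      X≢W ()

    arc-role : ∀ {l u} → l < k → u ∈ arc l → ∃ λ ρ → ρ ∈ roles × u ∈ f ρ × index ρ ≡ l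
    arc-role l< u∈ with ∈-arc⁻ u∈
    ... | inj₁ p        = _ , X∈ l< , p , refl
    ... | inj₂ (inj₁ p) = _ , Y∈ l< , p , refl
    ... | inj₂ (inj₂ p) = _ , W∈ l< , p , refl

    arc-disjoint : ∀ {l l′ u} → l < k → l′ < k → u ∈ arc l → u ∈ arc l′ → l ≡ l′
    arc-disjoint l< l′< u∈ u∈′ =
      let ρ , ρ∈ , p , at = arc-role l< u∈
          ρ′ , ρ′∈ , p′ , at′ = arc-role l′< u∈′
      in trans (sym at) (trans (cong index (disjoint ρ∈ ρ′∈ p p′)) at′)

    open Embedding κ w n using (φ; φ-injective; edge⁺-own; edge⁺-shared; edge⁻; nextF; next<)

    ψ : Fin k → Fin (2 + w) → Fin n
    ψ i j = List.lookup (arc (toℕ i)) (cast (sym (length-arc (FinP.toℕ<n i))) j)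

    ψ∈arc : ∀ i j → ψ i j ∈ arc (toℕ i)
    ψ∈arc i j = ∈-lookup (cast (sym (length-arc (FinP.toℕ<n i))) j)

    arc⊆ψ : ∀ i {u} → u ∈ arc (toℕ i) → ∃ λ j → ψ i j ≡ u
    arc⊆ψ i u∈ = cast (length-arc (FinP.toℕ<n i)) (Any.index u∈) ,
      trans (cong (List.lookup (arc (toℕ i))) (FinP.cast-involutive (sym (length-arc (FinP.toℕ<n i))) (length-arc (FinP.toℕ<n i)) (Any.index u∈)))
            (sym (lookup-index u∈))

    ψ-zero∈ : ∀ i → ψ i Fin.zero ∈ f (X (toℕ i))
    ψ-zero∈ i = lookup-cast-zero (f (X (toℕ i))) (sym (length-arc (FinP.toℕ<n i))) (width (X∈ (FinP.toℕ<n i)))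

    ψ-injective : ∀ {i j i′ j′} → ψ i j ≡ ψ i′ j′ → i ≡ i′ × j ≡ j′
    ψ-injective {i} {j} {i′} {j′} eq = i≡i′ , same i≡i′ eq
      where
      i≡i′ : i ≡ i′
      i≡i′ = FinP.toℕ-injective (arc-disjoint (FinP.toℕ<n i) (FinP.toℕ<n i′) (ψ∈arc i j) (subst (_∈ arc (toℕ i′)) (sym eq) (ψ∈arc i′ j′)))
      same : ∀ {i i′} → i ≡ i′ → ψ i j ≡ ψ i′ j′ → j ≡ j′
      same {i} refl eq = FinP.toℕ-injective (trans (sym (FinP.toℕ-cast (sym (length-arc (FinP.toℕ<n i))) j))
        (trans (cong toℕ (lookup-injective (arc-unique (FinP.toℕ<n i)) _ _ eq)) (FinP.toℕ-cast (sym (length-arc (FinP.toℕ<n i))) j′)))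

    image-edge : ∀ i → image (φ ψ) (cycleEdge k (3 + w) (toℕ i)) ≡ edgeSet f (toℕ i)
    image-edge i = SubP.⊆-antisym to from
      where
      l< = FinP.toℕ<n i
      next≡ : toℕ (nextF i) ≡ next (toℕ i)
      next≡ = FinP.toℕ-fromℕ< (next< l<)
      own : ∀ {u} → u ∈ arc (toℕ i) → u ∈ˢ edgeSet f (toℕ i)
      own u∈ = [ edgeSet-InE⁺ (toℕ i) (X-in l<) , [ edgeSet-InE⁺ (toℕ i) (Y-in l<) , edgeSet-InE⁺ (toℕ i) (W-in (toℕ i)) ]′ ]′ (∈-arc⁻ u∈)
      to : image (φ ψ) (cycleEdge k (3 + w) (toℕ i)) ⊆ˢ edgeSet f (toℕ i)
      to u∈ = [ (λ (j , eq) → subst (_∈ˢ edgeSet f (toℕ i)) (sym eq) (own (ψ∈arc i j))) ,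
                (λ eq → subst (_∈ˢ edgeSet f (toℕ i)) (sym eq)
                  (edgeSet-InE⁺ (toℕ i) (X-next-in l<) (subst (λ l → ψ (nextF i) Fin.zero ∈ f (X l)) next≡ (ψ-zero∈ (nextF i))))) ]′ (edge⁻ ψ i u∈)
      edgeImage : Subset n
      edgeImage = image (φ ψ) (cycleEdge k (3 + w) (toℕ i))
      own⁻ : ∀ {u} → u ∈ arc (toℕ i) → u ∈ˢ edgeImage
      own⁻ u∈ = let j , eq = arc⊆ψ i u∈ in subst (_∈ˢ edgeImage) eq (edge⁺-own ψ i j)
      shared⁻ : ∀ {u} → u ∈ f (X (next (toℕ i))) → u ∈ˢ edgeImage
      shared⁻ {u} u∈ = subst (_∈ˢ edgeImage) (∈-singleton (width (X∈ (FinP.toℕ<n (nextF i)))) (ψ-zero∈ (nextF i))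
        (subst (λ l → u ∈ f (X l)) (sym next≡) u∈)) (edge⁺-shared ψ i)
      from : edgeSet f (toℕ i) ⊆ˢ edgeImage
      from {u} u∈ = place (∈-edgeSet⁻ f (toℕ i) u∈)
        where
        place : (∃ λ q → u ∈ f (lookup (E (toℕ i)) q)) → u ∈ˢ edgeImage
        place (q , u∈f) =
          [ (λ eq → own⁻ (∈-++⁺ˡ (at eq))) ,
            [ (λ eq → own⁻ (∈-++⁺ʳ (f (X (toℕ i))) (∈-++⁺ˡ (at eq)))) ,
              [ (λ eq → own⁻ (∈-++⁺ʳ (f (X (toℕ i))) (∈-++⁺ʳ (f (Y (toℕ i))) (at eq)))) , (λ eq → shared⁻ (at eq)) ]′ ]′ ]′ (E-roles l< q)
          where
          at : ∀ {ρ} → lookup (E (toℕ i)) q ≡ ρ → u ∈ f ρ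
          at eq = subst (λ ρ → u ∈ f ρ) eq u∈f

    image-edge′ : ∀ {l} → l < k → image (φ ψ) (cycleEdge k (3 + w) l) ≡ edgeSet f l
    image-edge′ l< = subst (λ l → image (φ ψ) (cycleEdge k (3 + w) l) ≡ edgeSet f l) (FinP.toℕ-fromℕ< l<) (image-edge (fromℕ< l<))

    images≡ : map (image (φ ψ)) (cycleEdges k (3 + w)) ≡ edgeSets f
    images≡ = trans (sym (map-∘ {g = image (φ ψ)} {f = cycleEdge k (3 + w)} (upTo k))) (map-cong-local (All.tabulate (λ l∈ → image-edge′ (∈-upTo⁻ l∈))))

    isCycleCopy : IsCycleCopy k G (hyperedge f)
    isCycleCopy = φ ψ , φ-injective ψ ψ-injective ,
      AllP.map⁺ (All.tabulate (λ l∈ → subst (_∈ edges G) (sym (image-edge′ (∈-upTo⁻ l∈))) (edgeSet∈ (∈-upTo⁻ l∈)))) ,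
      λ i → mk⇔ (λ i∈ → subst (edgeAt G i ∈_) (sym images≡) (∈-hyperedge⁻ f i∈))
                (λ e∈ → ∈-hyperedge⁺ f (subst (edgeAt G i ∈_) images≡ e∈))

degreeBound-full : ∀ k r s b → degreeBound k r s b k ≡ (r ^ r) ^ k * ((r ^ r) ^ k * (r ^ r) ^ k)
degreeBound-full k r s b rewrite n∸n≡0 k | *-identityʳ ((r ^ r) ^ k) = refl

-- Degrees and number of hyperedges

module Counting {w n : ℕ} (κ : ℕ) (G : RGraph (3 + w) n) (s b : ℕ) (1≤d : ∀ q → 1 ≤ byCoord s b q)
  (A : List (Vec (List (Fin n)) 4)) (uA : Unique A) (A-tuple : All (Tuples.IsTuple G) A)
  (thick : ∀ a q → a ∈ A → byCoord s b q ≤ length (filter (λ x → VecP.≡-dec (≡-dec FinP._≟_) (erase q x) (erase q a)) A))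
  where

  open CycleConfig κ w n s b 1≤d A uA thick
  open Hypergraph κ G s b 1≤d A uA A-tuple thick

  Good : List Cfg → Set
  Good L = AllPairs Diff L × All Proper L

  good-filter : ∀ {P : Cfg → Set} (P? : Decidable P) {L} → Good L → Good (filter P? L)
  good-filter P? (ap , pr) = AllPairsP.filter⁺ P? ap , AllP.filter⁺ P? pr

  module _ (σ : Subset m) (1≤σ : 1 ≤ ∣ σ ∣) where

    Matches : Cfg → ℕ × Fin m → Set
    Matches f (l , i) = edgeSet f l ≡ edgeAt G i

    matching : ∀ {f} → σ ⊆ˢ hyperedge f → ∃ λ ps → ps ∈ labellings k (elements σ) × All (Matches f) ps
    matching {f} σ⊆ = ∈-labellings⁺ k (elements σ) (All.tabulate λ {i} i∈ →
      let l , l∈ , eq = ∈-map⁻ (edgeSet f) (∈-hyperedge⁻ f (σ⊆ (∈-elements⁻ i∈)))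
      in l , ∈-upTo⁻ l∈ , sym eq)

    count-labelled : ∀ ps → ps ∈ labellings k (elements σ) → ∀ L → Good L → All (λ f → All (Matches f) ps) L →
                     length L ≤ degreeBound k (3 + w) s b ∣ σ ∣
    count-labelled ps ps∈ [] _ _ = z≤n
    count-labelled ps ps∈ L@(f₀ ∷ _) (ap , pr) ms@(m₀ ∷ _) =
      subst (λ j → length L ≤ degreeBound k (3 + w) s b j) length-zs (D.count-valid L ap (All.zipWith valid (pr , ms)))
      where
      enrich : ℕ × Fin m → ℕ × List (Fin n)
      enrich (l , i) = l , elements (edgeAt G i)
      zs = map enrich ps
      proj₂≡ : map proj₂ ps ≡ elements σ
      proj₂≡ = proj₁ (∈-labellings⁻ k (elements σ) ps∈)
      length-ps : length ps ≡ ∣ σ ∣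
      length-ps = trans (sym (length-map proj₂ ps)) (trans (cong length proj₂≡) (length-elements σ))
      length-zs : length zs ≡ ∣ σ ∣
      length-zs = trans (length-map enrich ps) length-ps
      -- Distinct positions are not built into a labelling. They follow from one configuration that
      -- matches it: a position carries only one edge of `G`.
      zs-unique : Unique (map proj₁ zs)
      zs-unique = subst Unique (map-∘ {g = proj₁} {f = enrich} ps)
        (labels-unique {Q = Matches f₀} (λ e e′ → edgeAt-injective (trans (sym e) e′)) (subst Unique (sym proj₂≡) (elements-unique σ)) m₀)
      zs< : ∀ {z} → z ∈ zs → proj₁ z < k
      zs< z∈ with ∈-map⁻ enrich z∈
      ... | p , p∈ , refl = All.lookup (proj₂ (∈-labellings⁻ k (elements σ) ps∈)) p∈
      zs-size : ∀ {z} → z ∈ zs → length (proj₂ z) ≡ 3 + w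
      zs-size z∈ with ∈-map⁻ enrich z∈
      ... | (l , i) , p∈ , refl = trans (length-elements (edgeAt G i)) (All.lookup (uniform G) (∈-lookup i))
      nonempty : ∀ {I : Set} (xs : List I) → 1 ≤ length xs → ∃ λ x → x ∈ xs
      nonempty (x ∷ xs) _ = x , here refl
      module D = Degree κ w n s b 1≤d A uA thick zs zs-unique zs< zs-size (nonempty zs (subst (1 ≤_) (sym length-zs) 1≤σ))
      valid : ∀ {f} → Proper f × All (Matches f) ps → D.Valid f
      valid {f} (proper , matches) = proper , within
        where
        within : ∀ {z} → z ∈ zs → ∀ q → All (_∈ proj₂ z) (f (lookup (E (proj₁ z)) q))
        within z∈ q with ∈-map⁻ enrich z∈
        ... | (l , i) , p∈ , refl = All.tabulate λ {v} v∈ → ∈-elements⁺ (subst (v ∈ˢ_) (All.lookup matches p∈) (∈-edgeSet⁺ f l q v∈))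

    -- The edges of `σ` occupy positions on the cycle; there are at most k^j ways to assign them,
    -- and each assignment is counted separately.
    count-containing : ∀ L → Good L → All (λ f → σ ⊆ˢ hyperedge f) L → length L ≤ k ^ ∣ σ ∣ * degreeBound k (3 + w) s b ∣ σ ∣
    count-containing L good σ⊆ = begin
      length L
        ≤⟨ length≤classes*size Good good-filter (λ ps f → All.all? (λ { (l , i) → edgeSet f l ≟S edgeAt G i }) ps)
             (degreeBound k (3 + w) s b ∣ σ ∣) (labellings k (elements σ)) L good (All.map {P = λ f → σ ⊆ˢ hyperedge f} (λ {f} h → matching {f} h) σ⊆) count-labelled ⟩
      length (labellings k (elements σ)) * degreeBound k (3 + w) s b ∣ σ ∣
        ≡⟨ cong (_* degreeBound k (3 + w) s b ∣ σ ∣) (trans (length-labellings k (elements σ)) (cong (k ^_) (length-elements σ))) ⟩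
      k ^ ∣ σ ∣ * degreeBound k (3 + w) s b ∣ σ ∣ ∎
      where open ≤-Reasoning

  module _ (L : List Cfg) (good : Good L) where

    H : CycleHGraph k G
    H = record
      { hedges    = deduplicate _≟S_ (map hyperedge L)
      ; hdistinct = UniqueDecP.deduplicate-! _≟S_ (map hyperedge L)
      ; huniform  = All.tabulate (λ h∈ → let f , f∈ , eq = origin h∈ in trans (cong ∣_∣ eq) (hyperedge-size (All.lookup (proj₂ good) f∈)))
      ; hcopies   = All.tabulate (λ h∈ → let f , f∈ , eq = origin h∈ in subst (IsCycleCopy k G) (sym eq) (isCycleCopy (All.lookup (proj₂ good) f∈)))
      }
      where
      origin : ∀ {h} → h ∈ deduplicate _≟S_ (map hyperedge L) → ∃ λ f → f ∈ L × h ≡ hyperedge f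
      origin h∈ = ∈-map⁻ hyperedge (∈-deduplicate⁻ _≟S_ (map hyperedge L) h∈)

    deg≤ : ∀ σ → 1 ≤ ∣ σ ∣ → deg H σ ≤ k ^ ∣ σ ∣ * degreeBound k (3 + w) s b ∣ σ ∣
    deg≤ σ 1≤σ = begin
      deg H σ                                                     ≤⟨ unique-⊆⇒length≤ (UniqueP.filter⁺ (σ SubP.⊆?_) (hdistinct H)) sub ⟩
      length (map hyperedge (filter containing? L))               ≡⟨ length-map hyperedge (filter containing? L) ⟩
      length (filter containing? L)                               ≤⟨ count-containing σ 1≤σ (filter containing? L) (good-filter containing? good) (all-filter containing? L) ⟩
      k ^ ∣ σ ∣ * degreeBound k (3 + w) s b ∣ σ ∣                 ∎
      where
      open ≤-Reasoning
      containing? : ∀ f → Dec (σ ⊆ˢ hyperedge f)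
      containing? f = σ SubP.⊆? hyperedge f
      sub : ∀ {h} → h ∈ filter (σ SubP.⊆?_) (hedges H) → h ∈ map hyperedge (filter containing? L)
      sub h∈ with ∈-filter⁻ (σ SubP.⊆?_) h∈
      ... | h∈H , σ⊆h with ∈-map⁻ hyperedge (∈-deduplicate⁻ _≟S_ (map hyperedge L) h∈H)
      ...   | f , f∈ , refl = ∈-map⁺ hyperedge (∈-filter⁺ containing? f∈ σ⊆h)

    Δ≤ : ∀ j → 1 ≤ j → Δ H j ≤ k ^ j * degreeBound k (3 + w) s b j
    Δ≤ j 1≤j = foldr-⊔-≤ (deg H) (filter (λ σ → ∣ σ ∣ ≟ j) (allSubsets m)) λ σ∈ → bound (proj₂ (∈-filter⁻ (λ σ → ∣ σ ∣ ≟ j) {xs = allSubsets m} σ∈))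
      where
      bound : ∀ {σ} → ∣ σ ∣ ≡ j → deg H σ ≤ k ^ j * degreeBound k (3 + w) s b j
      bound {σ} refl = deg≤ σ 1≤j

    multiplicity : ℕ
    multiplicity = k ^ k * (C ^ k * (C ^ k * C ^ k))
      where C = (3 + w) ^ (3 + w)

    -- Configurations with the hyperedge `h` are among those containing the k-set `h`. For j = k all
    -- exponents of s and b vanish, so the degree bound becomes a constant multiplicity.
    length-L≤ : length L ≤ length (hedges H) * multiplicity
    length-L≤ = length≤classes*size Good good-filter (λ h f → hyperedge f ≟S h) multiplicity (hedges H) L good
      (All.tabulate λ {f} f∈ → hyperedge f , ∈-deduplicate⁺ _≟S_ (∈-map⁺ hyperedge f∈) , refl) fibre≤
      where
      fibre≤ : ∀ h → h ∈ hedges H → ∀ L′ → Good L′ → All (λ f → hyperedge f ≡ h) L′ → length L′ ≤ multiplicity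
      fibre≤ h h∈ L′ good′ eqs = ≤-trans (count-containing h (subst (1 ≤_) (sym size) (s≤s z≤n)) L′ good′ (All.map {Q = λ f → h ⊆ˢ hyperedge f} (λ { refl i∈ → i∈ }) eqs))
        (≤-reflexive (trans (cong (λ j → k ^ j * degreeBound k (3 + w) s b j) size) (cong (k ^ k *_) (degreeBound-full k (3 + w) s b))))
        where
        size : ∣ h ∣ ≡ k
        size = All.lookup (huniform H) h∈

-- The first factor is `M` to the number of greedy steps, the second bounds the number of
-- configurations per hyperedge.
lowerConstant : ℕ → ℕ → ℕ
lowerConstant κ w = (k * (2 + w)) ^ (suc κ + (κ + suc κ)) * (k ^ k * (C ^ k * (C ^ k * C ^ k)))
  where
  k = 2 + κ
  C = (3 + w) ^ (3 + w)

module Assembly {w n : ℕ} (κ : ℕ) (G : RGraph (3 + w) n) (s b : ℕ) (1≤d : ∀ q → 1 ≤ byCoord s b q)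
  (big : ∀ q → (2 + κ) * (2 + w) * meetCoeff n (byCoord 1 w q) ≤ byCoord s b q)
  (A : List (Vec (List (Fin n)) 4)) (uA : Unique A) (A-tuple : All (Tuples.IsTuple G) A) (many : numEdges G ≤ length A)
  (thick : ∀ a q → a ∈ A → byCoord s b q ≤ length (filter (λ x → VecP.≡-dec (≡-dec FinP._≟_) (erase q x) (erase q a)) A))
  where

  open CycleConfig κ w n s b 1≤d A uA thick
  open Counting κ G s b 1≤d A uA A-tuple thick

  length-steps : length steps ≡ suc κ + (κ + suc κ)
  length-steps = trans (length-++ (segment fanStep 0 (suc κ))) (cong₂ _+_ (length-segment fanStep 0 (suc κ))
    (trans (length-++ (segment legStep 0 κ)) (cong₂ _+_ (length-segment legStep 0 κ) (length-segment blockStep 0 (suc κ)))))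

  Balanced : CycleHGraph (2 + κ) G → Set
  Balanced H =
    numEdges G * (s ^ suc (κ + κ) * b ^ suc κ) ≤ lowerConstant κ w * length (hedges H) ×
    (∀ j → 1 ≤ j → Δ H j ≤ (2 + κ) ^ j * degreeBound (2 + κ) (3 + w) s b j)

  fromConfigurations : (Σ (List Cfg) λ L → length A * (s ^ suc (κ + κ) * b ^ suc κ) ≤ M ^ length steps * length L ×
                          All Proper L × AllPairs Diff L) → Σ (CycleHGraph (2 + κ) G) Balanced
  fromConfigurations (L , large , pr , ap) = H L (ap , pr) , lower , Δ≤ L (ap , pr)
    where
    open ≤-Reasoning
    c = s ^ suc (κ + κ) * b ^ suc κ
    N = M ^ (suc κ + (κ + suc κ))
    μ = multiplicity L (ap , pr)
    h = length (hedges (H L (ap , pr)))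
    lower : numEdges G * c ≤ lowerConstant κ w * h
    lower = begin
      numEdges G * c                   ≤⟨ *-monoˡ-≤ c many ⟩
      length A * c                     ≤⟨ large ⟩
      M ^ length steps * length L      ≡⟨ cong (λ e → M ^ e * length L) length-steps ⟩
      N * length L                     ≤⟨ *-monoʳ-≤ N (length-L≤ L (ap , pr)) ⟩
      N * (h * μ)                      ≡⟨ cong (N *_) (*-comm h μ) ⟩
      N * (μ * h)                      ≡⟨ *-assoc N μ h ⟨
      N * μ * h                        ∎

  private
    module T {a} (a∈ : a ∈ A) = Tuples.IsTuple (All.lookup A-tuple a∈)

  result : Σ (CycleHGraph (2 + κ) G) Balanced
  result = fromConfigurations (Lower.configurations big (λ a q a∈ → T.width a∈ q) (λ a q a∈ → T.unique a∈ q) (λ a q q′ a∈ → T.disjoint a∈ q q′))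

balanced : ∀ κ {w n} (G : RGraph (3 + w) n) s′ b′ →
  2 * (s′ * n ^ (2 + w)) ≤ numEdges G → 2 * (b′ * n ^ 3) ≤ w * numEdges G →
  (∀ q → (2 + κ) * (2 + w) * meetCoeff n (byCoord 1 w q) ≤ byCoord (suc s′) (suc b′) q) →
  Σ (CycleHGraph (2 + κ) G) λ H →
    numEdges G * (suc s′ ^ suc (κ + κ) * suc b′ ^ suc κ) ≤ lowerConstant κ w * length (hedges H) ×
    (∀ j → 1 ≤ j → Δ H j ≤ (2 + κ) ^ j * degreeBound (2 + κ) (3 + w) (suc s′) (suc b′) j)
balanced κ {w} {n} G s′ b′ s′-small b′-small big = assemble (Tuples.thickTuples G s′ b′ s′-small b′-small)
  where
  1≤d : ∀ q → 1 ≤ byCoord (suc s′) (suc b′) q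
  1≤d 0F = s≤s z≤n
  1≤d 1F = s≤s z≤n
  1≤d 2F = s≤s z≤n
  1≤d 3F = s≤s z≤n
  assemble : (Σ (List (Vec (List (Fin n)) 4)) λ A → Unique A × All (Tuples.IsTuple G) A × numEdges G ≤ length A ×
      (∀ a q → a ∈ A → byCoord (suc s′) (suc b′) q ≤ length (filter (λ x → VecP.≡-dec (≡-dec FinP._≟_) (erase q x) (erase q a)) A))) → _
  assemble (A , uA , A-tuple , many , thick) = Assembly.result κ G (suc s′) (suc b′) 1≤d big A uA A-tuple many thick

-- Rational estimates

toℚᵘ-ℕtoℚ : ∀ a → ℚ.toℚᵘ (ℕtoℚ a) ℚᵘ.≃ ℚᵘ.mkℚᵘ (ℤ.+ a) 0
toℚᵘ-ℕtoℚ a = ℚP.toℚᵘ-fromℚᵘ (ℚᵘ.mkℚᵘ (ℤ.+ a) 0)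

ℕtoℚ-* : ∀ a b → ℕtoℚ (a * b) ≡ ℕtoℚ a *ℚ ℕtoℚ b
ℕtoℚ-* a b = ℚP.toℚᵘ-injective (begin-equality
  ℚ.toℚᵘ (ℕtoℚ (a * b))                              ≃⟨ toℚᵘ-ℕtoℚ (a * b) ⟩
  ℚᵘ.mkℚᵘ (ℤ.+ (a * b)) 0                            ≡⟨ cong (λ z → ℚᵘ.mkℚᵘ z 0) (ℤP.pos-* a b) ⟩
  ℚᵘ.mkℚᵘ (ℤ.+ a) 0 ℚᵘ.* ℚᵘ.mkℚᵘ (ℤ.+ b) 0           ≃⟨ ℚᵘP.*-cong (toℚᵘ-ℕtoℚ a) (toℚᵘ-ℕtoℚ b) ⟨
  ℚ.toℚᵘ (ℕtoℚ a) ℚᵘ.* ℚ.toℚᵘ (ℕtoℚ b)               ≃⟨ ℚP.toℚᵘ-homo-* (ℕtoℚ a) (ℕtoℚ b) ⟨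
  ℚ.toℚᵘ (ℕtoℚ a *ℚ ℕtoℚ b)                          ∎)
  where open ℚᵘP.≤-Reasoning

ℕtoℚ-mono : ∀ {a b} → a ≤ b → ℕtoℚ a ≤ℚ ℕtoℚ b
ℕtoℚ-mono {a} {b} a≤b = ℚP.toℚᵘ-cancel-≤ (begin
  ℚ.toℚᵘ (ℕtoℚ a)       ≃⟨ toℚᵘ-ℕtoℚ a ⟩
  ℚᵘ.mkℚᵘ (ℤ.+ a) 0     ≤⟨ ℚᵘ.*≤* (ℤP.*-monoʳ-≤-nonNeg (ℤ.+ 1) (ℤ.+≤+ a≤b)) ⟩
  ℚᵘ.mkℚᵘ (ℤ.+ b) 0     ≃⟨ toℚᵘ-ℕtoℚ b ⟨
  ℚ.toℚᵘ (ℕtoℚ b)       ∎)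
  where open ℚᵘP.≤-Reasoning

ℕtoℚ-cancel : ∀ {a b} → ℕtoℚ a ≤ℚ ℕtoℚ b → a ≤ b
ℕtoℚ-cancel {a} {b} h with
  ℚᵘP.≤-respˡ-≃ (toℚᵘ-ℕtoℚ a) (ℚᵘP.≤-respʳ-≃ (toℚᵘ-ℕtoℚ b) (ℚP.toℚᵘ-mono-≤ h))
... | ℚᵘ.*≤* le = ℤP.drop‿+≤+ (subst₂ ℤ._≤_ (ℤP.*-identityʳ (ℤ.+ a)) (ℤP.*-identityʳ (ℤ.+ b)) le)

0≤ℕtoℚ : ∀ a → 0ℚ ≤ℚ ℕtoℚ a
0≤ℕtoℚ a = ℕtoℚ-mono {0} {a} z≤n

ℕtoℚ-positive : ∀ {a} → 1 ≤ a → Positive (ℕtoℚ a)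
ℕtoℚ-positive {a} 1≤a = positive (ℚP.<-≤-trans (ℚP.positive⁻¹ 1ℚ) (ℕtoℚ-mono 1≤a))

*ℚ-mono : ∀ {p p′ q q′} → 0ℚ ≤ℚ p → 0ℚ ≤ℚ q′ → p ≤ℚ p′ → q ≤ℚ q′ → p *ℚ q ≤ℚ p′ *ℚ q′
*ℚ-mono {p} {p′} {q} {q′} 0≤p 0≤q′ p≤ q≤ = ℚP.≤-trans (ℚP.*-monoˡ-≤-nonNeg p {{nonNegative 0≤p}} q≤) (ℚP.*-monoʳ-≤-nonNeg q′ {{nonNegative 0≤q′}} p≤)

0≤* : ∀ {p q} → 0ℚ ≤ℚ p → 0ℚ ≤ℚ q → 0ℚ ≤ℚ p *ℚ q
0≤* {p} {q} 0≤p 0≤q = subst (_≤ℚ p *ℚ q) (ℚP.*-zeroˡ q) (ℚP.*-monoʳ-≤-nonNeg q {{nonNegative 0≤q}} 0≤p)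

0≤^ : ∀ {p} e → 0ℚ ≤ℚ p → 0ℚ ≤ℚ p ^ℚ e
0≤^ zero    0≤p = ℚP.nonNegative⁻¹ 1ℚ
0≤^ (suc e) 0≤p = 0≤* 0≤p (0≤^ e 0≤p)

^ℚ-mono : ∀ {p q} e → 0ℚ ≤ℚ p → p ≤ℚ q → p ^ℚ e ≤ℚ q ^ℚ e
^ℚ-mono zero    0≤p p≤q = ℚP.≤-refl
^ℚ-mono (suc e) 0≤p p≤q = *ℚ-mono 0≤p (0≤^ e (ℚP.≤-trans 0≤p p≤q)) p≤q (^ℚ-mono e 0≤p p≤q)

ℚ-interchange : ∀ a b c d → (a *ℚ b) *ℚ (c *ℚ d) ≡ (a *ℚ c) *ℚ (b *ℚ d)
ℚ-interchange = solve 4 (λ a b c d → (a :* b) :* (c :* d) := (a :* c) :* (b :* d)) refl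
  where open ℚSolver.+-*-Solver

^ℚ-distrib-* : ∀ p q e → (p *ℚ q) ^ℚ e ≡ p ^ℚ e *ℚ q ^ℚ e
^ℚ-distrib-* p q zero    = refl
^ℚ-distrib-* p q (suc e) = trans (cong ((p *ℚ q) *ℚ_) (^ℚ-distrib-* p q e)) (ℚ-interchange p q (p ^ℚ e) (q ^ℚ e))

ℕtoℚ-^ : ∀ a e → ℕtoℚ (a ^ e) ≡ ℕtoℚ a ^ℚ e
ℕtoℚ-^ a zero    = refl
ℕtoℚ-^ a (suc e) = trans (ℕtoℚ-* a (a ^ e)) (cong (ℕtoℚ a *ℚ_) (ℕtoℚ-^ a e))

avgDeg*numEdges : ∀ {r n k} (G : RGraph r n) (H : CycleHGraph k G) → 1 ≤ numEdges G →
                  avgDeg H *ℚ ℕtoℚ (numEdges G) ≡ ℕtoℚ (k * length (hedges H))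
-- Matching on a nonempty edge list exposes the successor on which `avgDeg` branches.
avgDeg*numEdges {k = k} record { edges = e ∷ es } H _ = ℚP.toℚᵘ-injective (begin-equality
  ℚ.toℚᵘ (avgDeg H *ℚ ℕtoℚ m)                              ≃⟨ ℚP.toℚᵘ-homo-* (avgDeg H) (ℕtoℚ m) ⟩
  ℚ.toℚᵘ (avgDeg H) ℚᵘ.* ℚ.toℚᵘ (ℕtoℚ m)                   ≃⟨ ℚᵘP.*-cong (ℚP.toℚᵘ-fromℚᵘ (ℚᵘ.mkℚᵘ (ℤ.+ (k * length (hedges H))) (length es))) (toℚᵘ-ℕtoℚ m) ⟩
  ℚᵘ.mkℚᵘ (ℤ.+ (k * length (hedges H))) (length es) ℚᵘ.* ℚᵘ.mkℚᵘ (ℤ.+ m) 0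
    ≃⟨ ℚᵘ.*≡* (trans (ℤP.*-identityʳ _) (cong (λ d → ℤ.+ (k * length (hedges H)) ℤ.* ℤ.+ d) (sym (*-identityʳ m)))) ⟩
  ℚᵘ.mkℚᵘ (ℤ.+ (k * length (hedges H))) 0                  ≃⟨ toℚᵘ-ℕtoℚ (k * length (hedges H)) ⟨
  ℚ.toℚᵘ (ℕtoℚ (k * length (hedges H)))                    ∎)
  where
  open ℚᵘP.≤-Reasoning
  m = suc (length es)

n*meetCoeff : ∀ n l → n * meetCoeff n l ≡ l * n ^ l
n*meetCoeff n zero    = *-zeroʳ n
n*meetCoeff n (suc l) = trans (*-distribˡ-+ n (n ^ l) (n * meetCoeff n l))
  (trans (cong (λ x → n * n ^ l + n * x) (n*meetCoeff n l)) (rearrange n (n ^ l) l))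
  where
  rearrange : ∀ n N l → n * N + n * (l * N) ≡ suc l * (n * N)
  rearrange = solve-∀

m≤[1+m/n]*n : ∀ m n .{{_ : NonZero n}} → m ≤ suc (m / n) * n
m≤[1+m/n]*n m n = ≤-trans (≤-reflexive (m≡m%n+[m/n]*n m n)) (+-monoˡ-≤ (m / n * n) (<⇒≤ (m%n<n m n)))

*≤⇒≤/ : ∀ {x y} d .{{_ : NonZero d}} → x * d ≤ y → x ≤ y / d
*≤⇒≤/ {x} d h = ≤-trans (≤-reflexive (sym (m*n/n≡m x d))) (/-monoˡ-≤ d h)

BlockSize : (w n b′ : ℕ) → ℚ → Set
BlockSize w n b′ t = Σ ℚ λ β → Dval (3 + w) n t ≡ t *ℚ β × 0ℚ ≤ℚ β × β ≤ℚ ℕtoℚ (2 * suc b′) × ℕtoℚ (suc b′) ≤ℚ ℕtoℚ (1 + w) *ℚ β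

-- The degree scale of the triples is β = D / t: it is 1 for r = 3 and t n^(r-4) = |E(G)| / n^3 for r ≥ 4.
blockSize : ∀ w n m b′ t → 1 ≤ n → ℕtoℚ m ≡ t *ℚ ℕtoℚ (n ^ (2 + w)) → 0ℚ ≤ℚ t →
            2 * (b′ * n ^ 3) ≤ w * m → w * m ≤ suc b′ * (2 * n ^ 3) → n ^ (2 + w) ≤ m → BlockSize w n b′ t
blockSize zero n m zero t 1≤n m≡ 0≤t small large N≤m =
  1ℚ , sym (ℚP.*-identityʳ t) , ℚP.nonNegative⁻¹ 1ℚ , ℕtoℚ-mono {1} {2} (s≤s z≤n) , ℚP.≤-refl
blockSize zero n m (suc b″) t 1≤n m≡ 0≤t small large N≤m =
  contradiction (≤-trans (≤-trans (^-monoˡ-≤ 3 1≤n) (≤-trans (m≤m+n (n ^ 3) _) (m≤m+n _ _))) small) λ ()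
blockSize (suc w) n m b′ t 1≤n m≡ 0≤t small large N≤m =
  β , D≡ , 0≤* 0≤t (0≤^ w (0≤ℕtoℚ n)) ,
  ℚP.*-cancelʳ-≤-pos (ℕtoℚ (n ^ 3)) {{n³-pos}} (subst₂ _≤ℚ_ (sym β*n³) (ℕtoℚ-* (2 * b) (n ^ 3)) (ℕtoℚ-mono upper)) ,
  ℚP.*-cancelʳ-≤-pos (ℕtoℚ (n ^ 3)) {{n³-pos}} (subst₂ _≤ℚ_ (ℕtoℚ-* b (n ^ 3)) scaled (ℕtoℚ-mono lower))
  where
  b = suc b′
  β = t *ℚ ℕtoℚ n ^ℚ w
  n³-pos : Positive (ℕtoℚ (n ^ 3))
  n³-pos = ℕtoℚ-positive (^-monoˡ-≤ 3 1≤n)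
  D≡ : Dval (4 + w) n t ≡ t *ℚ β
  D≡ = trans (cong (_*ℚ ℕtoℚ n ^ℚ w) (cong (t *ℚ_) (ℚP.*-identityʳ t))) (ℚP.*-assoc t t (ℕtoℚ n ^ℚ w))
  β*n³ : β *ℚ ℕtoℚ (n ^ 3) ≡ ℕtoℚ m
  β*n³ = begin
    t *ℚ ℕtoℚ n ^ℚ w *ℚ ℕtoℚ (n ^ 3)        ≡⟨ ℚP.*-assoc t _ _ ⟩
    t *ℚ (ℕtoℚ n ^ℚ w *ℚ ℕtoℚ (n ^ 3))      ≡⟨ cong (λ x → t *ℚ (x *ℚ ℕtoℚ (n ^ 3))) (ℕtoℚ-^ n w) ⟨
    t *ℚ (ℕtoℚ (n ^ w) *ℚ ℕtoℚ (n ^ 3))     ≡⟨ cong (t *ℚ_) (ℕtoℚ-* (n ^ w) (n ^ 3)) ⟨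
    t *ℚ ℕtoℚ (n ^ w * n ^ 3)               ≡⟨ cong (λ x → t *ℚ ℕtoℚ x) (trans (sym (^-distribˡ-+-* n w 3)) (cong (n ^_) (+-comm w 3))) ⟩
    t *ℚ ℕtoℚ (n ^ (3 + w))                 ≡⟨ m≡ ⟨
    ℕtoℚ m                                  ∎
    where open ≡-Reasoning
  scaled : ℕtoℚ ((2 + w) * m) ≡ ℕtoℚ (2 + w) *ℚ β *ℚ ℕtoℚ (n ^ 3)
  scaled = trans (ℕtoℚ-* (2 + w) m) (trans (cong (ℕtoℚ (2 + w) *ℚ_) (sym β*n³)) (sym (ℚP.*-assoc (ℕtoℚ (2 + w)) β (ℕtoℚ (n ^ 3)))))
  open ≤-Reasoning
  upper : m ≤ 2 * b * n ^ 3
  upper = begin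
    m                 ≤⟨ m≤m+n m (w * m) ⟩
    suc w * m         ≤⟨ large ⟩
    b * (2 * n ^ 3)   ≡⟨ rearrange b (n ^ 3) ⟩
    2 * b * n ^ 3     ∎
    where
    rearrange : ∀ b c → b * (2 * c) ≡ 2 * b * c
    rearrange = solve-∀
  n³≤m : n ^ 3 ≤ m
  n³≤m = ≤-trans (^-monoʳ-≤ n {{>-nonZero 1≤n}} {3} {3 + w} (s≤s (s≤s (s≤s z≤n)))) N≤m
  lower : b * n ^ 3 ≤ (2 + w) * m
  -- The rounding up from `b′` to `b` costs 2 n^3, at most 2 |E(G)| because t ≥ 1; the factor 2 + w
  -- leaves room for it.
  lower = *-cancelˡ-≤ 2 (begin
    2 * (b * n ^ 3)                        ≡⟨ rearrange b′ (n ^ 3) ⟩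
    2 * (b′ * n ^ 3) + 2 * n ^ 3           ≤⟨ +-mono-≤ small (*-monoʳ-≤ 2 n³≤m) ⟩
    suc w * m + 2 * m                      ≡⟨ rearrange′ w m ⟩
    (3 + w) * m                            ≤⟨ *-monoˡ-≤ m {3 + w} {2 * (2 + w)} (≤-trans (m≤m+n (3 + w) (1 + w)) (≤-reflexive (rearrange″ w))) ⟩
    2 * (2 + w) * m                        ≡⟨ *-assoc 2 (2 + w) m ⟩
    2 * ((2 + w) * m)                      ∎)
    where
    rearrange : ∀ b c → 2 * (suc b * c) ≡ 2 * (b * c) + 2 * c
    rearrange = solve-∀
    rearrange′ : ∀ w m → suc w * m + 2 * m ≡ (3 + w) * m
    rearrange′ = solve-∀
    rearrange″ : ∀ w → 3 + w + (1 + w) ≡ 2 * (2 + w)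
    rearrange″ = solve-∀

lowerFactor upperFactor : ℕ → ℕ → ℕ
lowerFactor κ w = 2 ^ κ * (2 ^ suc κ * 2 ^ suc κ) * lowerConstant κ w
upperFactor κ w = k ^ k * (C ^ k * 2 ^ k * (C ^ k * 2 ^ k * (C ^ k * 2 ^ k))) * suc w ^ k
  where
  k = 2 + κ
  C = (3 + w) ^ (3 + w)

prefactor : (κ w j : ℕ) → ℕ
prefactor κ w j = k ^ j * (C ^ k * 2 ^ (k ∸ j ∸ 1) * (C ^ k * 2 ^ (k ∸ j) * (C ^ k * 2 ^ (k ∸ j))))
  where
  k = 2 + κ
  C = (3 + w) ^ (3 + w)

prefactor≤ : ∀ κ w j → j ≤ 2 + κ → prefactor κ w j * suc w ^ (2 + κ ∸ j) ≤ upperFactor κ w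
prefactor≤ κ w j j≤ =
  *-mono-≤ (*-mono-≤ (^-monoʳ-≤ (2 + κ) j≤) (*-mono-≤ (*-monoʳ-≤ C (^-monoʳ-≤ 2 (≤-trans (m∸n≤m (2 + κ ∸ j) 1) e≤)))
    (*-mono-≤ (*-monoʳ-≤ C (^-monoʳ-≤ 2 e≤)) (*-monoʳ-≤ C (^-monoʳ-≤ 2 e≤))))) (^-monoʳ-≤ (suc w) e≤)
  where
  C = ((3 + w) ^ (3 + w)) ^ (2 + κ)
  e≤ : 2 + κ ∸ j ≤ 2 + κ
  e≤ = m∸n≤m (2 + κ) j

^-distribʳ-* : ∀ e x y → (x * y) ^ e ≡ x ^ e * y ^ e
^-distribʳ-* zero    x y = refl
^-distribʳ-* (suc e) x y = trans (cong (x * y *_) (^-distribʳ-* e x y)) (swap x y (x ^ e) (y ^ e))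
  where
  swap : ∀ x y a b → x * y * (a * b) ≡ x * a * (y * b)
  swap = solve-∀

degreeBound-split : ∀ κ w s b j → (2 + κ) ^ j * degreeBound (2 + κ) (3 + w) s b j ≡
  prefactor κ w j * (s ^ (2 + κ ∸ j ∸ 1) * (s ^ (2 + κ ∸ j) * b ^ (2 + κ ∸ j)))
degreeBound-split κ w s b j =
  trans (cong (k ^ j *_) (cong₂ (λ x y → C * x * y) (^-distribʳ-* e′ 2 s)
          (cong₂ (λ x y → C * x * (C * y)) (^-distribʳ-* e 2 s) (^-distribʳ-* e 2 b))))
        (rearrange (k ^ j) C (2 ^ e′) (2 ^ e) (s ^ e′) (s ^ e) (b ^ e))
  where
  k = 2 + κ
  C = ((3 + w) ^ (3 + w)) ^ k
  e = k ∸ j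
  e′ = k ∸ j ∸ 1
  rearrange : ∀ K c p q x y z → K * (c * (p * x) * (c * (q * y) * (c * (q * z)))) ≡ K * (c * p * (c * q * (c * q))) * (x * (y * z))
  rearrange = solve-∀

module Estimates (κ w n : ℕ) (1≤n : 1 ≤ n) (G : RGraph (3 + w) n) (t : ℚ)
  (m≡′ : ℕtoℚ (numEdges G) ≡ t *ℚ (ℕtoℚ n ^ℚ (2 + w))) (t-large : ℕtoℚ (2 * (2 + κ) * (2 + w)) ≤ℚ t) where

  k m N s′ b′ : ℕ
  k = 2 + κ
  m = numEdges G
  N = n ^ (2 + w)

  instance
    N-nonZero : NonZero (2 * N)
    N-nonZero = m*n≢0 2 N {{_}} {{m^n≢0 n (2 + w) {{>-nonZero 1≤n}}}}
    n³-nonZero : NonZero (2 * n ^ 3)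
    n³-nonZero = m*n≢0 2 (n ^ 3) {{_}} {{m^n≢0 n 3 {{>-nonZero 1≤n}}}}

  -- Up to rounding, `s′` is t/2 and `b′` is (r-3) t n^(r-4) / 2: the largest thresholds for which
  -- pruning loses at most half of the ordered edges.
  s′ = m / (2 * N)
  b′ = (w * m) / (2 * n ^ 3)

  0≤t : 0ℚ ≤ℚ t
  0≤t = ℚP.≤-trans (0≤ℕtoℚ (2 * k * (2 + w))) t-large

  1≤N : 1 ≤ N
  1≤N = subst (_≤ N) (^-zeroˡ (2 + w)) (^-monoˡ-≤ (2 + w) 1≤n)

  N-pos : Positive (ℕtoℚ N)
  N-pos = ℕtoℚ-positive 1≤N

  m≡ : ℕtoℚ m ≡ t *ℚ ℕtoℚ N
  m≡ = trans m≡′ (cong (t *ℚ_) (sym (ℕtoℚ-^ n (2 + w))))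

  many : 2 * k * (2 + w) * N ≤ m
  many = ℕtoℚ-cancel (subst₂ _≤ℚ_ (sym (ℕtoℚ-* (2 * k * (2 + w)) N)) (sym m≡) (ℚP.*-monoʳ-≤-nonNeg (ℕtoℚ N) {{nonNegative (0≤ℕtoℚ N)}} t-large))

  s′-small : 2 * (s′ * N) ≤ m
  s′-small = ≤-trans (≤-reflexive (rearrange s′ N)) (m/n*n≤m m (2 * N))
    where
    rearrange : ∀ s N → 2 * (s * N) ≡ s * (2 * N)
    rearrange = solve-∀

  b′-small : 2 * (b′ * n ^ 3) ≤ w * m
  b′-small = ≤-trans (≤-reflexive (rearrange b′ (n ^ 3))) (m/n*n≤m (w * m) (2 * n ^ 3))
    where
    rearrange : ∀ s N → 2 * (s * N) ≡ s * (2 * N)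
    rearrange = solve-∀

  M≤s′ : k * (2 + w) ≤ s′
  M≤s′ = *≤⇒≤/ (2 * N) (≤-trans (≤-reflexive (rearrange k w N)) many)
    where
    rearrange : ∀ k w N → k * (2 + w) * (2 * N) ≡ 2 * k * (2 + w) * N
    rearrange = solve-∀

  -- As `meetCoeff n w` is w n^(w-1), the factor w occurs on both sides, and what remains is the
  -- bound |E(G)| ≥ 2k(r-1) n^(r-1) again.
  Mc≤b′ : k * (2 + w) * meetCoeff n w ≤ b′
  Mc≤b′ = *≤⇒≤/ (2 * n ^ 3) (begin
    k * (2 + w) * meetCoeff n w * (2 * n ^ 3)             ≡⟨ rearrange k w (meetCoeff n w) n ⟩
    2 * k * (2 + w) * (n * n * (n * meetCoeff n w))       ≡⟨ cong (λ x → 2 * k * (2 + w) * (n * n * x)) (n*meetCoeff n w) ⟩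
    2 * k * (2 + w) * (n * n * (w * n ^ w))               ≡⟨ rearrange′ (2 * k * (2 + w)) n w (n ^ w) ⟩
    w * (2 * k * (2 + w) * (n * (n * n ^ w)))             ≤⟨ *-monoʳ-≤ w many ⟩
    w * m                                                 ∎)
    where
    open ≤-Reasoning
    rearrange : ∀ k w c n → k * (2 + w) * c * (2 * (n * (n * (n * 1)))) ≡ 2 * k * (2 + w) * (n * n * (n * c))
    rearrange = solve-∀
    rearrange′ : ∀ x n w p → x * (n * n * (w * p)) ≡ w * (x * (n * (n * p)))
    rearrange′ = solve-∀

  big : ∀ q → k * (2 + w) * meetCoeff n (byCoord 1 w q) ≤ byCoord (suc s′) (suc b′) q
  big 3F = ≤-trans Mc≤b′ (n≤1+n b′)
  big 0F = core
    where
    core : k * (2 + w) * meetCoeff n 1 ≤ suc s′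
    core = ≤-trans (≤-reflexive (trans (cong (λ x → k * (2 + w) * (1 + x)) (*-zeroʳ n)) (*-identityʳ _))) (≤-trans M≤s′ (n≤1+n s′))
  big 1F = big 0F
  big 2F = big 0F

  t≤2s : t ≤ℚ ℕtoℚ (2 * suc s′)
  t≤2s = ℚP.*-cancelʳ-≤-pos (ℕtoℚ N) {{N-pos}} (subst₂ _≤ℚ_ m≡ (ℕtoℚ-* (2 * suc s′) N)
    (ℕtoℚ-mono (≤-trans (m≤[1+m/n]*n m (2 * N)) (≤-reflexive (rearrange (suc s′) N)))))
    where
    rearrange : ∀ s N → s * (2 * N) ≡ 2 * s * N
    rearrange = solve-∀

  N≤m : N ≤ m
  N≤m = ≤-trans (1≤n⇒m≤n*m {N} {2 * k * (2 + w)} (s≤s z≤n)) many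

  s≤t : ℕtoℚ (suc s′) ≤ℚ t
  s≤t = ℚP.*-cancelʳ-≤-pos (ℕtoℚ N) {{N-pos}} (subst₂ _≤ℚ_ (ℕtoℚ-* (suc s′) N) m≡ (ℕtoℚ-mono {suc s′ * N} {m} (*-cancelˡ-≤ 2 (begin
    2 * (suc s′ * N)             ≡⟨ rearrange s′ N ⟩
    2 * (s′ * N) + 2 * N         ≤⟨ +-mono-≤ s′-small 2N≤m ⟩
    m + m                        ≡⟨ cong (m +_) (+-identityʳ m) ⟨
    2 * m                        ∎))))
    where
    open ≤-Reasoning
    rearrange : ∀ s N → 2 * (suc s * N) ≡ 2 * (s * N) + 2 * N
    rearrange = solve-∀
    2N≤m : 2 * N ≤ m
    2N≤m = ≤-trans (*-monoˡ-≤ N {2} {2 * k * (2 + w)} (≤-trans (m≤m*n 2 (k * (2 + w))) (≤-reflexive (sym (*-assoc 2 k (2 + w)))))) many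

  block : BlockSize w n b′ t
  block = blockSize w n m b′ t 1≤n m≡ 0≤t b′-small (m≤[1+m/n]*n (w * m) (2 * n ^ 3)) N≤m

  β : ℚ
  β = proj₁ block

  D : ℚ
  D = Dval (3 + w) n t

  D≡ : D ≡ t *ℚ β
  D≡ = proj₁ (proj₂ block)

  0≤β : 0ℚ ≤ℚ β
  0≤β = proj₁ (proj₂ (proj₂ block))

  β≤2b : β ≤ℚ ℕtoℚ (2 * suc b′)
  β≤2b = proj₁ (proj₂ (proj₂ (proj₂ block)))

  b≤β : ℕtoℚ (suc b′) ≤ℚ ℕtoℚ (suc w) *ℚ β
  b≤β = proj₂ (proj₂ (proj₂ (proj₂ block)))

  D^ : ∀ e → D ^ℚ e ≡ t ^ℚ e *ℚ β ^ℚ e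
  D^ e = trans (cong (_^ℚ e) D≡) (^ℚ-distrib-* t β e)

  0≤D : 0ℚ ≤ℚ D
  0≤D = subst (0ℚ ≤ℚ_) (sym D≡) (0≤* 0≤t 0≤β)

  -- With D = tβ the left side is t^(2k-3) β^(k-1), the exponents of the greedy count; t ≤ 2s and β
  -- ≤ 2b then replace the real scales by the block sizes.
  scale≤ : t ^ℚ κ *ℚ D ^ℚ suc κ ≤ℚ ℕtoℚ (2 ^ κ * (2 ^ suc κ * 2 ^ suc κ) * (suc s′ ^ suc (κ + κ) * suc b′ ^ suc κ))
  scale≤ = begin
    t ^ℚ κ *ℚ D ^ℚ suc κ
      ≡⟨ cong (t ^ℚ κ *ℚ_) (D^ (suc κ)) ⟩
    t ^ℚ κ *ℚ (t ^ℚ suc κ *ℚ β ^ℚ suc κ)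
      ≤⟨ *ℚ-mono (0≤^ κ 0≤t) (0≤* (0≤^ (suc κ) (0≤ℕtoℚ (2 * s))) (0≤^ (suc κ) (0≤ℕtoℚ (2 * b)))) (^ℚ-mono κ 0≤t t≤2s)
           (*ℚ-mono (0≤^ (suc κ) 0≤t) (0≤^ (suc κ) (0≤ℕtoℚ (2 * b))) (^ℚ-mono (suc κ) 0≤t t≤2s) (^ℚ-mono (suc κ) 0≤β β≤2b)) ⟩
    ℕtoℚ (2 * s) ^ℚ κ *ℚ (ℕtoℚ (2 * s) ^ℚ suc κ *ℚ ℕtoℚ (2 * b) ^ℚ suc κ)
      ≡⟨ cong₂ _*ℚ_ (ℕtoℚ-^ (2 * s) κ) (cong₂ _*ℚ_ (ℕtoℚ-^ (2 * s) (suc κ)) (ℕtoℚ-^ (2 * b) (suc κ))) ⟨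
    ℕtoℚ ((2 * s) ^ κ) *ℚ (ℕtoℚ ((2 * s) ^ suc κ) *ℚ ℕtoℚ ((2 * b) ^ suc κ))
      ≡⟨ cong (ℕtoℚ ((2 * s) ^ κ) *ℚ_) (ℕtoℚ-* ((2 * s) ^ suc κ) ((2 * b) ^ suc κ)) ⟨
    ℕtoℚ ((2 * s) ^ κ) *ℚ ℕtoℚ ((2 * s) ^ suc κ * (2 * b) ^ suc κ)
      ≡⟨ ℕtoℚ-* ((2 * s) ^ κ) ((2 * s) ^ suc κ * (2 * b) ^ suc κ) ⟨
    ℕtoℚ ((2 * s) ^ κ * ((2 * s) ^ suc κ * (2 * b) ^ suc κ))
      ≡⟨ cong ℕtoℚ powers ⟩
    ℕtoℚ (2 ^ κ * (2 ^ suc κ * 2 ^ suc κ) * (s ^ suc (κ + κ) * b ^ suc κ)) ∎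
    where
    open ℚP.≤-Reasoning
    s = suc s′
    b = suc b′
    rearrange : ∀ p x q y s → p * x * (q * (s * x) * (q * y)) ≡ p * (q * q) * (s * (x * x) * y)
    rearrange = solve-∀
    powers : (2 * s) ^ κ * ((2 * s) ^ suc κ * (2 * b) ^ suc κ) ≡ 2 ^ κ * (2 ^ suc κ * 2 ^ suc κ) * (s ^ suc (κ + κ) * b ^ suc κ)
    powers = trans (cong₂ _*_ (^-distribʳ-* κ 2 s) (cong₂ _*_ (^-distribʳ-* (suc κ) 2 s) (^-distribʳ-* (suc κ) 2 b)))
      (trans (rearrange (2 ^ κ) (s ^ κ) (2 ^ suc κ) (b ^ suc κ) s)
        (cong (λ x → 2 ^ κ * (2 ^ suc κ * 2 ^ suc κ) * (s * x * b ^ suc κ)) (sym (^-distribˡ-+-* s κ κ))))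

  average : ∀ {Kn} (Kpos : Positive (ℕtoℚ Kn)) → lowerFactor κ w ≤ Kn → (H : CycleHGraph k G) →
    m * (suc s′ ^ suc (κ + κ) * suc b′ ^ suc κ) ≤ lowerConstant κ w * length (hedges H) →
    inv (ℕtoℚ Kn) Kpos *ℚ (t ^ℚ κ) *ℚ (D ^ℚ suc κ) ≤ℚ avgDeg H
  average {Kn} Kpos factor≤ H lower = begin
    K⁻¹ *ℚ (t ^ℚ κ) *ℚ (D ^ℚ suc κ)       ≡⟨ ℚP.*-assoc K⁻¹ (t ^ℚ κ) (D ^ℚ suc κ) ⟩
    K⁻¹ *ℚ ((t ^ℚ κ) *ℚ (D ^ℚ suc κ))     ≤⟨ ℚP.*-monoˡ-≤-nonNeg K⁻¹ {{ℚP.pos⇒nonNeg K⁻¹ {{ℚP.1/pos⇒pos K {{Kpos}}}}}} X≤ ⟩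
    K⁻¹ *ℚ (K *ℚ avgDeg H)                ≡⟨ ℚP.*-assoc K⁻¹ K (avgDeg H) ⟨
    K⁻¹ *ℚ K *ℚ avgDeg H                  ≡⟨ cong (_*ℚ avgDeg H) (ℚP.*-inverseˡ K {{ℚP.pos⇒nonZero K {{Kpos}}}}) ⟩
    1ℚ *ℚ avgDeg H                        ≡⟨ ℚP.*-identityˡ (avgDeg H) ⟩
    avgDeg H                              ∎
    where
    K = ℕtoℚ Kn
    K⁻¹ = inv K Kpos
    h = length (hedges H)
    P = 2 ^ κ * (2 ^ suc κ * 2 ^ suc κ)
    c = suc s′ ^ suc (κ + κ) * suc b′ ^ suc κ
    1≤m : 1 ≤ m
    1≤m = ≤-trans 1≤N N≤m
    counts : P * c * m ≤ Kn * (k * h)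
    counts = N.begin
      P * c * m                                N.≡⟨ trans (*-assoc P c m) (cong (P *_) (*-comm c m)) ⟩
      P * (m * c)                              N.≤⟨ *-monoʳ-≤ P lower ⟩
      P * (lowerConstant κ w * h)              N.≡⟨ *-assoc P (lowerConstant κ w) h ⟨
      lowerFactor κ w * h                      N.≤⟨ *-mono-≤ factor≤ (1≤n⇒m≤n*m {h} {k} (s≤s z≤n)) ⟩
      Kn * (k * h)                             N.∎
      where module N = ≤-Reasoning
    open ℚP.≤-Reasoning
    X≤ : (t ^ℚ κ) *ℚ (D ^ℚ suc κ) ≤ℚ K *ℚ avgDeg H
    X≤ = ℚP.*-cancelʳ-≤-pos (ℕtoℚ m) {{ℕtoℚ-positive 1≤m}} (begin
      (t ^ℚ κ) *ℚ (D ^ℚ suc κ) *ℚ ℕtoℚ m   ≤⟨ ℚP.*-monoʳ-≤-nonNeg (ℕtoℚ m) {{nonNegative (0≤ℕtoℚ m)}} scale≤ ⟩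
      ℕtoℚ (P * c) *ℚ ℕtoℚ m               ≡⟨ ℕtoℚ-* (P * c) m ⟨
      ℕtoℚ (P * c * m)                     ≤⟨ ℕtoℚ-mono counts ⟩
      ℕtoℚ (Kn * (k * h))                  ≡⟨ ℕtoℚ-* Kn (k * h) ⟩
      K *ℚ ℕtoℚ (k * h)                    ≡⟨ cong (K *ℚ_) (avgDeg*numEdges G H 1≤m) ⟨
      K *ℚ (avgDeg H *ℚ ℕtoℚ m)            ≡⟨ ℚP.*-assoc K (avgDeg H) (ℕtoℚ m) ⟨
      K *ℚ avgDeg H *ℚ ℕtoℚ m              ∎)

  -- The comparison runs the other way here, through s ≤ t and b ≤ (r-2)β. The target t^(k-j-1)
  -- D^(k-j) splits into k - j - 1 factors t for the roles `X`, k - j for `Y`, and k - j factors β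
  -- for `W`.
  maximum : ∀ {Kn} → upperFactor κ w ≤ Kn → ∀ j → j ≤ k → ∀ {δ} → δ ≤ k ^ j * degreeBound k (3 + w) (suc s′) (suc b′) j →
    ℕtoℚ δ ≤ℚ ℕtoℚ Kn *ℚ (t ^ℚ (k ∸ j ∸ 1)) *ℚ (D ^ℚ (k ∸ j))
  maximum {Kn} factor≤ j j≤ {δ} δ≤ = begin
    ℕtoℚ δ
      ≤⟨ ℕtoℚ-mono δ≤ ⟩
    ℕtoℚ (k ^ j * degreeBound k (3 + w) s b j)
      ≡⟨ cong ℕtoℚ (degreeBound-split κ w s b j) ⟩
    ℕtoℚ (pre * (s ^ e′ * (s ^ e * b ^ e)))
      ≡⟨ trans (ℕtoℚ-* pre _) (cong (ℕtoℚ pre *ℚ_) (trans (ℕtoℚ-* (s ^ e′) _) (cong (ℕtoℚ (s ^ e′) *ℚ_) (ℕtoℚ-* (s ^ e) (b ^ e))))) ⟩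
    ℕtoℚ pre *ℚ (ℕtoℚ (s ^ e′) *ℚ (ℕtoℚ (s ^ e) *ℚ ℕtoℚ (b ^ e)))
      ≡⟨ cong (ℕtoℚ pre *ℚ_) (cong₂ _*ℚ_ (ℕtoℚ-^ s e′) (cong₂ _*ℚ_ (ℕtoℚ-^ s e) (ℕtoℚ-^ b e))) ⟩
    ℕtoℚ pre *ℚ (ℕtoℚ s ^ℚ e′ *ℚ (ℕtoℚ s ^ℚ e *ℚ ℕtoℚ b ^ℚ e))
      ≤⟨ ℚP.*-monoˡ-≤-nonNeg (ℕtoℚ pre) {{nonNegative (0≤ℕtoℚ pre)}}
           (*ℚ-mono (0≤^ e′ (0≤ℕtoℚ s)) (0≤* (0≤^ e 0≤t) (0≤^ e (0≤* (0≤ℕtoℚ (suc w)) 0≤β))) (^ℚ-mono e′ (0≤ℕtoℚ s) s≤t)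
             (*ℚ-mono (0≤^ e (0≤ℕtoℚ s)) (0≤^ e (0≤* (0≤ℕtoℚ (suc w)) 0≤β)) (^ℚ-mono e (0≤ℕtoℚ s) s≤t) (^ℚ-mono e (0≤ℕtoℚ b) b≤β))) ⟩
    ℕtoℚ pre *ℚ (t ^ℚ e′ *ℚ (t ^ℚ e *ℚ (ℕtoℚ (suc w) *ℚ β) ^ℚ e))
      ≡⟨ cong (λ x → ℕtoℚ pre *ℚ (t ^ℚ e′ *ℚ (t ^ℚ e *ℚ x))) (^ℚ-distrib-* (ℕtoℚ (suc w)) β e) ⟩
    ℕtoℚ pre *ℚ (t ^ℚ e′ *ℚ (t ^ℚ e *ℚ (ℕtoℚ (suc w) ^ℚ e *ℚ β ^ℚ e)))
      ≡⟨ rearrange (ℕtoℚ pre) (t ^ℚ e′) (t ^ℚ e) (ℕtoℚ (suc w) ^ℚ e) (β ^ℚ e) ⟩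
    ℕtoℚ pre *ℚ ℕtoℚ (suc w) ^ℚ e *ℚ t ^ℚ e′ *ℚ (t ^ℚ e *ℚ β ^ℚ e)
      ≡⟨ cong₂ (λ x y → x *ℚ t ^ℚ e′ *ℚ y) (trans (cong (ℕtoℚ pre *ℚ_) (sym (ℕtoℚ-^ (suc w) e))) (sym (ℕtoℚ-* pre (suc w ^ e)))) (sym (D^ e)) ⟩
    ℕtoℚ (pre * suc w ^ e) *ℚ t ^ℚ e′ *ℚ D ^ℚ e
      ≤⟨ ℚP.*-monoʳ-≤-nonNeg (D ^ℚ e) {{nonNegative (0≤^ e 0≤D)}} (ℚP.*-monoʳ-≤-nonNeg (t ^ℚ e′) {{nonNegative (0≤^ e′ 0≤t)}}
           (ℕtoℚ-mono (≤-trans (prefactor≤ κ w j j≤) factor≤))) ⟩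
    ℕtoℚ Kn *ℚ t ^ℚ e′ *ℚ D ^ℚ e ∎
    where
    open ℚP.≤-Reasoning
    s = suc s′
    b = suc b′
    e = k ∸ j
    e′ = k ∸ j ∸ 1
    pre = prefactor κ w j
    rearrange : ∀ p x y v z → p *ℚ (x *ℚ (y *ℚ (v *ℚ z))) ≡ p *ℚ v *ℚ x *ℚ (y *ℚ z)
    rearrange = solve 5 (λ p x y v z → p :* (x :* (y :* (v :* z))) := p :* v :* x :* (y :* z)) refl
      where open ℚSolver.+-*-Solver

  Conclusion : (Kn : ℕ) → Positive (ℕtoℚ Kn) → CycleHGraph k G → Set
  Conclusion Kn Kpos H =
    (inv (ℕtoℚ Kn) Kpos *ℚ (t ^ℚ κ) *ℚ (D ^ℚ suc κ) ≤ℚ avgDeg H)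
    × ((j : ℕ) → 1 ≤ j → j ≤ suc κ → ℕtoℚ (Δ H j) ≤ℚ ℕtoℚ Kn *ℚ (t ^ℚ (k ∸ j ∸ 1)) *ℚ (D ^ℚ (k ∸ j)))

  conclude : ∀ Kn (Kpos : Positive (ℕtoℚ Kn)) → lowerFactor κ w ≤ Kn → upperFactor κ w ≤ Kn →
    (Σ (CycleHGraph k G) λ H →
      m * (suc s′ ^ suc (κ + κ) * suc b′ ^ suc κ) ≤ lowerConstant κ w * length (hedges H) ×
      (∀ j → 1 ≤ j → Δ H j ≤ k ^ j * degreeBound k (3 + w) (suc s′) (suc b′) j)) →
    Σ (CycleHGraph k G) (Conclusion Kn Kpos)
  conclude Kn Kpos lower≤ upper≤ (H , lower , upper) =
    H , average {Kn} Kpos lower≤ H lower , λ j 1≤j j≤ → maximum {Kn} upper≤ j (≤-trans j≤ (n≤1+n (suc κ))) {Δ H j} (upper j 1≤j)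

  result : ∀ Kn (Kpos : Positive (ℕtoℚ Kn)) → lowerFactor κ w ≤ Kn → upperFactor κ w ≤ Kn → Σ (CycleHGraph k G) (Conclusion Kn Kpos)
  result Kn Kpos lower≤ upper≤ = conclude Kn Kpos lower≤ upper≤ (balanced κ G s′ b′ s′-small b′-small big)

theorem3p1 : (r k : ℕ) → 3 ≤ r → 3 ≤ k →
    Σ ℚ λ K → Σ (Positive K) λ Kpos →
    (n : ℕ) → 1 ≤ n → (G : RGraph r n) → (t : ℚ) →
    ℕtoℚ (numEdges G) ≡ t *ℚ (ℕtoℚ n ^ℚ (r ∸ 1)) →
    ℕtoℚ (2 * k * (r ∸ 1)) ≤ℚ t →
    Σ (CycleHGraph k G) λ H →
    (inv K Kpos *ℚ (t ^ℚ (k ∸ 2)) *ℚ (Dval r n t ^ℚ (k ∸ 1)) ≤ℚ avgDeg H)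
    × ((j : ℕ) → 1 ≤ j → j ≤ k ∸ 1 →
    ℕtoℚ (Δ H j) ≤ℚ K *ℚ (t ^ℚ (k ∸ j ∸ 1)) *ℚ (Dval r n t ^ℚ (k ∸ j)))
theorem3p1 (suc (suc (suc w))) (suc (suc κ)) (s≤s (s≤s (s≤s _))) (s≤s (s≤s _)) =
  ℕtoℚ Kn , Kpos , λ n 1≤n G t m≡ t-large →
    Estimates.result κ w n 1≤n G t m≡ t-large Kn Kpos
      (≤-trans (m≤m+n (lowerFactor κ w) (upperFactor κ w)) (n≤1+n _)) (≤-trans (m≤n+m (upperFactor κ w) (lowerFactor κ w)) (n≤1+n _))
  where
  Kn : ℕ
  -- The sum dominates both constants at once, and the successor makes positivity immediate.
  Kn = suc (lowerFactor κ w + upperFactor κ w)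
  Kpos : Positive (ℕtoℚ Kn)
  Kpos = ℕtoℚ-positive {Kn} (s≤s z≤n)
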